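{- Let $l\neq 2$ be a prime number and let $\mathfrak H_{l^3}$ be the Heisenberg group, i.e. the non-commutative group of order $l^3$ and exponent $l$. Then for every local field $K$ whose residue field is finite of characteristic $p\neq l$, there is no finite Galois extension $L$ of $K$ with $\mathrm{Gal}(L|K)$ isomorphic to $\mathfrak H_{l^3}$.
   Context: A local field is a field complete for a discrete valuation with finite residue field. For an odd prime $l$ there are, up to isomorphism, exactly two non-commutative groups of order $l^3$, one of exponent $l$ (denoted $\mathfrak H_{l^3}$) and one of exponent $l^2$. -}

module Defs where

open import Algebra.Bundles using (AbelianGroup; CommutativeRing; Group)
open import Algebra.Definitions using (Commutative)
open import Algebra.Morphism.Structures
  using (IsRingHomomorphism; IsRingIsomorphism; IsGroupIsomorphism)
import Algebra.Construct.NaturalChoice.Min as Min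
import Algebra.Definitions.RawMonoid as RawMonoidOps
import Algebra.Morphism.Construct.Composition as Composition
import Algebra.Morphism.Construct.Identity as Identity
import Algebra.Properties.Group as GroupProperties
import Algebra.Properties.Ring as RingProperties
import Algebra.Properties.CommutativeSemigroup as CommutativeSemigroupProperties
open import Data.Fin.Base using (Fin)
open import Data.Integer.Base as ℤ using (ℤ; 0ℤ; 1ℤ)
import Data.Integer.Properties as ℤₚ
open import Data.Nat.Base as ℕ using (ℕ)
open import Data.Nat.Divisibility using (_∣_)
open import Data.Product.Base using (Σ; ∃; _,_; proj₁; proj₂)
open import Data.Product using (∃!)
open import Data.Vec.Functional using (Vector)
open import Data.Vec.Functional.Relation.Binary.Pointwise using (Pointwise)
open import Function.Base using (_∘_; id)
open import Function.Bundles using (Inverse; Equivalence; _⇔_)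
open import Level using (Level; _⊔_; suc)
open import Relation.Binary.Bundles using (Setoid; TotalOrder)
open import Relation.Binary.Construct.Add.Supremum.NonStrict ℤ._≤_
  using (_≤⁺_; [_]; _≤⊤⁺; ≤⁺-trans; ≤⁺-isTotalOrder-≡)
open import Relation.Binary.Structures using (IsEquivalence)
open import Relation.Binary.PropositionalEquality as ≡ using (_≡_)
open import Relation.Nullary.Construct.Add.Supremum using (_⁺; ⊤⁺; [_])
open import Relation.Nullary.Negation using (¬_; contradiction)

private
  variable
    a b c ℓ c′ ℓ′ : Level

------------------------------------------------------------------------
-- Finite setoids and groups

HasCardinality : Setoid c ℓ → ℕ → Set (c ⊔ ℓ)
HasCardinality S n = Inverse S (≡.setoid (Fin n))

module _ (G : Group c ℓ) where
  open Group G
  -- The operation of G is written additively by this module: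
  -- n × x is the n-th power of x.
  private module Power = RawMonoidOps rawMonoid

  KilledBy : ℕ → Set (c ⊔ ℓ)
  KilledBy n = ∀ x → n Power.× x ≈ ε

  record HasExponent (n : ℕ) : Set (c ⊔ ℓ) where
    field
      positive : 0 ℕ.< n
      kills    : KilledBy n
      least    : ∀ m → 0 ℕ.< m → KilledBy m → n ℕ.≤ m

  -- For an odd prime l these properties determine the group up to isomorphism.
  record IsHeisenberg (l : ℕ) : Set (c ⊔ ℓ) where
    field
      nonCommutative : ¬ Commutative _≈_ _∙_
      order          : HasCardinality setoid (l ℕ.^ 3)
      exponent       : HasExponent l

infix 4 _≅_

_≅_ : Group a b → Group c ℓ → Set (a ⊔ b ⊔ c ⊔ ℓ)
G ≅ H = ∃ (IsGroupIsomorphism (Group.rawGroup G) (Group.rawGroup H))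

------------------------------------------------------------------------
-- Fields

-- The library only has Heyting fields, which carry an extra apartness
-- relation; this is the usual notion.
record Field c ℓ : Set (suc (c ⊔ ℓ)) where
  field
    commutativeRing : CommutativeRing c ℓ
  open CommutativeRing commutativeRing public
  field
    1≉0     : ¬ 1# ≈ 0#
    inverse : ∀ x → ¬ x ≈ 0# → ∃ λ y → x * y ≈ 1#

HasCharacteristic : Field c ℓ → ℕ → Set ℓ
HasCharacteristic F p = ∀ n → (n ·1 ≈ 0#) ⇔ p ∣ n
  where
  open Field F
  _·1 : ℕ → Carrier
  n ·1 = RawMonoidOps._×_ +-rawMonoid n 1#

------------------------------------------------------------------------
-- ℤ ∪ {∞}, with ∞ = ⊤⁺

infixl 6 _+⁺_

_+⁺_ : ℤ ⁺ → ℤ ⁺ → ℤ ⁺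
[ m ] +⁺ [ n ] = [ m ℤ.+ n ]
[ _ ] +⁺ ⊤⁺    = ⊤⁺
⊤⁺    +⁺ _     = ⊤⁺

ℤ⁺-totalOrder : TotalOrder _ _ _
ℤ⁺-totalOrder = record { isTotalOrder = ≤⁺-isTotalOrder-≡ ℤₚ.≤-isTotalOrder }

open Min ℤ⁺-totalOrder using (_⊓_; ⊓-glb)

private
  ≤-trans⁺ : ∀ {x y z} → x ≤⁺ y → y ≤⁺ z → x ≤⁺ z
  ≤-trans⁺ = ≤⁺-trans ℤₚ.≤-trans

  +⁺-mono : ∀ {m n x y} → [ m ] ≤⁺ x → [ n ] ≤⁺ y → [ m ℤ.+ n ] ≤⁺ x +⁺ y
  +⁺-mono [ p ]      [ q ]      = [ ℤₚ.+-mono-≤ p q ]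
  +⁺-mono [ p ]      (_ ≤⊤⁺)    = _ ≤⊤⁺
  +⁺-mono (_ ≤⊤⁺)    _          = _ ≤⊤⁺

  double-zero : ∀ (i : ℤ) → i ℤ.+ i ≡ 0ℤ → i ≡ 0ℤ
  double-zero (ℤ.+ 0)       _  = ≡.refl
  double-zero (ℤ.+ ℕ.suc _) ()
  double-zero ℤ.-[1+ _ ]    ()

  []-injective : ∀ {i j : ℤ} → _≡_ {A = ℤ ⁺} [ i ] [ j ] → i ≡ j
  []-injective ≡.refl = ≡.refl

  double-zero⁺ : ∀ x → x +⁺ x ≡ [ 0ℤ ] → x ≡ [ 0ℤ ]
  double-zero⁺ [ i ] eq = ≡.cong [_] (double-zero i ([]-injective eq))

  idem⇒zero⁺ : ∀ x → ¬ x ≡ ⊤⁺ → x ≡ x +⁺ x → x ≡ [ 0ℤ ]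
  idem⇒zero⁺ ⊤⁺    x≢⊤ _  = contradiction ≡.refl x≢⊤
  idem⇒zero⁺ [ i ] _   eq = ≡.cong [_] (identityˡ-unique i i (≡.sym ([]-injective eq)))
    where open GroupProperties (AbelianGroup.group ℤₚ.+-0-abelianGroup) using (identityˡ-unique)

------------------------------------------------------------------------
-- Discretely valued fields

-- Normalised: the value group is all of ℤ.
record IsDiscreteValuation (K : Field c ℓ) (v : Field.Carrier K → ℤ ⁺) : Set (c ⊔ ℓ) where
  open Field K
  field
    v-cong       : ∀ {x y} → x ≈ y → v x ≡ v y
    v-∞          : ∀ x → v x ≡ ⊤⁺ ⇔ x ≈ 0#
    v-*          : ∀ x y → v (x * y) ≡ v x +⁺ v y
    v-+          : ∀ x y → v x ⊓ v y ≤⁺ v (x + y)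
    v-surjective : ∀ n → ∃ λ x → v x ≡ [ n ]

module _ (K : Field c ℓ) (v : Field.Carrier K → ℤ ⁺) where
  open Field K

  IsCauchy : (ℕ → Carrier) → Set
  IsCauchy s = ∀ (N : ℤ) → ∃ λ M → ∀ m n → M ℕ.≤ m → M ℕ.≤ n → [ N ] ≤⁺ v (s m - s n)

  ConvergesTo : (ℕ → Carrier) → Carrier → Set
  ConvergesTo s x = ∀ (N : ℤ) → ∃ λ M → ∀ n → M ℕ.≤ n → [ N ] ≤⁺ v (s n - x)

  IsComplete : Set c
  IsComplete = ∀ s → IsCauchy s → ∃ (ConvergesTo s)

-- The residue field 𝒪/𝔪, where 𝒪 = {v ≥ 0} and 𝔪 = {v ≥ 1}: its elements
-- are those of 𝒪, and x and y are equal in it when x - y lies in 𝔪.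
module Residue {K : Field c ℓ} {v : Field.Carrier K → ℤ ⁺}
               (isDiscreteValuation : IsDiscreteValuation K v) where
  open Field K
  open IsDiscreteValuation isDiscreteValuation
  open RingProperties ring
  open CommutativeSemigroupProperties +-commutativeSemigroup using (interchange)

  private
    v1 : v 1# ≡ [ 0ℤ ]
    v1 = idem⇒zero⁺ (v 1#) (1≉0 ∘ Equivalence.to (v-∞ 1#))
           (≡.trans (v-cong (sym (*-identityˡ 1#))) (v-* 1# 1#))

    v-neg1 : v (- 1#) ≡ [ 0ℤ ]
    v-neg1 = double-zero⁺ _ (≡.trans (≡.sym (v-* (- 1#) (- 1#)))
      (≡.trans (v-cong (trans (-1*x≈-x (- 1#)) (-‿involutive 1#))) v1))

    Above : ℤ → Carrier → Set
    Above n x = [ n ] ≤⁺ v x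

    above-cong : ∀ {n x y} → x ≈ y → Above n x → Above n y
    above-cong x≈y = ≡.subst (_ ≤⁺_) (v-cong x≈y)

    above-0 : ∀ {n} → Above n 0#
    above-0 = ≡.subst (_ ≤⁺_) (≡.sym (Equivalence.from (v-∞ 0#) refl)) (_ ≤⊤⁺)

    above-1 : Above 0ℤ 1#
    above-1 = ≡.subst (_ ≤⁺_) (≡.sym v1) [ ℤₚ.≤-refl ]

    above-+ : ∀ {n x y} → Above n x → Above n y → Above n (x + y)
    above-+ p q = ≤-trans⁺ (⊓-glb p q) (v-+ _ _)

    above-* : ∀ {m n x y} → Above m x → Above n y → Above (m ℤ.+ n) (x * y)
    above-* p q = ≡.subst (_ ≤⁺_) (≡.sym (v-* _ _)) (+⁺-mono p q)

    above-neg : ∀ {n x} → Above n x → Above n (- x)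
    above-neg {n} {x} p = above-cong (-1*x≈-x x)
      (≡.subst (λ k → Above k (- 1# * x)) (ℤₚ.+-identityˡ n)
        (above-* {0ℤ} (≡.subst (_ ≤⁺_) (≡.sym v-neg1) [ ℤₚ.≤-refl ]) p))

  𝒪 : Set c
  𝒪 = Σ Carrier λ x → [ 0ℤ ] ≤⁺ v x

  infix 4 _∼_

  _∼_ : 𝒪 → 𝒪 → Set
  (x , _) ∼ (y , _) = [ 1ℤ ] ≤⁺ v (x - y)

  private
    ≈⇒∼ : ∀ {x y} → x ≈ y → Above 1ℤ (x - y)
    ≈⇒∼ x≈y = above-cong (sym (trans (+-congʳ x≈y) (-‿inverseʳ _))) above-0

    sub-trans : ∀ x y z → (x - y) + (y - z) ≈ x - z
    sub-trans x y z = trans (+-assoc x (- y) (y - z)) (+-congˡ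
      (trans (sym (+-assoc (- y) y (- z)))
        (trans (+-congʳ (-‿inverseˡ y)) (+-identityˡ (- z)))))

    ∼-isEquivalence : IsEquivalence _∼_
    ∼-isEquivalence = record
      { refl  = ≈⇒∼ refl
      ; sym   = λ p → above-cong (⁻¹-anti-homo‿- _ _) (above-neg p)
      ; trans = λ p q → above-cong (sub-trans _ _ _) (above-+ p q)
      }

    ∼-+-cong : ∀ {x y u w} → Above 1ℤ (x - y) → Above 1ℤ (u - w) →
               Above 1ℤ ((x + u) - (y + w))
    ∼-+-cong p q = above-cong
      (trans (interchange _ _ _ _) (+-congˡ (-‿+-comm _ _)))
      (above-+ p q)

    ∼-neg-cong : ∀ {x y} → Above 1ℤ (x - y) → Above 1ℤ (- x - - y)
    ∼-neg-cong p = above-cong (sym (-‿+-comm _ _)) (above-neg p)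

    ∼-*-cong : ∀ {x y u w} → Above 0ℤ u → Above 0ℤ y →
               Above 1ℤ (x - y) → Above 1ℤ (u - w) →
               Above 1ℤ (x * u - y * w)
    ∼-*-cong {x} {y} {u} {w} pu py p q = above-cong
      (trans (+-cong ([y-z]x≈yx-zx u x y) (x[y-z]≈xy-xz y u w))
        (sub-trans (x * u) (y * u) (y * w)))
      (above-+ (above-* {1ℤ} {0ℤ} p pu) (above-* {0ℤ} {1ℤ} py q))

  residueRing : CommutativeRing _ _
  residueRing = record
    { Carrier = 𝒪
    ; _≈_     = _∼_
    ; _+_     = λ (x , p) (y , q) → x + y , above-+ p q
    ; _*_     = λ (x , p) (y , q) → x * y , above-* {0ℤ} {0ℤ} p q
    ; -_      = λ (x , p) → - x , above-neg p
    ; 0#      = 0# , above-0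
    ; 1#      = 1# , above-1
    ; isCommutativeRing = record
      { isRing = record
        { +-isAbelianGroup = record
          { isGroup = record
            { isMonoid = record
              { isSemigroup = record
                { isMagma = record
                  { isEquivalence = ∼-isEquivalence
                  ; ∙-cong = ∼-+-cong
                  }
                ; assoc = λ _ _ _ → ≈⇒∼ (+-assoc _ _ _)
                }
              ; identity = (λ _ → ≈⇒∼ (+-identityˡ _)) , (λ _ → ≈⇒∼ (+-identityʳ _))
              }
            ; inverse = (λ _ → ≈⇒∼ (-‿inverseˡ _)) , (λ _ → ≈⇒∼ (-‿inverseʳ _))
            ; ⁻¹-cong = ∼-neg-cong
            }
          ; comm = λ _ _ → ≈⇒∼ (+-comm _ _)
          }
        ; *-cong = λ {_} {y} {u} p q → ∼-*-cong (proj₂ u) (proj₂ y) p q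
        ; *-assoc = λ _ _ _ → ≈⇒∼ (*-assoc _ _ _)
        ; *-identity = (λ _ → ≈⇒∼ (*-identityˡ _)) , (λ _ → ≈⇒∼ (*-identityʳ _))
        ; distrib = (λ _ _ _ → ≈⇒∼ (distribˡ _ _ _)) , (λ _ _ _ → ≈⇒∼ (distribʳ _ _ _))
        }
      ; *-comm = λ _ _ → ≈⇒∼ (*-comm _ _)
      }
    }

  private
    -0-id : ∀ x → x - 0# ≈ x
    -0-id x = trans (+-congˡ -0#≈0#) (+-identityʳ x)

    unit⁺ : ∀ {x y} → [ 0ℤ ] ≤⁺ x → ¬ [ 1ℤ ] ≤⁺ x → x +⁺ y ≡ [ 0ℤ ] → [ 0ℤ ] ≤⁺ y
    unit⁺ {⊤⁺} _ ¬p _ = contradiction (_ ≤⊤⁺) ¬p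
    unit⁺ {[ ℤ.+ ℕ.suc n ]} _ ¬p _ = contradiction [ ℤ.+≤+ (ℕ.s≤s ℕ.z≤n) ] ¬p
    unit⁺ {[ ℤ.+ 0 ]} {[ j ]} _ _ eq =
      ≡.subst ([ 0ℤ ] ≤⁺_) (≡.trans (≡.sym eq) (≡.cong [_] (ℤₚ.+-identityˡ j))) [ ℤₚ.≤-refl ]
    unit⁺ {[ ℤ.+ 0 ]} {⊤⁺} _ _ ()
    unit⁺ {[ ℤ.-[1+ _ ] ]} [ () ] _ _

  residueField : Field _ _
  residueField = record
    { commutativeRing = residueRing
    ; 1≉0     = λ p → ¬1≤0 (≡.subst ([ 1ℤ ] ≤⁺_) (≡.trans (v-cong (-0-id 1#)) v1) p)
    ; inverse = inv
    }
    where
    ¬1≤0 : ¬ [ 1ℤ ] ≤⁺ [ 0ℤ ]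
    ¬1≤0 [ ℤ.+≤+ () ]

    inv : ∀ (x : 𝒪) → ¬ Above 1ℤ (proj₁ x - 0#) → ∃ λ (y : 𝒪) → Above 1ℤ (proj₁ x * proj₁ y - 1#)
    inv (x , p) x≁0 = (y , unit⁺ p ¬x∈𝔪 vxy) , ≈⇒∼ xy≈1
      where
      ¬x∈𝔪 : ¬ Above 1ℤ x
      ¬x∈𝔪 = x≁0 ∘ above-cong (sym (-0-id x))
      x⁻¹ = inverse x (λ x≈0 → ¬x∈𝔪 (above-cong (sym x≈0) above-0))
      y = proj₁ x⁻¹
      xy≈1 = proj₂ x⁻¹
      vxy : v x +⁺ v y ≡ [ 0ℤ ]
      vxy = ≡.trans (≡.sym (v-* x y)) (≡.trans (v-cong xy≈1) v1)

record LocalField c ℓ : Set (suc (c ⊔ ℓ)) where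
  field
    baseField           : Field c ℓ
    v                   : Field.Carrier baseField → ℤ ⁺
    isDiscreteValuation : IsDiscreteValuation baseField v
    isComplete          : IsComplete baseField v
  open Residue isDiscreteValuation using (residueField) public
  field
    residueFinite       : ∃ (HasCardinality (Field.setoid residueField))

------------------------------------------------------------------------
-- Galois extensions

record FieldExtension (K : Field c ℓ) c′ ℓ′ : Set (c ⊔ ℓ ⊔ suc (c′ ⊔ ℓ′)) where
  field
    top                : Field c′ ℓ′
    ι                  : Field.Carrier K → Field.Carrier top
    isRingHomomorphism : IsRingHomomorphism (Field.rawRing K) (Field.rawRing top) ι

module _ {K : Field c ℓ} (E : FieldExtension K c′ ℓ′) where
  open FieldExtension E
  private
    module K = Field K
    module L = Field top

  -- b is a K-basis of L.
  IsBasis : ∀ {n} → Vector L.Carrier n → Set (c ⊔ ℓ ⊔ c′ ⊔ ℓ′)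
  IsBasis {n} b = ∀ x → ∃! (Pointwise K._≈_ {n = n}) λ a →
    x L.≈ RawMonoidOps.sum L.+-rawMonoid (λ i → ι (a i) L.* b i)

  IsFinite : Set (c ⊔ ℓ ⊔ c′ ⊔ ℓ′)
  IsFinite = ∃ λ n → ∃ λ (b : Vector L.Carrier n) → IsBasis b

  record Automorphism : Set (c ⊔ c′ ⊔ ℓ′) where
    field
      ⟦_⟧               : L.Carrier → L.Carrier
      isRingIsomorphism : IsRingIsomorphism L.rawRing L.rawRing ⟦_⟧
      fixes             : ∀ k → ⟦ ι k ⟧ L.≈ ι k
    open IsRingIsomorphism isRingIsomorphism public

  open Automorphism using (⟦_⟧)

  private
    infix 4 _≋_
    _≋_ : Automorphism → Automorphism → Set (c′ ⊔ ℓ′)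
    σ ≋ τ = ∀ x → ⟦ σ ⟧ x L.≈ ⟦ τ ⟧ x

    _∘ᴬ_ : Automorphism → Automorphism → Automorphism
    σ ∘ᴬ τ = record
      { ⟦_⟧   = ⟦ σ ⟧ ∘ ⟦ τ ⟧
      ; isRingIsomorphism =
          Composition.isRingIsomorphism L.trans τ.isRingIsomorphism σ.isRingIsomorphism
      ; fixes = λ k → L.trans (σ.⟦⟧-cong (τ.fixes k)) (σ.fixes k)
      }
      where
      module σ = Automorphism σ
      module τ = Automorphism τ

    idᴬ : Automorphism
    idᴬ = record
      { ⟦_⟧               = id
      ; isRingIsomorphism = Identity.isRingIsomorphism L.rawRing L.refl
      ; fixes             = λ _ → L.refl
      }

    module Inv (σ : Automorphism) where
      open Automorphism σ using (⟦⟧-cong; +-homo; *-homo; -‿homo; 0#-homo; 1#-homo; fixes; injective; surjective)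

      f⁻¹ : L.Carrier → L.Carrier
      f⁻¹ y = proj₁ (surjective y)

      invʳ : ∀ y → ⟦ σ ⟧ (f⁻¹ y) L.≈ y
      invʳ y = proj₂ (surjective y) L.refl

      unique : ∀ {x y} → ⟦ σ ⟧ x L.≈ y → f⁻¹ y L.≈ x
      unique e = injective (L.trans (invʳ _) (L.sym e))

      invˡ : ∀ x → f⁻¹ (⟦ σ ⟧ x) L.≈ x
      invˡ x = unique L.refl

      f⁻¹-cong : ∀ {x y} → x L.≈ y → f⁻¹ x L.≈ f⁻¹ y
      f⁻¹-cong x≈y = unique (L.trans (invʳ _) (L.sym x≈y))

      automorphism : Automorphism
      automorphism = record
        { ⟦_⟧ = f⁻¹
        ; isRingIsomorphism = record
          { isRingMonomorphism = record
            { isRingHomomorphism = record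
              { isSemiringHomomorphism = record
                { isNearSemiringHomomorphism = record
                  { +-isMonoidHomomorphism = record
                    { isMagmaHomomorphism = record
                      { isRelHomomorphism = record { cong = f⁻¹-cong }
                      ; homo = λ x y → unique (L.trans (+-homo _ _) (L.+-cong (invʳ x) (invʳ y)))
                      }
                    ; ε-homo = unique 0#-homo
                    }
                  ; *-homo = λ x y → unique (L.trans (*-homo _ _) (L.*-cong (invʳ x) (invʳ y)))
                  }
                ; 1#-homo = unique 1#-homo
                }
              ; -‿homo = λ x → unique (L.trans (-‿homo _) (L.-‿cong (invʳ x)))
              }
            ; injective = λ e → L.trans (L.sym (invʳ _)) (L.trans (⟦⟧-cong e) (invʳ _))
            }
          ; surjective = λ y → ⟦ σ ⟧ y , λ e → L.trans (f⁻¹-cong e) (invˡ y)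
          }
        ; fixes = λ k → unique (fixes k)
        }

  Gal : Group (c ⊔ c′ ⊔ ℓ′) (c′ ⊔ ℓ′)
  Gal = record
    { Carrier = Automorphism
    ; _≈_     = _≋_
    ; _∙_     = _∘ᴬ_
    ; ε       = idᴬ
    ; _⁻¹     = Inv.automorphism
    ; isGroup = record
      { isMonoid = record
        { isSemigroup = record
          { isMagma = record
            { isEquivalence = record
              { refl  = λ _ → L.refl
              ; sym   = λ e x → L.sym (e x)
              ; trans = λ e f x → L.trans (e x) (f x)
              }
            ; ∙-cong = λ {_} {σ′} e f x → L.trans (e _) (Automorphism.⟦⟧-cong σ′ (f x))
            }
          ; assoc = λ _ _ _ _ → L.refl
          }
        ; identity = (λ _ _ → L.refl) , (λ _ _ → L.refl)
        }
      ; inverse = Inv.invˡ , Inv.invʳ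
      ; ⁻¹-cong = λ {σ} {τ} e x → Inv.unique σ (L.trans (e _) (Inv.invʳ τ x))
      }
    }

  -- The field fixed by all K-automorphisms of L is K; for finite extensions
  -- this is the same as being normal and separable.
  IsGalois : Set (c ⊔ c′ ⊔ ℓ′)
  IsGalois = ∀ x → (∀ (σ : Automorphism) → ⟦ σ ⟧ x L.≈ x) → ∃ λ k → ι k L.≈ x

record FiniteGaloisExtension (K : Field c ℓ) c′ ℓ′ : Set (c ⊔ ℓ ⊔ suc (c′ ⊔ ℓ′)) where
  field
    extension : FieldExtension K c′ ℓ′
    isFinite  : IsFinite extension
    isGalois  : IsGalois extension

{-# OPTIONS --safe #-}
module Submission where

-- The function v ∘ Norm on L is invariant under G = Gal(L|K). It is at least 0
-- exactly on the power bounded elements of L: for these form a local ring,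
-- because K is complete and L has no idempotents but 0 and 1, and then a
-- primitive equation of z over K shows that z or z⁻¹ is power bounded. So G
-- acts on the valuation ring of L and on its residue field.
--
-- If α ∈ G acts trivially on the residue field, then αx / x is modulo the
-- maximal ideal an l-th root of unity, as G has exponent l. By the pigeonhole
-- principle it lies in the residue field of K, so the commutator of α with any
-- σ ∈ G moves no x to first order; as l is a unit and G has exponent l, such
-- an element of G is trivial. Hence α is central.
--
-- On the residue field every σ ∈ G is a power of the Frobenius, which itself
-- is induced by some σ₀ ∈ G. Therefore G is generated by σ₀ and central
-- elements, whereas the Heisenberg group is not commutative.

open import Defs
open import Algebra.Bundles
open import Algebra.Definitions using (Commutative)
open import Algebra.Morphism.Structures using (IsRingHomomorphism; IsGroupIsomorphism)
open import Algebra.Solver.Ring.AlmostCommutativeRing using (fromCommutativeRing; _-Raw-AlmostCommutative⟶_)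
import Algebra.Construct.NaturalChoice.Min as Min
import Algebra.Definitions.RawMonoid as RawMonoidOps
import Algebra.Morphism.Construct.Composition as Composition
import Algebra.Morphism.Construct.Identity as Identity
import Algebra.Properties.CommutativeMonoid.Sum as CommutativeMonoidSum
import Algebra.Properties.CommutativeSemiring.Exp as Exp
import Algebra.Properties.Group as GroupProperties
import Algebra.Properties.Ring as RingProperties
import Algebra.Properties.Semiring.Mult.TCOptimised as SemiringMult
import Algebra.Properties.Semiring.Sum as SemiringSum
import Algebra.Solver.Ring as RingSolver
open import Data.Fin.Base using (Fin; zero; suc; toℕ; fromℕ<; punchIn; splitAt; combine; funToFin; finToFun)
open import Data.Fin.Permutation using (Permutation; permutation; _⟨$⟩ʳ_)
import Data.Fin.Properties as Finₚ
open import Data.Integer.Base as ℤ using (ℤ; 0ℤ; 1ℤ)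
import Data.Integer.Properties as ℤₚ
open import Data.Integer.Solver using (module +-*-Solver)
open import Data.List.Base using (List; []; _∷_; _++_; length; map; tabulate; zipWith; replicate)
import Data.List.Properties as Listₚ
import Data.List.Relation.Binary.Permutation.Homogeneous as ↭
import Data.List.Relation.Binary.Permutation.Setoid as PermutationSetoid
import Data.List.Relation.Binary.Permutation.Setoid.Properties as PermutationSetoidProperties
open import Data.List.Relation.Binary.Pointwise as Pointwise using (Pointwise; []; _∷_)
open import Data.List.Relation.Unary.All as All using (All; []; _∷_)
import Data.List.Relation.Unary.All.Properties as Allₚ
open import Data.Maybe.Base using (Maybe; just; nothing)
open import Data.Nat.Base as ℕ using (ℕ; zero; suc)
open import Data.Nat.Coprimality using (coprime-Bézout; prime⇒coprime)
open import Data.Nat.Divisibility using (1∣_)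
open import Data.Nat.DivMod using (_%_; _/_; m≡m%n+[m/n]*n; m%n<n)
open import Data.Nat.GCD using (module Bézout)
open import Data.Nat.Primality using (Prime; prime⇒nonZero; prime⇒irreducible)
import Data.Nat.Properties as ℕₚ
open import Data.Product.Base using (Σ; Σ-syntax; ∃; _×_; _,_; proj₁; proj₂)
open import Data.Sum.Base using (_⊎_; inj₁; inj₂; [_,_]′)
import Data.Vec.Functional as Vector
open import Data.Vec.Functional using (Vector; removeAt; tail)
open import Function.Base using (_∘_; id)
open import Function.Bundles using (Inverse; Equivalence)
import Level
open import Relation.Binary.Bundles using (Setoid)
open import Relation.Binary.Construct.Add.Supremum.NonStrict ℤ._≤_
  using (_≤⁺_; [_]; _≤⊤⁺; ≤⁺-trans; ≤⁺-dec; [≤]-injective)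
open import Relation.Binary.PropositionalEquality as ≡ using (_≡_; _≢_)
import Relation.Binary.Reasoning.Setoid as SetoidReasoning
open import Relation.Nullary.Construct.Add.Supremum using (_⁺; ⊤⁺; [_])
open import Relation.Nullary.Decidable as Dec using (Dec; yes; no)
open import Relation.Nullary.Negation using (¬_; contradiction)

open Min ℤ⁺-totalOrder using (⊓-glb)
open +-*-Solver using () renaming (_:+_ to _:+ℤ_; _:-_ to _:-ℤ_; _:=_ to _:=ℤ_; :-_ to :-ℤ_)

-- The valuation ring of L needs two descriptions because each gives only half of its properties
-- cheaply. For power bounded elements closure under addition is a plain estimate; for the norm
-- condition multiplicativity, invariance under G and decidability are immediate. Neither the degree
-- nor the finiteness of the residue extension is ever computed. The residue ring of L is handled
-- only as a ring without zero divisors over the finite residue field F of K. The Galois theory of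
-- finite fields is replaced by traces: the sum of the `φⁱ x` for i < l is fixed by φ, hence lies in
-- F, hence is unchanged when x is replaced by σx. Comparing such traces for all powers of one
-- element, a Vandermonde argument determines its G-orbit and its stabiliser. Primality of l ensures
-- that an element not fixed by φ has l distinct iterates. Whether φ is the identity on the residue
-- ring cannot be decided by search. Commutativity is therefore proved up to double negation, which
-- equality in L absorbs: it is decidable through the valuations of coordinates.

module IntegerCoefficients {c ℓ} (R : CommutativeRing c ℓ) where
  open CommutativeRing R
  open RingProperties ring
  open SemiringMult semiring using (1+×; ×-homo-+; ×1-homo-*) renaming (_×_ to _·_)
  open SetoidReasoning setoid

  ⟦_⟧ℤ : ℤ → Carrier
  ⟦ ℤ.+ n ⟧ℤ      = n · 1#
  ⟦ ℤ.-[1+ n ] ⟧ℤ = - (suc n · 1#)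

  cancel-suc : ∀ x y → x - y ≈ (1# + x) - (1# + y)
  cancel-suc x y = sym (begin
    (1# + x) - (1# + y)       ≈⟨ +-cong (+-comm 1# x) (sym (-‿+-comm 1# y)) ⟩
    (x + 1#) + (- 1# - y)     ≈⟨ +-assoc x 1# _ ⟩
    x + (1# + (- 1# - y))     ≈⟨ +-congˡ (sym (+-assoc 1# _ _)) ⟩
    x + ((1# - 1#) - y)       ≈⟨ +-congˡ (+-congʳ (-‿inverseʳ 1#)) ⟩
    x + (0# - y)              ≈⟨ +-congˡ (+-identityˡ _) ⟩
    x - y                     ∎)

  ⊖-homo : ∀ m n → ⟦ m ℤ.⊖ n ⟧ℤ ≈ m · 1# - n · 1#
  ⊖-homo m zero = sym (trans (+-congˡ -0#≈0#) (+-identityʳ _))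
  ⊖-homo zero (suc n) = sym (+-identityˡ _)
  ⊖-homo (suc m) (suc n) = begin
    ⟦ suc m ℤ.⊖ suc n ⟧ℤ     ≡⟨ ≡.cong ⟦_⟧ℤ (ℤₚ.[1+m]⊖[1+n]≡m⊖n m n) ⟩
    ⟦ m ℤ.⊖ n ⟧ℤ             ≈⟨ ⊖-homo m n ⟩
    m · 1# - n · 1#          ≈⟨ cancel-suc _ _ ⟩
    (1# + m · 1#) - (1# + n · 1#) ≈⟨ sym (+-cong (1+× m 1#) (-‿cong (1+× n 1#))) ⟩
    suc m · 1# - suc n · 1#  ∎

  neg-homo : ∀ i → ⟦ ℤ.- i ⟧ℤ ≈ - ⟦ i ⟧ℤ
  neg-homo (ℤ.+ zero)  = sym -0#≈0#
  neg-homo (ℤ.+ suc n) = refl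
  neg-homo ℤ.-[1+ n ]  = sym (-‿involutive _)

  +-homo : ∀ i j → ⟦ i ℤ.+ j ⟧ℤ ≈ ⟦ i ⟧ℤ + ⟦ j ⟧ℤ
  +-homo (ℤ.+ m) (ℤ.+ n) = ×-homo-+ 1# m n
  +-homo (ℤ.+ m) ℤ.-[1+ n ] = ⊖-homo m (suc n)
  +-homo ℤ.-[1+ m ] (ℤ.+ n) = trans (⊖-homo n (suc m)) (+-comm _ _)
  +-homo ℤ.-[1+ m ] ℤ.-[1+ n ] = begin
    - (suc (suc (m ℕ.+ n)) · 1#)      ≡⟨ ≡.cong (λ k → - (k · 1#)) (≡.sym (≡.cong suc (ℕₚ.+-suc m n))) ⟩
    - ((suc m ℕ.+ suc n) · 1#)        ≈⟨ -‿cong (×-homo-+ 1# (suc m) (suc n)) ⟩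
    - (suc m · 1# + suc n · 1#)       ≈⟨ sym (-‿+-comm _ _) ⟩
    - (suc m · 1#) - suc n · 1#       ∎

  pos-*-homo : ∀ m n → ⟦ ℤ.+ m ℤ.* ℤ.+ n ⟧ℤ ≈ ⟦ ℤ.+ m ⟧ℤ * ⟦ ℤ.+ n ⟧ℤ
  pos-*-homo m n = trans (reflexive (≡.cong ⟦_⟧ℤ (≡.sym (ℤₚ.pos-* m n)))) (×1-homo-* m n)

  *-homo : ∀ i j → ⟦ i ℤ.* j ⟧ℤ ≈ ⟦ i ⟧ℤ * ⟦ j ⟧ℤ
  *-homo (ℤ.+ m) (ℤ.+ n) = pos-*-homo m n
  *-homo (ℤ.+ m) ℤ.-[1+ n ] = begin
    ⟦ ℤ.+ m ℤ.* (ℤ.- (ℤ.+ suc n)) ⟧ℤ   ≡⟨ ≡.cong ⟦_⟧ℤ (≡.sym (ℤₚ.neg-distribʳ-* (ℤ.+ m) (ℤ.+ suc n))) ⟩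
    ⟦ ℤ.- (ℤ.+ m ℤ.* ℤ.+ suc n) ⟧ℤ     ≈⟨ neg-homo (ℤ.+ m ℤ.* ℤ.+ suc n) ⟩
    - ⟦ ℤ.+ m ℤ.* ℤ.+ suc n ⟧ℤ         ≈⟨ -‿cong (pos-*-homo m (suc n)) ⟩
    - (⟦ ℤ.+ m ⟧ℤ * ⟦ ℤ.+ suc n ⟧ℤ)    ≈⟨ -‿distribʳ-* _ _ ⟩
    ⟦ ℤ.+ m ⟧ℤ * - ⟦ ℤ.+ suc n ⟧ℤ      ∎
  *-homo ℤ.-[1+ m ] j = begin
    ⟦ (ℤ.- (ℤ.+ suc m)) ℤ.* j ⟧ℤ   ≡⟨ ≡.cong ⟦_⟧ℤ (≡.sym (ℤₚ.neg-distribˡ-* (ℤ.+ suc m) j)) ⟩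
    ⟦ ℤ.- (ℤ.+ suc m ℤ.* j) ⟧ℤ     ≈⟨ neg-homo (ℤ.+ suc m ℤ.* j) ⟩
    - ⟦ ℤ.+ suc m ℤ.* j ⟧ℤ         ≈⟨ -‿cong (pos-any j) ⟩
    - (⟦ ℤ.+ suc m ⟧ℤ * ⟦ j ⟧ℤ)    ≈⟨ -‿distribˡ-* _ _ ⟩
    - ⟦ ℤ.+ suc m ⟧ℤ * ⟦ j ⟧ℤ      ∎
    where
    pos-any : ∀ j → ⟦ ℤ.+ suc m ℤ.* j ⟧ℤ ≈ ⟦ ℤ.+ suc m ⟧ℤ * ⟦ j ⟧ℤ
    pos-any (ℤ.+ n) = pos-*-homo (suc m) n
    pos-any ℤ.-[1+ n ] = *-homo (ℤ.+ suc m) ℤ.-[1+ n ]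

  morphism : ℤ.+-*-rawRing -Raw-AlmostCommutative⟶ fromCommutativeRing R
  morphism = record
    { ⟦_⟧    = ⟦_⟧ℤ
    ; +-homo = +-homo
    ; *-homo = *-homo
    ; -‿homo = neg-homo
    ; 0-homo = refl
    ; 1-homo = refl
    }

  -- The solver must recognise equal coefficients, and equality in `R` may be undecidable. Integer
  -- coefficients are compared in ℤ instead; distinct integers give `nothing`, although they may
  -- coincide in `R`.
  coefficient-dec : ∀ i j → Maybe (⟦ i ⟧ℤ ≈ ⟦ j ⟧ℤ)
  coefficient-dec i j with i ℤₚ.≟ j
  ... | yes i≡j = just (reflexive (≡.cong ⟦_⟧ℤ i≡j))
  ... | no  _   = nothing

  open RingSolver ℤ.+-*-rawRing (fromCommutativeRing R) morphism coefficient-dec public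
    using (solve; _:=_; _:+_; _:*_; _:-_; :-_; con)
    renaming (Polynomial to SolverPolynomial)

  :1 : ∀ {n} → SolverPolynomial n
  :1 = con ℤ.1ℤ

module RingKit {c ℓ} (R : CommutativeRing c ℓ) where
  open CommutativeRing R public hiding (zero)
  open RingProperties ring public
  open IntegerCoefficients R public
    using (solve; _:=_; _:+_; _:*_; _:-_; :-_; con; :1)
  open Exp commutativeSemiring public
  open CommutativeMonoidSum +-commutativeMonoid public
    using (sum; sum-cong-≋; ∑-distrib-+; ∑-permute)
  open SemiringSum semiring public using (*-distribˡ-sum; *-distribʳ-sum)
  open CommutativeMonoidSum *-commutativeMonoid public
    using ()
    renaming (sum to ∏; sum-cong-≋ to ∏-cong; ∑-distrib-+ to ∏-distrib-*;
              ∑-permute to ∏-permute; sum-remove to ∏-remove; sum-replicate to ∏-replicate)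

  x-y≈0⇒x≈y : ∀ {x y} → x - y ≈ 0# → x ≈ y
  x-y≈0⇒x≈y {x} {y} e = trans
    (solve 2 (λ x y → x := (x :- y) :+ y) refl x y)
    (trans (+-congʳ e) (+-identityˡ y))

  x≈y⇒x-y≈0 : ∀ {x y} → x ≈ y → x - y ≈ 0#
  x≈y⇒x-y≈0 e = trans (+-congʳ e) (-‿inverseʳ _)

  1^ : ∀ n → 1# ^ n ≈ 1#
  1^ zero    = refl
  1^ (suc n) = trans (*-identityˡ _) (1^ n)

  0^ : ∀ n → 0# ^ suc n ≈ 0#
  0^ n = zeroˡ _

  ∏-zero : ∀ {n} (t : Fin n → Carrier) i → t i ≈ 0# → ∏ t ≈ 0#
  ∏-zero t zero    e = trans (*-congʳ e) (zeroˡ _)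
  ∏-zero t (suc i) e = trans (*-congˡ (∏-zero (tail t) i e)) (zeroʳ _)

  ∏-ones : ∀ {n} (t : Fin n → Carrier) → (∀ i → t i ≈ 1#) → ∏ t ≈ 1#
  ∏-ones {zero}  t e = refl
  ∏-ones {suc n} t e = trans (*-cong (e zero) (∏-ones (tail t) (e ∘ suc))) (*-identityˡ _)

module _ {c ℓ} (R : CommutativeRing c ℓ) where
  open CommutativeRing R

  NoZeroDivisors : Set _
  NoZeroDivisors = ∀ x y → x * y ≈ 0# → x ≈ 0# ⊎ y ≈ 0#

-- Polynomials and finite fields

-- ev a cs is the polynomial with coefficients cs, constant term first,
-- followed by the leading coefficient a.
module Polynomials {c ℓ} (R : CommutativeRing c ℓ) where
  open RingKit R
  open SetoidReasoning setoid

  ev : Carrier → List Carrier → Carrier → Carrier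
  ev a []       X = a
  ev a (c ∷ cs) X = c + X * ev a cs X

  ev-congˡ : ∀ {a b} cs X → a ≈ b → ev a cs X ≈ ev b cs X
  ev-congˡ []       X e = e
  ev-congˡ (c ∷ cs) X e = +-congˡ (*-congˡ (ev-congˡ cs X e))

  ev-++ : ∀ cs ds X → ev 0# (cs ++ ds) X ≈ ev 0# cs X + X ^ length cs * ev 0# ds X
  ev-++ [] ds X = sym (trans (+-identityˡ _) (*-identityˡ _))
  ev-++ (c ∷ cs) ds X = trans (+-congˡ (*-congˡ (ev-++ cs ds X)))
    (solve 5 (λ c X a P b → c :+ X :* (a :+ P :* b) := (c :+ X :* a) :+ (X :* P) :* b) refl c X _ _ _)

  ev-lead : ∀ a cs X → ev 0# (cs ++ a ∷ []) X ≈ ev a cs X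
  ev-lead a [] X = trans (+-congˡ (zeroʳ X)) (+-identityʳ a)
  ev-lead a (c ∷ cs) X = +-congˡ (*-congˡ (ev-lead a cs X))

  ev-zipWith-minus : ∀ a b cs ds X → length cs ≡ length ds →
                     ev (a - b) (zipWith _-_ cs ds) X ≈ ev a cs X - ev b ds X
  ev-zipWith-minus a b []       []       X _ = refl
  ev-zipWith-minus a b (c ∷ cs) (d ∷ ds) X e = begin
    (c - d) + X * ev (a - b) (zipWith _-_ cs ds) X
      ≈⟨ +-congˡ (*-congˡ (ev-zipWith-minus a b cs ds X (ℕₚ.suc-injective e))) ⟩
    (c - d) + X * (ev a cs X - ev b ds X)
      ≈⟨ solve 5 (λ c d X p q → (c :- d) :+ X :* (p :- q) := (c :+ X :* p) :- (d :+ X :* q)) refl c d X _ _ ⟩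
    (c + X * ev a cs X) - (d + X * ev b ds X) ∎

  ev-zeros : ∀ n X → ev 1# (replicate n 0#) X ≈ X ^ n
  ev-zeros zero    X = refl
  ev-zeros (suc n) X = trans (+-identityˡ _) (*-congˡ (ev-zeros n X))

  factor-root : ∀ a r c cs → ∃ λ ds → length ds ≡ length cs ×
                (∀ X → ev a (c ∷ cs) X ≈ (X - r) * ev a ds X + ev a (c ∷ cs) r)
  factor-root a r c [] = [] , ≡.refl , λ X →
    solve 4 (λ a r c X → c :+ X :* a := (X :- r) :* a :+ (c :+ r :* a)) refl a r c X
  factor-root a r c (c′ ∷ cs) with ds , len , e ← factor-root a r c′ cs =
    ev a (c′ ∷ cs) r ∷ ds , ≡.cong suc len , λ X → trans (+-congˡ (*-congˡ (e X)))
      (solve 5 (λ r c X D E → c :+ X :* ((X :- r) :* D :+ E) := (X :- r) :* (E :+ X :* D) :+ (c :+ r :* E))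
        refl r c X (ev a ds X) (ev a (c′ ∷ cs) r))

  -- The leading coefficient `a` may vanish. With a ≈ 0 this says that a polynomial of degree below
  -- n with n distinct roots is zero, which is how additivity of the Frobenius is obtained.
  roots⇒product : NoZeroDivisors R → ∀ {n} a cs (r : Fin n → Carrier) → length cs ≡ n →
                  (∀ i j → r i ≈ r j → i ≡ j) → (∀ i → ev a cs (r i) ≈ 0#) →
                  ∀ X → ev a cs X ≈ a * ∏ (λ i → X - r i)
  roots⇒product nzd {zero} a [] r len inj root X = sym (*-identityʳ a)
  roots⇒product nzd {suc n} a (c ∷ cs) r len inj root X
    with ds , len′ , e ← factor-root a (r zero) c cs = begin
    ev a (c ∷ cs) X                                        ≈⟨ quotient X ⟩
    (X - r zero) * ev a ds X                               ≈⟨ *-congˡ ih ⟩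
    (X - r zero) * (a * ∏ (λ i → X - r (suc i)))           ≈⟨ solve 3 (λ x y z → x :* (y :* z) := y :* (x :* z)) refl _ a _ ⟩
    a * ((X - r zero) * ∏ (λ i → X - r (suc i)))           ∎
    where
    quotient : ∀ X → ev a (c ∷ cs) X ≈ (X - r zero) * ev a ds X
    quotient X = trans (e X) (trans (+-congˡ (root zero)) (+-identityʳ _))
    ih = roots⇒product nzd a ds (r ∘ suc) (≡.trans len′ (ℕₚ.suc-injective len))
      (λ i j q → Finₚ.suc-injective (inj _ _ q))
      (λ i → [ (λ q → contradiction (inj (suc i) zero (x-y≈0⇒x≈y q)) λ ()) , id ]′
        (nzd _ _ (trans (sym (quotient (r (suc i)))) (root (suc i)))))
      X

  -- Multiplication of a monic polynomial by X - r, with carry p.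
  mulRoot : Carrier → Carrier → List Carrier → List Carrier
  mulRoot r p []       = p - r ∷ []
  mulRoot r p (c ∷ cs) = p - r * c ∷ mulRoot r c cs

  length-mulRoot : ∀ r p cs → length (mulRoot r p cs) ≡ suc (length cs)
  length-mulRoot r p []       = ≡.refl
  length-mulRoot r p (c ∷ cs) = ≡.cong suc (length-mulRoot r c cs)

  ev-mulRoot : ∀ r p cs X → ev 1# (mulRoot r p cs) X ≈ p + (X - r) * ev 1# cs X
  ev-mulRoot r p [] X =
    solve 3 (λ r p X → (p :- r) :+ X :* :1 := p :+ (X :- r) :* :1) refl r p X
  ev-mulRoot r p (c ∷ cs) X = begin
    (p - r * c) + X * ev 1# (mulRoot r c cs) X
      ≈⟨ +-congˡ (*-congˡ (ev-mulRoot r c cs X)) ⟩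
    (p - r * c) + X * (c + (X - r) * ev 1# cs X)
      ≈⟨ solve 5 (λ r p c X E → (p :- r :* c) :+ X :* (c :+ (X :- r) :* E) := p :+ (X :- r) :* (c :+ X :* E)) refl r p c X _ ⟩
    p + (X - r) * (c + X * ev 1# cs X) ∎

  -- Only monicity and degree matter later, so no binomial coefficients are computed: each step
  -- multiplies by the root factor of -y.
  [X+y]^ : ∀ y n → ∃ λ cs → length cs ≡ n × (∀ X → (X + y) ^ n ≈ ev 1# cs X)
  [X+y]^ y zero    = [] , ≡.refl , λ X → refl
  [X+y]^ y (suc n) with cs , len , e ← [X+y]^ y n =
    mulRoot (- y) 0# cs , ≡.trans (length-mulRoot _ _ cs) (≡.cong suc len) , λ X → begin
      (X + y) * (X + y) ^ n        ≈⟨ *-congˡ (e X) ⟩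
      (X + y) * ev 1# cs X         ≈⟨ solve 3 (λ X y E → (X :+ y) :* E := con (ℤ.+ 0) :+ (X :- (:- y)) :* E) refl X y _ ⟩
      0# + (X - - y) * ev 1# cs X  ≈⟨ sym (ev-mulRoot (- y) 0# cs X) ⟩
      ev 1# (mulRoot (- y) 0# cs) X ∎

  moments-minus : ∀ {n} (e d : Fin n → Carrier) x m →
    sum (λ i → e i ^ m * (d i * (e i - x))) ≈ sum (λ i → e i ^ suc m * d i) - x * sum (λ i → e i ^ m * d i)
  moments-minus {zero}  e d x m = solve 1 (λ x → con (ℤ.+ 0) := con (ℤ.+ 0) :- x :* con (ℤ.+ 0)) refl x
  moments-minus {suc n} e d x m = trans (+-congˡ (moments-minus (e ∘ suc) (d ∘ suc) x m))
    (solve 6 (λ E e d x S T → E :* (d :* (e :- x)) :+ (S :- x :* T) := (e :* E :* d :+ S) :- x :* (E :* d :+ T))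
      refl (e zero ^ m) (e zero) (d zero) x _ _)

  -- Subtracting `e zero` times the m-th moment from the next one removes the node `e zero` and
  -- multiplies every other weight by its difference from that node. Repeating this leaves only
  -- `d₀`. The nodes `e i` may coincide among themselves, so only collisions with `e₀` have to be
  -- excluded in applications.
  vandermonde : ∀ {n} (e d : Fin n → Carrier) e₀ d₀ →
    (∀ m → e₀ ^ m * d₀ + sum (λ i → e i ^ m * d i) ≈ 0#) → d₀ * ∏ (λ i → e₀ - e i) ≈ 0#
  vandermonde {zero} e d e₀ d₀ h = trans
    (solve 1 (λ d → d :* :1 := :1 :* d :+ con (ℤ.+ 0)) refl d₀) (h 0)
  vandermonde {suc n} e d e₀ d₀ h = trans (sym (*-assoc _ _ _))
    (vandermonde (e ∘ suc) (λ i → d (suc i) * (e (suc i) - e zero)) e₀ (d₀ * (e₀ - e zero)) λ m → begin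
      e₀ ^ m * (d₀ * (e₀ - e zero)) + sum (λ i → e (suc i) ^ m * (d (suc i) * (e (suc i) - e zero)))
        ≈⟨ +-congˡ (moments-minus (e ∘ suc) (d ∘ suc) (e zero) m) ⟩
      e₀ ^ m * (d₀ * (e₀ - e zero)) + (S (suc m) - e zero * S m)
        ≈⟨ solve 8 (λ E₀ d₀ e₀ E e d S T →
             E₀ :* (d₀ :* (e₀ :- e)) :+ (S :- e :* T) :=
             (e₀ :* E₀ :* d₀ :+ (e :* E :* d :+ S)) :- e :* (E₀ :* d₀ :+ (E :* d :+ T)))
             refl (e₀ ^ m) d₀ e₀ (e zero ^ m) (e zero) (d zero) (S (suc m)) (S m) ⟩
      (e₀ ^ suc m * d₀ + sum (λ i → e i ^ suc m * d i)) - e zero * (e₀ ^ m * d₀ + sum (λ i → e i ^ m * d i))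
        ≈⟨ +-cong (h (suc m)) (-‿cong (*-congˡ (h m))) ⟩
      0# - e zero * 0#
        ≈⟨ solve 1 (λ x → con (ℤ.+ 0) :- x :* con (ℤ.+ 0) := con (ℤ.+ 0)) refl (e zero) ⟩
      0# ∎)
    where
    S : ℕ → Carrier
    S m = sum (λ i → e (suc i) ^ m * d (suc i))

  ∏≈0⇒∃ : NoZeroDivisors R → ¬ 1# ≈ 0# → ∀ {n} (t : Fin n → Carrier) → ∏ t ≈ 0# → ∃ λ i → t i ≈ 0#
  ∏≈0⇒∃ nzd 1≉0 {zero}  t e = contradiction e 1≉0
  ∏≈0⇒∃ nzd 1≉0 {suc n} t e with nzd _ _ e
  ... | inj₁ p = zero , p
  ... | inj₂ p with i , q ← ∏≈0⇒∃ nzd 1≉0 (tail t) p = suc i , q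

field-noZeroDivisors : ∀ {c ℓ} (F : Field c ℓ) → (∀ x → Dec (Field._≈_ F x (Field.0# F))) →
                       NoZeroDivisors (Field.commutativeRing F)
field-noZeroDivisors F ≈0? x y e with ≈0? x
... | yes x≈0 = inj₁ x≈0
... | no  x≉0 with x′ , xx′≈1 ← Field.inverse F x x≉0 = inj₂ (begin
  y             ≈⟨ sym (*-identityˡ y) ⟩
  1# * y        ≈⟨ *-congʳ (sym xx′≈1) ⟩
  x * x′ * y    ≈⟨ solve 3 (λ x x′ y → x :* x′ :* y := x′ :* (x :* y)) refl x x′ y ⟩
  x′ * (x * y)  ≈⟨ *-congˡ e ⟩
  x′ * 0#       ≈⟨ zeroʳ x′ ⟩
  0#            ∎)
  where
  open RingKit (Field.commutativeRing F)
  open SetoidReasoning setoid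

module FiniteField {c ℓ} (F : Field c ℓ) {q : ℕ} (card : HasCardinality (Field.setoid F) q) where
  open Field F using (commutativeRing; 1≉0; inverse)
  open RingKit commutativeRing
  open SetoidReasoning setoid
  open Inverse card using (to; from; to-cong; from-cong; inverseˡ; inverseʳ)

  from-to : ∀ x → from (to x) ≈ x
  from-to x = inverseʳ ≡.refl

  to-injective : ∀ {x y} → to x ≡ to y → x ≈ y
  to-injective e = trans (sym (from-to _)) (trans (from-cong e) (from-to _))

  from-injective : ∀ {i j} → from i ≈ from j → i ≡ j
  from-injective e = ≡.trans (≡.sym (inverseˡ refl)) (≡.trans (to-cong e) (inverseˡ refl))

  infix 4 _≟_
  _≟_ : ∀ x y → Dec (x ≈ y)
  x ≟ y = Dec.map′ to-injective to-cong (to x Finₚ.≟ to y)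

  noZeroDivisors : NoZeroDivisors commutativeRing
  noZeroDivisors = field-noZeroDivisors F (_≟ 0#)

  2≤q : 2 ℕ.≤ q
  2≤q = go q to (λ e → 1≉0 (to-injective e))
    where
    go : ∀ n (f : Carrier → Fin n) → f 1# ≢ f 0# → 2 ℕ.≤ n
    go 0 f _ with () ← f 0#
    go 1 f ne with f 1# | f 0#
    ... | zero | zero = contradiction ≡.refl ne
    go (suc (suc n)) f _ = ℕ.s≤s (ℕ.s≤s ℕ.z≤n)

  private
    ifZero : ∀ {z} → Carrier → Carrier → Dec (z ≈ 0#) → Carrier
    ifZero x y (yes _) = x
    ifZero x y (no _)  = y

    ifZero-yes : ∀ {z} x y (d : Dec (z ≈ 0#)) → z ≈ 0# → ifZero x y d ≡ x
    ifZero-yes x y (yes _) _ = ≡.refl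
    ifZero-yes x y (no ¬p) p = contradiction p ¬p

    ifZero-no : ∀ {z} x y (d : Dec (z ≈ 0#)) → ¬ z ≈ 0# → ifZero x y d ≡ y
    ifZero-no x y (yes p) ¬p = contradiction p ¬p
    ifZero-no x y (no _)  _  = ≡.refl

  -- Replace the zero of F by 1 and multiply all elements: the product is
  -- unchanged when every element is first multiplied by x ≉ 0, but it
  -- also acquires one factor x for each of the q - 1 nonzero elements.
  module _ (x : Carrier) (x≉0 : ¬ x ≈ 0#) where
    private
      x⁻¹ = proj₁ (inverse x x≉0)
      xx⁻¹ = proj₂ (inverse x x≉0)

      -- `s` collects the factors gained by the permutation and `s′` supplies the one missing at the
      -- zero of F. As `s i * s′ i ≈ x` for every i, the power `x ^ q` appears without dealing with
      -- q - 1.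
      t s s′ : Fin q → Carrier
      t i  = ifZero 1# (from i) (from i ≟ 0#)
      s i  = ifZero 1# x (from i ≟ 0#)
      s′ i = ifZero x 1# (from i ≟ 0#)

      π : Permutation q q
      π = permutation (λ i → to (x * from i)) (λ i → to (x⁻¹ * from i))
        (λ i → from-injective (trans (from-to _) (trans (*-congˡ (from-to _)) (shuffle x x⁻¹ (from i) xx⁻¹))))
        (λ i → from-injective (trans (from-to _) (trans (*-congˡ (from-to _)) (shuffle x⁻¹ x (from i) (trans (*-comm _ _) xx⁻¹)))))
        where
        shuffle : ∀ u w y → u * w ≈ 1# → u * (w * y) ≈ y
        shuffle u w y e = trans (sym (*-assoc u w y)) (trans (*-congʳ e) (*-identityˡ y))

      t-π : ∀ i → t (π ⟨$⟩ʳ i) ≈ s i * t i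
      t-π i with from i ≟ 0#
      ... | yes p = trans (reflexive (ifZero-yes _ _ (_ ≟ 0#) (trans (from-to _) (trans (*-congˡ p) (zeroʳ x))))) (sym (*-identityˡ 1#))
      ... | no ¬p = trans (reflexive (ifZero-no _ _ (_ ≟ 0#)
          λ e → [ x≉0 , ¬p ]′ (noZeroDivisors _ _ (trans (sym (from-to _)) e)))) (from-to _)

      t≉0 : ∀ i → ¬ t i ≈ 0#
      t≉0 i with from i ≟ 0#
      ... | yes p = 1≉0
      ... | no ¬p = ¬p

      ∏s≈1 : ∏ s ≈ 1#
      ∏s≈1 with noZeroDivisors (∏ s - 1#) (∏ t) (begin
        (∏ s - 1#) * ∏ t          ≈⟨ solve 2 (λ s t → (s :- :1) :* t := s :* t :- t) refl (∏ s) (∏ t) ⟩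
        ∏ s * ∏ t - ∏ t           ≈⟨ +-congʳ (sym (∏-distrib-* s t)) ⟩
        ∏ (λ i → s i * t i) - ∏ t ≈⟨ +-congʳ (∏-cong (λ i → sym (t-π i))) ⟩
        ∏ (λ i → t (π ⟨$⟩ʳ i)) - ∏ t ≈⟨ +-congʳ (sym (∏-permute t π)) ⟩
        ∏ t - ∏ t                 ≈⟨ -‿inverseʳ _ ⟩
        0#                        ∎)
      ... | inj₁ e = x-y≈0⇒x≈y e
      ... | inj₂ e with i , ti≈0 ← Polynomials.∏≈0⇒∃ commutativeRing noZeroDivisors 1≉0 t e = contradiction ti≈0 (t≉0 i)

      ∏s′ : ∀ {n} (u : Fin n → Carrier) i → (∀ j → i ≢ j → u j ≈ 1#) → ∏ u ≈ u i
      ∏s′ {suc n} u i h = trans (∏-remove {i = i} u) (trans (*-congˡ (∏-ones (removeAt u i)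
        (λ j → h (punchIn i j) λ e → Finₚ.punchInᵢ≢i i j (≡.sym e)))) (*-identityʳ _))

      ss′ : ∀ i → s i * s′ i ≈ x
      ss′ i with from i ≟ 0#
      ... | yes _ = *-identityˡ x
      ... | no  _ = *-identityʳ x

    fermat-nonzero : x ^ q ≈ x
    fermat-nonzero = begin
      x ^ q                ≈⟨ sym (∏-replicate q) ⟩
      ∏ {q} (λ _ → x)      ≈⟨ ∏-cong (λ i → sym (ss′ i)) ⟩
      ∏ (λ i → s i * s′ i) ≈⟨ ∏-distrib-* s s′ ⟩
      ∏ s * ∏ s′           ≈⟨ *-congʳ ∏s≈1 ⟩
      1# * ∏ s′            ≈⟨ *-identityˡ _ ⟩
      ∏ s′                 ≈⟨ ∏s′ s′ (to 0#) (λ j ne → reflexive (ifZero-no x 1# (from j ≟ 0#)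
                                λ e → ne (from-injective (trans (from-to 0#) (sym e))))) ⟩
      s′ (to 0#)           ≡⟨ ifZero-yes x 1# (_ ≟ 0#) (from-to 0#) ⟩
      x                    ∎

  fermat : ∀ x → x ^ q ≈ x
  fermat x with x ≟ 0#
  ... | no x≉0  = fermat-nonzero x x≉0
  ... | yes x≈0 = zero-power q 2≤q
    where
    zero-power : ∀ n → 2 ℕ.≤ n → x ^ n ≈ x
    zero-power (suc n) _ = trans (^-congˡ (suc n) x≈0) (trans (0^ n) (sym x≈0))

module FieldHomomorphism {c ℓ c′ ℓ′} (F : Field c ℓ) (_≟_ : ∀ x y → Dec (Field._≈_ F x y))
  (R : CommutativeRing c′ ℓ′)
  (1≉0 : ¬ CommutativeRing._≈_ R (CommutativeRing.1# R) (CommutativeRing.0# R))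
  (j : Field.Carrier F → CommutativeRing.Carrier R)
  (j-hom : IsRingHomomorphism (Field.rawRing F) (CommutativeRing.rawRing R) j) where
  private
    module F = Field F
    module FK = RingKit F.commutativeRing
    module J = IsRingHomomorphism j-hom
  open RingKit R
  open SetoidReasoning setoid

  j-injective : ∀ {x y} → j x ≈ j y → x F.≈ y
  j-injective {x} {y} e with x ≟ y
  ... | yes p = p
  ... | no ¬p with z , uz≈1 ← F.inverse (x F.- y) (λ p → ¬p (FK.x-y≈0⇒x≈y p)) =
    contradiction (begin
      1#                     ≈⟨ sym J.1#-homo ⟩
      j F.1#                 ≈⟨ J.⟦⟧-cong (F.sym uz≈1) ⟩
      j ((x F.- y) F.* z)    ≈⟨ J.*-homo _ _ ⟩
      j (x F.- y) * j z      ≈⟨ *-congʳ (trans (J.+-homo _ _) (+-congˡ (J.-‿homo y))) ⟩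
      (j x - j y) * j z      ≈⟨ *-congʳ (x≈y⇒x-y≈0 e) ⟩
      0# * j z               ≈⟨ zeroˡ _ ⟩
      0#                     ∎) 1≉0

module FrobeniusOver {c ℓ c′ ℓ′} (F : Field c ℓ) {q : ℕ} (card : HasCardinality (Field.setoid F) q)
  (R : CommutativeRing c′ ℓ′) (nzd : NoZeroDivisors R)
  (1≉0 : ¬ CommutativeRing._≈_ R (CommutativeRing.1# R) (CommutativeRing.0# R))
  (j : Field.Carrier F → CommutativeRing.Carrier R)
  (j-hom : IsRingHomomorphism (Field.rawRing F) (CommutativeRing.rawRing R) j) where

  private
    module F = Field F
    module FF = FiniteField F card
    module FK = RingKit F.commutativeRing
  open RingKit R
  open Polynomials R
  open SetoidReasoning setoid
  open Inverse card using (from)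
  private module J = IsRingHomomorphism j-hom
  open FieldHomomorphism F FF._≟_ R 1≉0 j j-hom

  j-^ : ∀ x n → j (x FK.^ n) ≈ j x ^ n
  j-^ x zero    = J.1#-homo
  j-^ x (suc n) = trans (J.*-homo _ _) (*-congˡ (j-^ x n))

  fixed : ∀ x → j x ^ q ≈ j x
  fixed x = trans (sym (j-^ x q)) (J.⟦⟧-cong (FF.fermat x))

  private
    r : Fin q → Carrier
    r i = j (from i)

    r-injective : ∀ i k → r i ≈ r k → i ≡ k
    r-injective i k e = FF.from-injective (j-injective e)

    -- (X + y)^q - X^q - y^q has degree less than q.
    extend : ∀ y → (∀ i → (r i + y) ^ q ≈ r i ^ q + y ^ q) → ∀ X → (X + y) ^ q ≈ X ^ q + y ^ q
    extend y h X with [X+y]^ y q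
    ... | cs , len , e = go
      where
      D = zipWith _-_ cs (replicate q 0#)
      D-len : length D ≡ q
      D-len = ≡.trans (Listₚ.length-zipWith _-_ cs (replicate q 0#))
        (≡.trans (≡.cong₂ ℕ._⊓_ len (Listₚ.length-replicate q)) (ℕₚ.⊓-idem q))
      D-ev : ∀ X → ev (1# - 1#) D X ≈ (X + y) ^ q - X ^ q
      D-ev X = trans (ev-zipWith-minus 1# 1# cs _ X (≡.trans len (≡.sym (Listₚ.length-replicate q))))
        (+-cong (sym (e X)) (-‿cong (ev-zeros q X)))
      go : (X + y) ^ q ≈ X ^ q + y ^ q
      go with D | D-len | D-ev
      -- The constant coefficient of `D` has to absorb `y ^ q`, so `D` must be nonempty; this is
      -- where q ≥ 2 enters.
      ... | [] | l | _ = contradiction (≡.subst (2 ℕ.≤_) (≡.sym l) FF.2≤q) λ ()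
      ... | d ∷ ds | l | ev-D = begin
        (X + y) ^ q                                ≈⟨ solve 3 (λ a b c → a := (a :- b :- c) :+ (b :+ c)) refl _ (X ^ q) (y ^ q) ⟩
        (((X + y) ^ q - X ^ q) - y ^ q) + (X ^ q + y ^ q) ≈⟨ +-congʳ (sym (E X)) ⟩
        ev (1# - 1#) (d - y ^ q ∷ ds) X + (X ^ q + y ^ q)
          ≈⟨ +-congʳ (roots⇒product nzd (1# - 1#) (d - y ^ q ∷ ds) r l r-injective
               (λ i → trans (E (r i)) (trans (solve 3 (λ a b c → (a :- b :- c) := a :- (b :+ c)) refl _ _ _) (x≈y⇒x-y≈0 (h i)))) X) ⟩
        (1# - 1#) * ∏ (λ i → X - r i) + (X ^ q + y ^ q)
          ≈⟨ solve 2 (λ p z → (:1 :- :1) :* p :+ z := z) refl _ _ ⟩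
        X ^ q + y ^ q ∎
        where
        E : ∀ X → ev (1# - 1#) (d - y ^ q ∷ ds) X ≈ ((X + y) ^ q - X ^ q) - y ^ q
        E X = trans (solve 3 (λ d y e → (d :- y) :+ e := (d :+ e) :- y) refl d (y ^ q) _) (+-congʳ (ev-D X))

    onF : ∀ k X → (X + r k) ^ q ≈ X ^ q + r k ^ q
    onF k = extend (r k) λ i → begin
      (r i + r k) ^ q          ≈⟨ ^-congˡ q (sym (J.+-homo _ _)) ⟩
      j (from i F.+ from k) ^ q ≈⟨ fixed _ ⟩
      j (from i F.+ from k)    ≈⟨ J.+-homo _ _ ⟩
      r i + r k                ≈⟨ sym (+-cong (fixed _) (fixed _)) ⟩
      r i ^ q + r k ^ q        ∎

  -- `extend` is applied twice. For y in F, additivity at the points of F is Fermat's identity,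
  -- which gives it for all X. By symmetry it then holds at the points of F for an arbitrary y, and
  -- extends once more. The argument never mentions the characteristic or that q is a prime power.
  frobenius-+ : ∀ x y → (x + y) ^ q ≈ x ^ q + y ^ q
  frobenius-+ x y = extend y (λ i → trans (^-congˡ q (+-comm _ _)) (trans (onF i y) (+-comm _ _))) x

  -- The q elements of F exhaust the roots of X^q - X: it equals the product of the X - r over F,
  -- and a vanishing product has a vanishing factor.
  fixed⇒∈F : ∀ z → z ^ q ≈ z → ∃ λ x → z ≈ j x
  fixed⇒∈F z e = let i , p = ∏≈0⇒∃ nzd 1≉0 (λ i → z - r i) ∏≈0 in from i , x-y≈0⇒x≈y p
    where
    X^n-X : ∀ n → 2 ℕ.≤ n → ∃ λ cs → length cs ≡ n × (∀ X → ev 1# cs X ≈ X ^ n - X)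
    X^n-X 1 (ℕ.s≤s ())
    X^n-X (suc (suc n)) _ = 0# ∷ - 1# ∷ replicate n 0# ,
      ≡.cong (λ k → suc (suc k)) (Listₚ.length-replicate n) , λ X → begin
        0# + X * (- 1# + X * ev 1# (replicate n 0#) X)  ≈⟨ +-congˡ (*-congˡ (+-congˡ (*-congˡ (ev-zeros n X)))) ⟩
        0# + X * (- 1# + X * X ^ n)  ≈⟨ solve 2 (λ X E → con (ℤ.+ 0) :+ X :* (:- :1 :+ X :* E) := X :* (X :* E) :- X) refl X (X ^ n) ⟩
        X * (X * X ^ n) - X ∎
    ∏≈0 : ∏ (λ i → z - r i) ≈ 0#
    ∏≈0 with cs , len , ev-cs ← X^n-X q FF.2≤q = begin
      ∏ (λ i → z - r i)       ≈⟨ sym (*-identityˡ _) ⟩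
      1# * ∏ (λ i → z - r i)  ≈⟨ sym (roots⇒product nzd 1# cs r len r-injective
                                   (λ i → trans (ev-cs (r i)) (x≈y⇒x-y≈0 (fixed _))) z) ⟩
      ev 1# cs z              ≈⟨ ev-cs z ⟩
      z ^ q - z               ≈⟨ x≈y⇒x-y≈0 e ⟩
      0#                      ∎

  φ : Carrier → Carrier
  φ x = x ^ q

  φ-cong : ∀ {x y} → x ≈ y → φ x ≈ φ y
  φ-cong = ^-congˡ q

  φ-0 : φ 0# ≈ 0#
  φ-0 = 0^n q FF.2≤q
    where
    0^n : ∀ n → 2 ℕ.≤ n → 0# ^ n ≈ 0#
    0^n (suc n) _ = 0^ n

  φ-neg : ∀ x → φ (- x) ≈ - φ x
  φ-neg x = begin
    φ (- x)                   ≈⟨ solve 2 (λ a b → a := (a :+ b) :- b) refl _ (φ x) ⟩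
    (φ (- x) + φ x) - φ x     ≈⟨ +-congʳ (sym (frobenius-+ (- x) x)) ⟩
    φ (- x + x) - φ x         ≈⟨ +-congʳ (trans (φ-cong (-‿inverseˡ x)) φ-0) ⟩
    0# - φ x                  ≈⟨ +-identityˡ _ ⟩
    - φ x                     ∎

  φ-hom : IsRingHomomorphism rawRing rawRing φ
  φ-hom = record
    { isSemiringHomomorphism = record
      { isNearSemiringHomomorphism = record
        { +-isMonoidHomomorphism = record
          { isMagmaHomomorphism = record
            { isRelHomomorphism = record { cong = φ-cong }
            ; homo = frobenius-+
            }
          ; ε-homo = φ-0
          }
        ; *-homo = λ x y → ^-distrib-* x y q
        }
      ; 1#-homo = 1^ q
      }
    ; -‿homo = φ-neg
    }

  φ-ev : ∀ xs X → φ (ev 1# (map j xs) X) ≈ ev 1# (map j xs) (φ X)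
  φ-ev []       X = 1^ q
  φ-ev (x ∷ xs) X = trans (frobenius-+ _ _) (+-cong (fixed x) (trans (^-distrib-* X _ q) (*-congˡ (φ-ev xs X))))

  φ-root : ∀ xs {n} (t : Fin n → Carrier) → (∀ X → ev 1# (map j xs) X ≈ ∏ (λ i → X - t i)) →
           ∀ {x} i → x ≈ t i → ∃ λ k → φ x ≈ t k
  φ-root xs t e {x} i x≈t = let k , p = ∏≈0⇒∃ nzd 1≉0 (λ i → φ x - t i) product≈0 in k , x-y≈0⇒x≈y p
    where
    product≈0 : ∏ (λ i → φ x - t i) ≈ 0#
    product≈0 = begin
      ∏ (λ i → φ x - t i)        ≈⟨ sym (e (φ x)) ⟩
      ev 1# (map j xs) (φ x)     ≈⟨ sym (φ-ev xs x) ⟩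
      φ (ev 1# (map j xs) x)     ≈⟨ φ-cong (trans (e x) (∏-zero (λ i → x - t i) i (x≈y⇒x-y≈0 x≈t))) ⟩
      φ 0#                       ≈⟨ φ-0 ⟩
      0#                         ∎

-- Norms and characteristic polynomials in Galois extensions

module RingHomomorphismKit {c ℓ c′ ℓ′} (R : CommutativeRing c ℓ) (S : CommutativeRing c′ ℓ′)
  (f : CommutativeRing.Carrier R → CommutativeRing.Carrier S)
  (f-hom : IsRingHomomorphism (CommutativeRing.rawRing R) (CommutativeRing.rawRing S) f) where
  private module R = RingKit R
  open RingKit S
  open IsRingHomomorphism f-hom

  ^-homo : ∀ x n → f (x R.^ n) ≈ f x ^ n
  ^-homo x zero    = 1#-homo
  ^-homo x (suc n) = trans (*-homo x _) (*-congˡ (^-homo x n))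

  ∏-homo : ∀ {n} (t : Fin n → R.Carrier) → f (R.∏ t) ≈ ∏ (f ∘ t)
  ∏-homo {zero}  t = 1#-homo
  ∏-homo {suc n} t = trans (*-homo _ _) (*-congˡ (∏-homo (t ∘ suc)))

  sum-homo : ∀ {n} (t : Fin n → R.Carrier) → f (R.sum t) ≈ sum (f ∘ t)
  sum-homo {zero}  t = 0#-homo
  sum-homo {suc n} t = trans (+-homo _ _) (+-congˡ (sum-homo (t ∘ suc)))

  minus-homo : ∀ x y → f (x R.- y) ≈ f x - f y
  minus-homo x y = trans (+-homo x (R.- y)) (+-congˡ (-‿homo y))

module RootPolynomial {c ℓ} (R : CommutativeRing c ℓ) where
  open RingKit R
  open Polynomials R
  open PermutationSetoid setoid using (_↭_)

  infix 4 _≋_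
  _≋_ : List Carrier → List Carrier → Set _
  _≋_ = Pointwise _≈_

  ≋-refl : ∀ {cs} → cs ≋ cs
  ≋-refl = Pointwise.refl refl

  ≋-trans : ∀ {as bs cs} → as ≋ bs → bs ≋ cs → as ≋ cs
  ≋-trans = Pointwise.transitive trans

  ev-cong : ∀ a {cs ds} X → cs ≋ ds → ev a cs X ≈ ev a ds X
  ev-cong a X []       = refl
  ev-cong a X (e ∷ es) = +-cong e (*-congˡ (ev-cong a X es))

  mulRoot-cong : ∀ {r s p q cs ds} → r ≈ s → p ≈ q → cs ≋ ds → mulRoot r p cs ≋ mulRoot s q ds
  mulRoot-cong e f []       = +-cong f (-‿cong e) ∷ []
  mulRoot-cong e f (g ∷ gs) = +-cong f (-‿cong (*-cong e g)) ∷ mulRoot-cong e g gs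

  -- The carries x and y are arbitrary because the induction changes them: passing the coefficient c
  -- replaces the pair x, y by y, c.
  mulRoot-comm : ∀ r s x y cs → mulRoot r (x - s * y) (mulRoot s y cs) ≋ mulRoot s (x - r * y) (mulRoot r y cs)
  mulRoot-comm r s x y [] =
    solve 4 (λ r s x y → (x :- s :* y) :- r :* (y :- s) := (x :- r :* y) :- s :* (y :- r)) refl r s x y ∷
    solve 3 (λ r s y → (y :- s) :- r := (y :- r) :- s) refl r s y ∷ []
  mulRoot-comm r s x y (c ∷ cs) =
    solve 5 (λ r s x y c → (x :- s :* y) :- r :* (y :- s :* c) := (x :- r :* y) :- s :* (y :- r :* c)) refl r s x y c ∷
    mulRoot-comm r s y c cs

  rootsPoly : List Carrier → List Carrier
  rootsPoly []       = []
  rootsPoly (r ∷ rs) = mulRoot r 0# (rootsPoly rs)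

  rootsPoly-≋ : ∀ {rs ss} → rs ≋ ss → rootsPoly rs ≋ rootsPoly ss
  rootsPoly-≋ []       = []
  rootsPoly-≋ (e ∷ es) = mulRoot-cong e refl (rootsPoly-≋ es)

  rootsPoly-↭ : ∀ {rs ss} → rs ↭ ss → rootsPoly rs ≋ rootsPoly ss
  rootsPoly-↭ (↭.refl es)   = rootsPoly-≋ es
  rootsPoly-↭ (↭.prep e p)  = mulRoot-cong e refl (rootsPoly-↭ p)
  rootsPoly-↭ (↭.swap {ys = ys} {x} {y} e f p) = ≋-trans (mulRoot-cong e zero≈ (mulRoot-cong f refl (rootsPoly-↭ p)))
    (≋-trans (mulRoot-comm _ _ 0# 0# (rootsPoly ys)) (mulRoot-cong refl (sym zero≈) ≋-refl))
    where
    zero≈ : ∀ {z} → 0# ≈ 0# - z * 0#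
    zero≈ {z} = solve 1 (λ z → con (ℤ.+ 0) := con (ℤ.+ 0) :- z :* con (ℤ.+ 0)) refl z
  rootsPoly-↭ (↭.trans p q) = ≋-trans (rootsPoly-↭ p) (rootsPoly-↭ q)

  -- In the commutative monoid of lists under `_++_` up to `_↭_`, a list is the sum of its
  -- singletons. `∑-permute` in that monoid turns a permutation of indices into a permutation of
  -- lists.
  rootsPoly-permute : ∀ {n} (t : Fin n → Carrier) (π : Permutation n n) →
                      rootsPoly (tabulate t) ≋ rootsPoly (tabulate (t ∘ (π ⟨$⟩ʳ_)))
  rootsPoly-permute t π = rootsPoly-↭ (≡.subst₂ _↭_ (≡.sym (concat-singletons t)) (≡.sym (concat-singletons (t ∘ (π ⟨$⟩ʳ_))))
    (L.∑-permute (λ i → t i ∷ []) π))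
    where
    module L = CommutativeMonoidSum (PermutationSetoidProperties.++-commutativeMonoid setoid)
    concat-singletons : ∀ {n} (t : Fin n → Carrier) → tabulate t ≡ L.sum (λ i → t i ∷ [])
    concat-singletons {zero}  t = ≡.refl
    concat-singletons {suc n} t = ≡.cong (t zero ∷_) (concat-singletons (t ∘ suc))

  ev-rootsPoly : ∀ {n} (t : Fin n → Carrier) X → ev 1# (rootsPoly (tabulate t)) X ≈ ∏ (λ i → X - t i)
  ev-rootsPoly {zero}  t X = refl
  ev-rootsPoly {suc n} t X = trans (ev-mulRoot (t zero) 0# (rootsPoly (tabulate (λ i → t (suc i)))) X)
    (trans (+-identityˡ _) (*-congˡ (ev-rootsPoly (t ∘ suc) X)))

  module _ (f : Carrier → Carrier) (f-hom : IsRingHomomorphism rawRing rawRing f) where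
    open IsRingHomomorphism f-hom using (*-homo; 0#-homo)
    open RingHomomorphismKit R R f f-hom using (minus-homo)

    map-mulRoot : ∀ r p cs → map f (mulRoot r p cs) ≋ mulRoot (f r) (f p) (map f cs)
    map-mulRoot r p []       = minus-homo p r ∷ []
    map-mulRoot r p (c ∷ cs) =
      trans (minus-homo p (r * c)) (+-congˡ (-‿cong (*-homo r c))) ∷ map-mulRoot r c cs

    map-rootsPoly : ∀ rs → map f (rootsPoly rs) ≋ rootsPoly (map f rs)
    map-rootsPoly []       = []
    map-rootsPoly (r ∷ rs) = ≋-trans (map-mulRoot r 0# _)
      (mulRoot-cong refl 0#-homo (map-rootsPoly rs))

module GaloisNorm {c ℓ c′ ℓ′} {K : Field c ℓ} (E : FieldExtension K c′ ℓ′) (isGalois : IsGalois E)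
  {N : ℕ} (card : HasCardinality (Group.setoid (Gal E)) N) where

  open FieldExtension E using (top; ι)
  private
    module K = RingKit (Field.commutativeRing K)
    module G = Group (Gal E)
  open RingKit (Field.commutativeRing top)
  open Polynomials (Field.commutativeRing top)
  open RootPolynomial (Field.commutativeRing top)
  open SetoidReasoning setoid
  open Inverse card using (to; from; to-cong; inverseˡ; inverseʳ)
  open Automorphism using (⟦_⟧)

  module AutKit (τ : Automorphism E) =
    RingHomomorphismKit (Field.commutativeRing top) (Field.commutativeRing top) ⟦ τ ⟧
      (Automorphism.isRingHomomorphism τ)

  σ : Fin N → Carrier → Carrier
  σ i = ⟦ from i ⟧

  index-correct : ∀ τ x → σ (to τ) x ≈ ⟦ τ ⟧ x
  index-correct τ = inverseʳ {τ} ≡.refl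

  translate : Automorphism E → Permutation N N
  translate τ = permutation (λ i → to (τ G.∙ from i)) (λ i → to (τ G.⁻¹ G.∙ from i))
    (λ i → cancel τ (τ G.⁻¹) (G.inverseʳ τ) i) (λ i → cancel (τ G.⁻¹) τ (G.inverseˡ τ) i)
    where
    cancel : ∀ τ ρ → τ G.∙ ρ G.≈ G.ε → ∀ i → to (τ G.∙ from (to (ρ G.∙ from i))) ≡ i
    cancel τ ρ e i = ≡.trans (to-cong {τ G.∙ from (to (ρ G.∙ from i))} {from i}
      (λ x → trans (Automorphism.⟦⟧-cong τ (index-correct (ρ G.∙ from i) x)) (e (σ i x))))
      (inverseˡ {i} {from i} λ x → refl)

  translate-correct : ∀ τ i x → σ (translate τ ⟨$⟩ʳ i) x ≈ ⟦ τ ⟧ (σ i x)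
  translate-correct τ i = index-correct (τ G.∙ from i)

  ∏σ-invariant : ∀ τ x → ⟦ τ ⟧ (∏ (λ i → σ i x)) ≈ ∏ (λ i → σ i x)
  ∏σ-invariant τ x = begin
    ⟦ τ ⟧ (∏ (λ i → σ i x))                ≈⟨ AutKit.∏-homo τ (λ i → σ i x) ⟩
    ∏ (λ i → ⟦ τ ⟧ (σ i x))                ≈⟨ ∏-cong (λ i → sym (translate-correct τ i x)) ⟩
    ∏ (λ i → σ (translate τ ⟨$⟩ʳ i) x)     ≈⟨ sym (∏-permute (λ i → σ i x) (translate τ)) ⟩
    ∏ (λ i → σ i x)                        ∎

  Norm : Carrier → K.Carrier
  Norm x = proj₁ (isGalois _ λ τ → ∏σ-invariant τ x)

  ι-Norm : ∀ x → ι (Norm x) ≈ ∏ (λ i → σ i x)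
  ι-Norm x = proj₂ (isGalois _ λ τ → ∏σ-invariant τ x)

  translateʳ : Automorphism E → Permutation N N
  translateʳ τ = permutation (λ i → to (from i G.∙ τ)) (λ i → to (from i G.∙ τ G.⁻¹))
    (λ i → cancel τ (τ G.⁻¹) (G.inverseˡ τ) i) (λ i → cancel (τ G.⁻¹) τ (G.inverseʳ τ) i)
    where
    cancel : ∀ τ ρ → ρ G.∙ τ G.≈ G.ε → ∀ i → to (from (to (from i G.∙ ρ)) G.∙ τ) ≡ i
    cancel τ ρ e i = ≡.trans (to-cong {from (to (from i G.∙ ρ)) G.∙ τ} {from i}
      (λ x → trans (index-correct (from i G.∙ ρ) (⟦ τ ⟧ x)) (Automorphism.⟦⟧-cong (from i) (e x))))
      (inverseˡ {i} {from i} λ x → refl)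

  -- Left translation shows that the product of conjugates is fixed by τ; right translation shows
  -- that x and τx have the same product, which later makes the norm invariant under G.
  ∏σ-automorphism : ∀ τ x → ∏ (λ i → σ i (⟦ τ ⟧ x)) ≈ ∏ (λ i → σ i x)
  ∏σ-automorphism τ x = begin
    ∏ (λ i → σ i (⟦ τ ⟧ x))                 ≈⟨ ∏-cong (λ i → sym (index-correct (from i G.∙ τ) x)) ⟩
    ∏ (λ i → σ (translateʳ τ ⟨$⟩ʳ i) x)     ≈⟨ sym (∏-permute (λ i → σ i x) (translateʳ τ)) ⟩
    ∏ (λ i → σ i x)                         ∎

  conjugates : Carrier → List Carrier
  conjugates x = tabulate (λ i → σ i x)


  -- The statement is coefficientwise, not about polynomial functions, because `isGalois` descends
  -- one element at a time. τ permutes the conjugates, and the coefficients do not depend on their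
  -- order.
  coefficients-invariant : ∀ τ x → map ⟦ τ ⟧ (rootsPoly (conjugates x)) ≋ rootsPoly (conjugates x)
  coefficients-invariant τ x =
    ≋-trans (map-rootsPoly ⟦ τ ⟧ (Automorphism.isRingHomomorphism τ) (conjugates x))
    (≋-trans (rootsPoly-≋ (≡.subst (_≋ tabulate (λ i → σ (translate τ ⟨$⟩ʳ i) x))
      (≡.sym (Listₚ.map-tabulate (λ i → σ i x) ⟦ τ ⟧)) (Pointwise.tabulate⁺ (λ i → sym (translate-correct τ i x)))))
      (Pointwise.symmetric sym (rootsPoly-permute (λ i → σ i x) (translate τ))))

  descend : ∀ cs → (∀ (τ : Automorphism E) → map ⟦ τ ⟧ cs ≋ cs) → ∃ λ ks → map ι ks ≋ cs
  descend [] h = [] , []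
  descend (c ∷ cs) h with k , e ← isGalois c (λ τ → Pointwise.head (h τ))
                       | ks , es ← descend cs (λ τ → Pointwise.tail (h τ)) = k ∷ ks , e ∷ es

  charPoly : Carrier → List K.Carrier
  charPoly x = proj₁ (descend _ λ τ → coefficients-invariant τ x)

  ι-charPoly : ∀ x → map ι (charPoly x) ≋ rootsPoly (conjugates x)
  ι-charPoly x = proj₂ (descend _ λ τ → coefficients-invariant τ x)

  ev-charPoly : ∀ x X → ev 1# (map ι (charPoly x)) X ≈ ∏ (λ i → X - σ i x)
  ev-charPoly x X = trans (ev-cong 1# X (ι-charPoly x)) (ev-rootsPoly (λ i → σ i x) X)

-- Discrete valuations and the filtration of L by lattices

≤⁺-transitive : ∀ {x y z} → x ≤⁺ y → y ≤⁺ z → x ≤⁺ z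
≤⁺-transitive = ≤⁺-trans ℤₚ.≤-trans

+⁺-mono : ∀ {m n x y} → [ m ] ≤⁺ x → [ n ] ≤⁺ y → [ m ℤ.+ n ] ≤⁺ x +⁺ y
+⁺-mono [ p ]   [ q ]   = [ ℤₚ.+-mono-≤ p q ]
+⁺-mono [ p ]   (_ ≤⊤⁺) = _ ≤⊤⁺
+⁺-mono (_ ≤⊤⁺) _       = _ ≤⊤⁺

[]⁺-injective : ∀ {i j : ℤ} → _≡_ {A = ℤ ⁺} [ i ] [ j ] → i ≡ j
[]⁺-injective ≡.refl = ≡.refl

[i]≢⊤⁺ : ∀ {i : ℤ} → ¬ _≡_ {A = ℤ ⁺} [ i ] ⊤⁺
[i]≢⊤⁺ ()

+⁺-cancel : ∀ x y {i} → x +⁺ y ≡ [ 0ℤ ] → x ≡ [ i ] → y ≡ [ ℤ.- i ]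
+⁺-cancel [ i ] [ j ] e ≡.refl = ≡.cong [_]
  (inverseʳ-unique i j ([]⁺-injective e))
  where
  open GroupProperties (AbelianGroup.group ℤₚ.+-0-abelianGroup) using (inverseʳ-unique)

common-lower-bound : ∀ {p n} (P : Fin n → ℤ → Set p) →
  (∀ i {a b} → a ℤ.≤ b → P i b → P i a) → (∀ i → ∃ (P i)) → ∃ λ a → ∀ i → P i a
common-lower-bound {n = zero}  P mono ex = 0ℤ , λ ()
common-lower-bound {n = suc n} P mono ex
  with a , p ← ex zero | b , q ← common-lower-bound (P ∘ suc) (mono ∘ suc) (ex ∘ suc) =
  a ℤ.⊓ b , λ { zero → mono zero (ℤₚ.i⊓j≤i a b) p ; (suc i) → mono (suc i) (ℤₚ.i⊓j≤j a b) (q i) }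

module Valuation {c ℓ} (K : Field c ℓ) (v : Field.Carrier K → ℤ ⁺) (isDV : IsDiscreteValuation K v) where
  open Field K using (1≉0; inverse)
  open RingKit (Field.commutativeRing K)
  open IsDiscreteValuation isDV

  Above : ℤ → Carrier → Set
  Above n x = [ n ] ≤⁺ v x

  above? : ∀ n x → Dec (Above n x)
  above? n x = ≤⁺-dec ℤₚ._≤?_ [ n ] (v x)

  above-cong : ∀ {n x y} → x ≈ y → Above n x → Above n y
  above-cong x≈y = ≡.subst (_ ≤⁺_) (v-cong x≈y)

  above-mono : ∀ {m n x} → m ℤ.≤ n → Above n x → Above m x
  above-mono m≤n = ≤⁺-transitive [ m≤n ]

  above-0 : ∀ {n} → Above n 0#
  above-0 = ≡.subst (_ ≤⁺_) (≡.sym (Equivalence.from (v-∞ 0#) refl)) (_ ≤⊤⁺)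

  above-+ : ∀ {n x y} → Above n x → Above n y → Above n (x + y)
  above-+ p q = ≤⁺-transitive (⊓-glb p q) (v-+ _ _)

  above-* : ∀ {m n x y} → Above m x → Above n y → Above (m ℤ.+ n) (x * y)
  above-* p q = ≡.subst (_ ≤⁺_) (≡.sym (v-* _ _)) (+⁺-mono p q)

  v1 : v 1# ≡ [ 0ℤ ]
  v1 with v 1# in e | ≡.trans (v-cong (sym (*-identityˡ 1#))) (v-* 1# 1#)
  ... | ⊤⁺    | _  = contradiction (Equivalence.to (v-∞ 1#) e) 1≉0
  ... | [ i ] | e′ = ≡.cong [_] (identityˡ-unique′ i i (≡.sym ([]⁺-injective e′)))
    where
    open GroupProperties (AbelianGroup.group ℤₚ.+-0-abelianGroup) using () renaming (identityˡ-unique to identityˡ-unique′)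

  above-1 : Above 0ℤ 1#
  above-1 = ≡.subst (_ ≤⁺_) (≡.sym v1) [ ℤₚ.≤-refl ]

  ¬above-1-1 : ¬ Above 1ℤ 1#
  ¬above-1-1 p with ≡.subst ([ 1ℤ ] ≤⁺_) v1 p
  ... | [ ℤ.+≤+ () ]

  v-inverse : ∀ {x y i} → x * y ≈ 1# → v x ≡ [ i ] → v y ≡ [ ℤ.- i ]
  v-inverse {x} {y} e = +⁺-cancel (v x) (v y) (≡.trans (≡.sym (v-* x y)) (≡.trans (v-cong e) v1))

  above-neg : ∀ {n x} → Above n x → Above n (- x)
  above-neg {n} {x} p = above-cong (-1*x≈-x x) (≡.subst (λ k → Above k (- 1# * x)) (ℤₚ.+-identityˡ n) (above-* above-neg1 p))
    where
    [-1]² : - 1# * - 1# ≈ 1#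
    [-1]² = solve 0 (:- :1 :* :- :1 := :1) refl
    above-neg1 : Above 0ℤ (- 1#)
    above-neg1 with v (- 1#) in e
    ... | ⊤⁺ = _ ≤⊤⁺
    ... | [ i ] with ≡.trans (≡.sym e) (v-inverse [-1]² e)
    ...   | e′ = [ ℤₚ.≤-reflexive (≡.sym (self-negative i ([]⁺-injective e′))) ]
      where
      self-negative : ∀ i → i ≡ ℤ.- i → i ≡ 0ℤ
      self-negative (ℤ.+ 0)       _  = ≡.refl
      self-negative (ℤ.+ suc _)   ()
      self-negative (ℤ.-[1+ _ ])  ()

  above-minus : ∀ {n x y} → Above n x → Above n y → Above n (x - y)
  above-minus p q = above-+ p (above-neg q)

  lower-bound : ∀ x → ∃ λ n → Above n x
  lower-bound x with v x
  ... | ⊤⁺    = 0ℤ , (_ ≤⊤⁺)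
  ... | [ i ] = i , [ ℤₚ.≤-refl ]

  above-all⇒≈0 : ∀ x → (∀ n → Above n x) → x ≈ 0#
  above-all⇒≈0 x h with v x in e
  ... | ⊤⁺    = Equivalence.to (v-∞ x) e
  ... | [ i ] = contradiction ([≤]-injective (h (1ℤ ℤ.+ i))) (ℤₚ.<⇒≱ (ℤₚ.suc[i]≤j⇒i<j {i} ℤₚ.≤-refl))

  finite-valuation : ∀ x → ¬ x ≈ 0# → ∃ λ i → v x ≡ [ i ]
  finite-valuation x x≉0 with v x in e
  ... | ⊤⁺    = contradiction (Equivalence.to (v-∞ x) e) x≉0
  ... | [ i ] = i , ≡.refl

  ≈0? : ∀ x → Dec (x ≈ 0#)
  ≈0? x with v x in e
  ... | ⊤⁺    = yes (Equivalence.to (v-∞ x) e)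
  ... | [ i ] = no λ x≈0 → [i]≢⊤⁺ (≡.trans (≡.sym e) (Equivalence.from (v-∞ x) x≈0))

  infix 4 _≟_
  _≟_ : ∀ x y → Dec (x ≈ y)
  x ≟ y = Dec.map′ x-y≈0⇒x≈y x≈y⇒x-y≈0 (≈0? (x - y))

  scale : ∀ m → ∃ λ s → ∃ λ s⁻¹ → s * s⁻¹ ≈ 1# × v s ≡ [ m ] × v s⁻¹ ≡ [ ℤ.- m ]
  scale m with s , vs ← v-surjective m
    with s⁻¹ , e ← inverse s (λ s≈0 → [i]≢⊤⁺ (≡.trans (≡.sym vs) (Equivalence.from (v-∞ s) s≈0))) =
    s , s⁻¹ , e , vs , v-inverse e vs

  above-≡ : ∀ {i x} → v x ≡ [ i ] → Above i x
  above-≡ e = ≡.subst (_ ≤⁺_) (≡.sym e) [ ℤₚ.≤-refl ]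

  v≡0 : ∀ {x} → Above 0ℤ x → ¬ Above 1ℤ x → v x ≡ [ 0ℤ ]
  v≡0 {x} p ¬p with v x
  v≡0 p  ¬p | ⊤⁺              = contradiction (_ ≤⊤⁺) ¬p
  v≡0 p  ¬p | [ ℤ.+ zero ]    = ≡.refl
  v≡0 p  ¬p | [ ℤ.+ suc n ]   = contradiction [ ℤ.+≤+ (ℕ.s≤s ℕ.z≤n) ] ¬p
  v≡0 [ () ] ¬p | [ ℤ.-[1+ n ] ]

  v≡0⇒¬above-1 : ∀ {x} → v x ≡ [ 0ℤ ] → ¬ Above 1ℤ x
  v≡0⇒¬above-1 e p with ≡.subst ([ 1ℤ ] ≤⁺_) e p
  ... | [ ℤ.+≤+ () ]

  near-1⇒v≡0 : ∀ x → Above 1ℤ (1# - x) → v x ≡ [ 0ℤ ]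
  near-1⇒v≡0 x p = v≡0
    (above-cong (solve 1 (λ x → :1 :- (:1 :- x) := x) refl x) (above-minus above-1 (above-mono (ℤ.+≤+ ℕ.z≤n) p)))
    (λ q → ¬above-1-1 (above-cong (solve 1 (λ x → (:1 :- x) :+ x := :1) refl x) (above-+ p q)))

  above-^ : ∀ {x} → Above 0ℤ x → ∀ m → Above 0ℤ (x ^ m)
  above-^ p zero    = above-1
  above-^ p (suc m) = above-* {0ℤ} {0ℤ} p (above-^ p m)

  private
    negative-^ : ∀ {x n} → v x ≡ [ ℤ.-[1+ n ] ] → ∀ m → ∃ λ j → v (x ^ m) ≡ [ j ] × j ℤ.≤ ℤ.- ℤ.+ m
    negative-^ e zero = 0ℤ , v1 , ℤₚ.≤-refl
    negative-^ {x} {n} e (suc m) with j , e′ , j≤ ← negative-^ e m =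
      ℤ.-[1+ n ] ℤ.+ j , ≡.trans (v-* x (x ^ m)) (≡.cong₂ _+⁺_ e e′) ,
      ≡.subst (ℤ.-[1+ n ] ℤ.+ j ℤ.≤_) (≡.sym (ℤₚ.neg-distrib-+ 1ℤ (ℤ.+ m))) (ℤₚ.+-mono-≤ (ℤ.-≤- ℕ.z≤n) j≤)

    unreachable : ∀ D → ¬ D ℤ.≤ ℤ.- ℤ.+ suc ℤ.∣ D ∣
    unreachable (ℤ.+ n) ()
    unreachable ℤ.-[1+ n ] (ℤ.-≤- p) = ℕₚ.1+n≰n p

  -- A negative valuation is at most -1, so v(x^m) ≤ -m, and the exponent ∣D∣ + 1 already falls
  -- below D.
  powers-above : ∀ {x} D → (∀ m → Above D (x ^ m)) → Above 0ℤ x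
  powers-above {x} D h with v x in e
  ... | ⊤⁺            = _ ≤⊤⁺
  ... | [ ℤ.+ n ]     = [ ℤ.+≤+ ℕ.z≤n ]
  ... | [ ℤ.-[1+ n ] ] with j , e′ , j≤ ← negative-^ e (suc ℤ.∣ D ∣) =
    contradiction (ℤₚ.≤-trans ([≤]-injective (≡.subst ([ D ] ≤⁺_) e′ (h (suc ℤ.∣ D ∣)))) j≤) (unreachable D)

i≤∣i∣ : ∀ i → i ℤ.≤ ℤ.+ ℤ.∣ i ∣
i≤∣i∣ (ℤ.+ n)    = ℤₚ.≤-refl
i≤∣i∣ ℤ.-[1+ n ] = ℤ.-≤+

module Complete {c ℓ} (K : Field c ℓ) (v : Field.Carrier K → ℤ ⁺) (isDV : IsDiscreteValuation K v)
                (isComplete : IsComplete K v) where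
  open RingKit (Field.commutativeRing K)
  open Valuation K v isDV

  telescope : ∀ (s : ℕ → Carrier) (R : ℤ) → (∀ k → Above (R ℤ.+ ℤ.+ k) (s (suc k) - s k)) →
              ∀ m j → Above (R ℤ.+ ℤ.+ m) (s (j ℕ.+ m) - s m)
  telescope s R h m zero    = above-cong (sym (-‿inverseʳ _)) above-0
  telescope s R h m (suc j) = above-cong
    (solve 3 (λ x y z → (x :- y) :+ (y :- z) := x :- z) refl (s (suc (j ℕ.+ m))) _ _)
    (above-+ (above-mono (ℤₚ.+-monoʳ-≤ R (ℤ.+≤+ (ℕₚ.m≤n+m m j))) (h (j ℕ.+ m))) (telescope s R h m j))

  telescope-≤ : ∀ (s : ℕ → Carrier) (R : ℤ) → (∀ k → Above (R ℤ.+ ℤ.+ k) (s (suc k) - s k)) →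
                ∀ m n → m ℕ.≤ n → Above (R ℤ.+ ℤ.+ m) (s n - s m)
  telescope-≤ s R h m n m≤n = ≡.subst (λ k → Above (R ℤ.+ ℤ.+ m) (s k - s m)) (ℕₚ.m∸n+n≡m m≤n)
    (telescope s R h m (n ℕ.∸ m))

  -- The limit inherits the explicit rate R + k: by the ultrametric inequality, telescoping and
  -- passing to a far term s n cost nothing.
  limit : ∀ (s : ℕ → Carrier) (R : ℤ) → (∀ k → Above (R ℤ.+ ℤ.+ k) (s (suc k) - s k)) →
          ∃ λ x → ∀ k → Above (R ℤ.+ ℤ.+ k) (x - s k)
  limit s R h = let x , conv = isComplete s cauchy in x , approximates x conv
    where
    reach : ∀ N → N ℤ.≤ R ℤ.+ ℤ.+ ℤ.∣ N ℤ.- R ∣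
    reach N = ≡.subst (ℤ._≤ R ℤ.+ ℤ.+ ℤ.∣ N ℤ.- R ∣)
      (+-*-Solver.solve 2 (λ N R → R +-*-Solver.:+ (N +-*-Solver.:- R) +-*-Solver.:= N) ≡.refl N R)
      (ℤₚ.+-monoʳ-≤ R (i≤∣i∣ (N ℤ.- R)))
    cauchy : IsCauchy K v s
    cauchy N = M , λ m n M≤m M≤n → above-mono (reach N) (above-cong
      (solve 3 (λ x y z → (x :- z) :- (y :- z) := x :- y) refl (s m) (s n) (s M))
      (above-minus (telescope-≤ s R h M m M≤m) (telescope-≤ s R h M n M≤n)))
      where
      M = ℤ.∣ N ℤ.- R ∣
    approximates : ∀ x → ConvergesTo K v s x → ∀ k → Above (R ℤ.+ ℤ.+ k) (x - s k)
    approximates x conv k with M , c ← conv (R ℤ.+ ℤ.+ k) = above-cong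
      (solve 3 (λ x y z → (y :- z) :- (y :- x) := x :- z) refl x (s n) (s k))
      (above-minus (telescope-≤ s R h k n (ℕₚ.m≤n⊔m M k)) (c n (ℕₚ.m≤m⊔n M k)))
      where
      n = M ℕ.⊔ k

module FiniteResidue {c ℓ} (K : Field c ℓ) (v : Field.Carrier K → ℤ ⁺) (isDV : IsDiscreteValuation K v)
  {q : ℕ} (card : HasCardinality (Field.setoid (Residue.residueField isDV)) q) where
  open Residue isDV using (𝒪)
  open RingKit (Field.commutativeRing K)
  open Valuation K v isDV
  open Inverse card using (to; from; inverseʳ)

  private
    π π⁻¹ : Carrier
    π = proj₁ (scale 1ℤ)
    π⁻¹ = proj₁ (proj₂ (scale 1ℤ))
    ππ⁻¹≈1 : π * π⁻¹ ≈ 1#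
    ππ⁻¹≈1 = proj₁ (proj₂ (proj₂ (scale 1ℤ)))

    rep : 𝒪 → Carrier
    rep x = proj₁ (from (to x))

    rep-close : ∀ x → Above 1ℤ (proj₁ x - rep x)
    rep-close x = above-cong (solve 2 (λ a b → :- (a :- b) := b :- a) refl _ _)
      (above-neg (inverseʳ {x} ≡.refl))

    shift : 𝒪 → 𝒪
    shift x = π⁻¹ * (proj₁ x - rep x) ,
      above-* {ℤ.- 1ℤ} {1ℤ} (above-≡ (proj₂ (proj₂ (proj₂ (proj₂ (scale 1ℤ)))))) (rep-close x)

  -- The first N digits of a π-adic expansion: the residue class of x, then recursively the code of
  -- (x - rep x)/π. This makes 𝒪 modulo π^N finite enough for the pigeonhole principle.
  code : ∀ N → ∃ λ m → Σ[ code ∈ (𝒪 → Fin m) ]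
         (∀ x y → code x ≡ code y → Above (ℤ.+ N) (proj₁ x - proj₁ y))
  code zero = 1 , (λ _ → zero) , λ x y _ → above-minus (proj₂ x) (proj₂ y)
  code (suc N) with m , cd , close ← code N = q ℕ.* m , (λ x → combine (to x) (cd (shift x))) , λ x y e →
    let tx≡ty , e′ = Finₚ.combine-injective _ _ _ _ e
    in above-cong (begin
      π * (π⁻¹ * (proj₁ x - rep x) - π⁻¹ * (proj₁ y - rep y))
        ≈⟨ solve 6 (λ p p′ x r y s → p :* (p′ :* (x :- r) :- p′ :* (y :- s)) := (p :* p′) :* ((x :- y) :- (r :- s)))
             refl π π⁻¹ (proj₁ x) (rep x) (proj₁ y) (rep y) ⟩
      (π * π⁻¹) * ((proj₁ x - proj₁ y) - (rep x - rep y))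
        ≈⟨ *-cong ππ⁻¹≈1 (+-congˡ (-‿cong (x≈y⇒x-y≈0 (reflexive (≡.cong (proj₁ ∘ from) tx≡ty))))) ⟩
      1# * ((proj₁ x - proj₁ y) - 0#)
        ≈⟨ solve 1 (λ x → :1 :* (x :- con (ℤ.+ 0)) := x) refl _ ⟩
      proj₁ x - proj₁ y ∎)
      (above-* {1ℤ} (above-≡ (proj₁ (proj₂ (proj₂ (proj₂ (scale 1ℤ)))))) (close _ _ e′))
    where open SetoidReasoning setoid

module Filtration {c ℓ c′ ℓ′} {K : Field c ℓ} (v : Field.Carrier K → ℤ ⁺) (isDV : IsDiscreteValuation K v)
  (isComplete : IsComplete K v)
  {q : ℕ} (card : HasCardinality (Field.setoid (Residue.residueField isDV)) q)
  (E : FieldExtension K c′ ℓ′) {n : ℕ}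
  (b : Vector (Field.Carrier (FieldExtension.top E)) n) (isBasis : IsBasis E b) where

  open FieldExtension E using (top; ι)
  open Field top using (1≉0)
  private
    module K = RingKit (Field.commutativeRing K)
    module ι = IsRingHomomorphism (FieldExtension.isRingHomomorphism E)
  open RingKit (Field.commutativeRing top)
  open Valuation K v isDV using (Above; above-cong; above-mono; above-0; above-+; above-neg; above-*; above-≡;
    lower-bound; above-all⇒≈0; scale; finite-valuation; v-inverse) renaming (≈0? to ≈0?ᴷ)
  open Complete K v isDV isComplete using (limit)
  open FiniteResidue K v isDV card using (code)
  open SetoidReasoning setoid
  open Automorphism using (⟦_⟧)

  combination : (Fin n → K.Carrier) → Carrier
  combination k = sum (λ i → ι (k i) * b i)

  coord : Carrier → Fin n → K.Carrier
  coord x = proj₁ (isBasis x)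

  expand : ∀ x → x ≈ combination (coord x)
  expand x = proj₁ (proj₂ (isBasis x))

  coord-unique : ∀ {x} k → x ≈ combination k → ∀ i → coord x i K.≈ k i
  coord-unique {x} k e = proj₂ (proj₂ (isBasis x)) {k} e

  coord-cong : ∀ {x y} → x ≈ y → ∀ i → coord x i K.≈ coord y i
  coord-cong {x} {y} e = coord-unique (coord y) (trans e (expand y))

  coord-+ : ∀ x y i → coord (x + y) i K.≈ coord x i K.+ coord y i
  coord-+ x y = coord-unique _ (begin
    x + y ≈⟨ +-cong (expand x) (expand y) ⟩
    combination (coord x) + combination (coord y) ≈⟨ sym (∑-distrib-+ (λ i → ι (coord x i) * b i) (λ i → ι (coord y i) * b i)) ⟩
    sum (λ i → ι (coord x i) * b i + ι (coord y i) * b i)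
      ≈⟨ sum-cong-≋ (λ i → trans (sym (distribʳ (b i) (ι (coord x i)) (ι (coord y i)))) (*-congʳ (sym (ι.+-homo (coord x i) (coord y i))))) ⟩
    combination (λ i → coord x i K.+ coord y i) ∎)

  coord-scale : ∀ k x i → coord (ι k * x) i K.≈ k K.* coord x i
  coord-scale k x = coord-unique _ (begin
    ι k * x ≈⟨ *-congˡ (expand x) ⟩
    ι k * combination (coord x) ≈⟨ *-distribˡ-sum (ι k) (λ i → ι (coord x i) * b i) ⟩
    sum (λ i → ι k * (ι (coord x i) * b i))
      ≈⟨ sum-cong-≋ (λ i → trans (sym (*-assoc (ι k) (ι (coord x i)) (b i))) (*-congʳ (sym (ι.*-homo k (coord x i))))) ⟩
    combination (λ i → k K.* coord x i) ∎)

  ι-neg1 : ∀ x → ι (K.- K.1#) * x ≈ - x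
  ι-neg1 x = trans (*-congʳ (trans (ι.-‿homo _) (-‿cong ι.1#-homo))) (-1*x≈-x x)

  coord-neg : ∀ x i → coord (- x) i K.≈ K.- coord x i
  coord-neg x i = K.trans (coord-cong (sym (ι-neg1 x)) i) (K.trans (coord-scale _ x i) (K.-1*x≈-x _))

  -- In K zero is detected by the value ∞; in L by the finitely many coordinates. All case
  -- distinctions on elements of L rest on this.
  ≈0? : ∀ x → Dec (x ≈ 0#)
  ≈0? x = Dec.map′
    (λ h → trans (expand x) (trans (sum-cong-≋ (λ i → trans (*-congʳ (trans (ι.⟦⟧-cong (h i)) ι.0#-homo)) (zeroˡ _))) (sum-0 n)))
    (λ e i → K.trans (coord-cong (trans e (sym (zeroʳ (ι K.0#)))) i) (K.trans (coord-scale K.0# 0# i) (K.zeroˡ _)))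
    (Finₚ.all? λ i → ≈0?ᴷ (coord x i))
    where
    sum-0 : ∀ n → sum {n} (λ _ → 0#) ≈ 0#
    sum-0 zero    = refl
    sum-0 (suc n) = trans (+-identityˡ _) (sum-0 n)

  infix 4 _≟_
  _≟_ : ∀ x y → Dec (x ≈ y)
  x ≟ y = Dec.map′ x-y≈0⇒x≈y x≈y⇒x-y≈0 (≈0? (x - y))

  Lattice : ℤ → Carrier → Set
  Lattice m x = ∀ i → Above m (coord x i)

  private
    Lattice-cong : ∀ {m x y} → x ≈ y → Lattice m x → Lattice m y
    Lattice-cong e p i = above-cong (coord-cong e i) (p i)

    Lattice-mono : ∀ {m k x} → m ℤ.≤ k → Lattice k x → Lattice m x
    Lattice-mono m≤k p i = above-mono m≤k (p i)

    Lattice-+ : ∀ {m x y} → Lattice m x → Lattice m y → Lattice m (x + y)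
    Lattice-+ p q i = above-cong (K.sym (coord-+ _ _ i)) (above-+ (p i) (q i))

    Lattice-scale : ∀ {m k a x} → Above m a → Lattice k x → Lattice (m ℤ.+ k) (ι a * x)
    Lattice-scale p q i = above-cong (K.sym (coord-scale _ _ i)) (above-* p (q i))

    Lattice-0 : ∀ {m} → Lattice m 0#
    Lattice-0 i = above-cong (K.trans (K.sym (K.zeroˡ _)) (K.trans (K.sym (coord-scale K.0# 0# i)) (coord-cong (zeroʳ _) i))) above-0

    Lattice-sum : ∀ {m j} (t : Fin j → Carrier) → (∀ i → Lattice m (t i)) → Lattice m (sum t)
    Lattice-sum {j = zero}  t p = Lattice-0
    Lattice-sum {j = suc j} t p = Lattice-+ (p zero) (Lattice-sum (t ∘ suc) (p ∘ suc))

    Lattice-exhaust : ∀ x → ∃ λ m → Lattice m x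
    Lattice-exhaust x = common-lower-bound (λ i m → Above m (coord x i)) (λ i → above-mono) (λ i → lower-bound (coord x i))

    Lattice-linear : ∀ {m k x} (t : Fin n → Carrier) → Lattice m x → (∀ i → Lattice k (t i)) →
                     Lattice (m ℤ.+ k) (sum (λ i → ι (coord x i) * t i))
    Lattice-linear t p q = Lattice-sum _ λ i → Lattice-scale (p i) (q i)

    -- Products of lattice elements lose only a constant: `d` bounds the valuations of the structure
    -- constants of the basis from below.
    structure-bound : ∃ λ d → ∀ i j → Lattice d (b i * b j)
    structure-bound = common-lower-bound (λ i d → ∀ j → Lattice d (b i * b j)) (λ i a≤b p j → Lattice-mono a≤b (p j)) λ i →
      common-lower-bound (λ j d → Lattice d (b i * b j)) (λ j → Lattice-mono) (λ j → Lattice-exhaust (b i * b j))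

    d : ℤ
    d = proj₁ structure-bound

    Lattice-* : ∀ {m k x y} → Lattice m x → Lattice k y → Lattice (m ℤ.+ (k ℤ.+ d)) (x * y)
    Lattice-* {x = x} {y} p q = Lattice-cong (sym xy) (Lattice-linear _ p λ i →
      Lattice-cong (sym (by i)) (Lattice-linear _ q (proj₂ structure-bound i)))
      where
      by : ∀ i → b i * y ≈ sum (λ j → ι (coord y j) * (b i * b j))
      by i = begin
        b i * y                                     ≈⟨ *-congˡ (expand y) ⟩
        b i * combination (coord y)                 ≈⟨ *-distribˡ-sum (b i) (λ j → ι (coord y j) * b j) ⟩
        sum (λ j → b i * (ι (coord y j) * b j))     ≈⟨ sum-cong-≋ (λ j → solve 3 (λ x y z → x :* (y :* z) := y :* (x :* z)) refl (b i) (ι (coord y j)) (b j)) ⟩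
        sum (λ j → ι (coord y j) * (b i * b j))     ∎
      xy : x * y ≈ sum (λ i → ι (coord x i) * (b i * y))
      xy = begin
        x * y                                       ≈⟨ *-congʳ (expand x) ⟩
        combination (coord x) * y                   ≈⟨ *-distribʳ-sum y (λ i → ι (coord x i) * b i) ⟩
        sum (λ i → ι (coord x i) * b i * y)         ≈⟨ sum-cong-≋ (λ i → *-assoc (ι (coord x i)) (b i) y) ⟩
        sum (λ i → ι (coord x i) * (b i * y))       ∎

  -- The shift by d makes the filtration multiplicative.
  record Λ (m : ℤ) (x : Carrier) : Set where
    constructor mkΛ
    field
      lattice : Lattice (m ℤ.- d) x

  open Λ public

  Λ-cong : ∀ {m x y} → x ≈ y → Λ m x → Λ m y
  Λ-cong e p = mkΛ (Lattice-cong e (lattice p))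

  Λ-mono : ∀ {m k x} → m ℤ.≤ k → Λ k x → Λ m x
  Λ-mono m≤k p = mkΛ (Lattice-mono (ℤₚ.+-monoˡ-≤ (ℤ.- d) m≤k) (lattice p))

  Λ-0 : ∀ {m} → Λ m 0#
  Λ-0 = mkΛ Lattice-0

  Λ-+ : ∀ {m x y} → Λ m x → Λ m y → Λ m (x + y)
  Λ-+ p q = mkΛ (Lattice-+ (lattice p) (lattice q))

  Λ-neg : ∀ {m x} → Λ m x → Λ m (- x)
  Λ-neg p = mkΛ λ i → above-cong (K.sym (coord-neg _ i)) (above-neg (lattice p i))

  Λ-minus : ∀ {m x y} → Λ m x → Λ m y → Λ m (x - y)
  Λ-minus p q = Λ-+ p (Λ-neg q)

  Λ-* : ∀ {m k x y} → Λ m x → Λ k y → Λ (m ℤ.+ k) (x * y)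
  Λ-* {m} {k} {x} {y} p q = mkΛ (≡.subst (λ z → Lattice z (x * y))
    (+-*-Solver.solve 3 (λ m k d → (m :-ℤ d) :+ℤ ((k :-ℤ d) :+ℤ d) :=ℤ (m :+ℤ k) :-ℤ d) ≡.refl m k d)
    (Lattice-* (lattice p) (lattice q)))

  Λ-scale : ∀ {m k a x} → Above m a → Λ k x → Λ (m ℤ.+ k) (ι a * x)
  Λ-scale {m} {k} {a} {x} p q = mkΛ (≡.subst (λ z → Lattice z (ι a * x)) (≡.sym (ℤₚ.+-assoc m k (ℤ.- d))) (Lattice-scale p (lattice q)))

  Λ-exhaust : ∀ x → ∃ λ m → Λ m x
  Λ-exhaust x with m , p ← Lattice-exhaust x = m ℤ.+ d , mkΛ (≡.subst (λ z → Lattice z x)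
    (+-*-Solver.solve 2 (λ m d → m :=ℤ (m :+ℤ d) :-ℤ d) ≡.refl m d) p)

  Λ-separated : ∀ x → (∀ m → Λ m x) → x ≈ 0#
  Λ-separated x h = trans (expand x) (trans
    (sum-cong-≋ (λ i → trans (*-congʳ (trans (ι.⟦⟧-cong (coord≈0 i)) ι.0#-homo)) (trans (zeroˡ (b i)) (sym (zeroˡ (b i))))))
    (trans (sym (*-distribˡ-sum 0# b)) (zeroˡ _)))
    where
    coord≈0 : ∀ i → coord x i K.≈ K.0#
    coord≈0 i = above-all⇒≈0 _ λ m → ≡.subst (λ z → Above z (coord x i))
      (+-*-Solver.solve 2 (λ m d → (m :+ℤ d) :-ℤ d :=ℤ m) ≡.refl m d) (lattice (h (m ℤ.+ d)) i)

  Λ-limit : ∀ (s : ℕ → Carrier) R → (∀ k → Λ (R ℤ.+ ℤ.+ k) (s (suc k) - s k)) →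
            ∃ λ x → ∀ k → Λ (R ℤ.+ ℤ.+ k) (x - s k)
  Λ-limit s R h = combination (λ i → proj₁ (lim i)) , λ k → mkΛ λ i → above-cong
    (K.sym (K.trans (coord-+ _ _ i) (K.+-cong (coord-unique _ refl i) (coord-neg (s k) i))))
    (≡.subst (λ z → Above z (proj₁ (lim i) K.- coord (s k) i)) (reorder k) (proj₂ (lim i) k))
    where
    reorder : ∀ k → (R ℤ.- d) ℤ.+ ℤ.+ k ≡ (R ℤ.+ ℤ.+ k) ℤ.- d
    reorder k = +-*-Solver.solve 3 (λ R k d → (R :-ℤ d) :+ℤ k :=ℤ (R :+ℤ k) :-ℤ d) ≡.refl R (ℤ.+ k) d
    lim : ∀ i → ∃ λ x → ∀ k → Above ((R ℤ.- d) ℤ.+ ℤ.+ k) (x K.- coord (s k) i)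
    lim i = limit (λ k → coord (s k) i) (R ℤ.- d) λ k →
      above-cong (K.trans (coord-+ _ _ i) (K.+-congˡ (coord-neg (s k) i)))
      (≡.subst (λ z → Above z (coord (s (suc k) - s k) i)) (≡.sym (reorder k)) (lattice (h k) i))

  -- Coordinates of elements of `Λ C` have valuation at least C - d, so multiplying by `s` brings
  -- them into 𝒪, where ∣r - C∣ digits are recorded. Dividing by `s` again leaves a difference of
  -- valuation at least C - d + ∣r - C∣ ≥ r - d.
  Λ-code : ∀ C r → ∃ λ m → Σ[ code ∈ (∀ x → Λ C x → Fin m) ]
           (∀ x y p p′ → code x p ≡ code y p′ → Λ r (x - y))
  Λ-code C r with s , s⁻¹ , ss⁻¹≈1 , vs , vs⁻¹ ← scale (ℤ.- (C ℤ.- d)) | m , cd , close ← code ℤ.∣ r ℤ.- C ∣ =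
    m ℕ.^ n , (λ x p → funToFin (digit x p)) , λ x y p p′ e → mkΛ λ i →
      above-cong (difference (coord x i) (coord y i) (coord (x - y) i) (K.trans (coord-+ _ _ i) (K.+-congˡ (coord-neg y i))))
      (above-mono (enough) (above-* (above-≡ vs⁻¹) (close _ _
        (≡.trans (≡.sym (Finₚ.finToFun-funToFin (digit x p) i))
          (≡.trans (≡.cong (λ f → finToFun f i) e) (Finₚ.finToFun-funToFin (digit y p′) i))))))
    where
    digit : ∀ x → Λ C x → Fin n → Fin m
    digit x p i = cd (s K.* coord x i , ≡.subst (λ z → Above z (s K.* coord x i)) (ℤₚ.+-inverseˡ (C ℤ.- d)) (above-* (above-≡ vs) (lattice p i)))
    enough : r ℤ.- d ℤ.≤ (ℤ.- (ℤ.- (C ℤ.- d))) ℤ.+ ℤ.+ ℤ.∣ r ℤ.- C ∣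
    enough = ≡.subst (ℤ._≤ (ℤ.- (ℤ.- (C ℤ.- d))) ℤ.+ ℤ.+ ℤ.∣ r ℤ.- C ∣)
      (+-*-Solver.solve 3 (λ r C d → (:-ℤ (:-ℤ (C :-ℤ d))) :+ℤ (r :-ℤ C) :=ℤ r :-ℤ d) ≡.refl r C d)
      (ℤₚ.+-monoʳ-≤ (ℤ.- (ℤ.- (C ℤ.- d))) (i≤∣i∣ (r ℤ.- C)))
    difference : ∀ x y z → z K.≈ x K.- y → s⁻¹ K.* (s K.* x K.- s K.* y) K.≈ z
    difference x y z e = K.trans (K.solve 4 (λ s s′ x y → s′ K.:* (s K.:* x K.:- s K.:* y) K.:= (s K.:* s′) K.:* (x K.:- y)) K.refl s s⁻¹ x y)
      (K.trans (K.*-congʳ ss⁻¹≈1) (K.trans (K.*-identityˡ _) (K.sym e)))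

  -- The basis is arbitrary, so τ need not preserve the lattices. Being K-linear, it shifts them by
  -- no more than the images of the basis vectors require.
  Λ-automorphism : ∀ (τ : Automorphism E) → ∃ λ t → ∀ m x → Λ m x → Λ (m ℤ.+ t) (⟦ τ ⟧ x)
  Λ-automorphism τ with t , bounds ← common-lower-bound (λ i m → Lattice m (⟦ τ ⟧ (b i))) (λ i → Lattice-mono) (λ i → Lattice-exhaust (⟦ τ ⟧ (b i))) =
    t , λ m x p → mkΛ (≡.subst (λ z → Lattice z (⟦ τ ⟧ x))
      (+-*-Solver.solve 3 (λ m t d → (m :-ℤ d) :+ℤ t :=ℤ (m :+ℤ t) :-ℤ d) ≡.refl m t d)
      (Lattice-cong (sym (τx x)) (Lattice-linear _ (lattice p) bounds)))
    where
    module τ = Automorphism τ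
    module τKit = RingHomomorphismKit (Field.commutativeRing top) (Field.commutativeRing top) ⟦ τ ⟧ τ.isRingHomomorphism
    τx : ∀ x → ⟦ τ ⟧ x ≈ sum (λ i → ι (coord x i) * ⟦ τ ⟧ (b i))
    τx x = trans (τ.⟦⟧-cong (expand x)) (trans (τKit.sum-homo (λ i → ι (coord x i) * b i))
      (sum-cong-≋ λ i → trans (τ.*-homo (ι (coord x i)) (b i)) (*-congʳ (τ.fixes (coord x i)))))

  -- Some coordinate of 1 is nonzero, and the same coordinate of `ι k` is k times it. Dividing by it
  -- recovers k at the cost of a fixed shift.
  ι-Λ : ∃ λ t → ∀ m k → Λ m (ι k) → Above (m ℤ.+ t) k
  ι-Λ with j , a≉0 ← Finₚ.¬∀⟶∃¬ n (λ i → coord 1# i K.≈ K.0#) (λ i → ≈0?ᴷ (coord 1# i)) (λ h → 1≉0 (Λ-separated 1# λ m → mkΛ λ i → above-cong (K.sym (h i)) above-0))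
    with i , va ← finite-valuation (coord 1# j) a≉0 | u , au≈1 ← Field.inverse K (coord 1# j) a≉0 =
    ℤ.- d ℤ.+ ℤ.- i , λ m k p → above-cong
      (K.trans (K.*-congʳ (K.trans (coord-cong (sym (*-identityʳ (ι k))) j) (coord-scale k 1# j)))
        (K.trans (K.*-assoc k _ u) (K.trans (K.*-congˡ au≈1) (K.*-identityʳ k))))
      (≡.subst (λ z → Above z (coord (ι k) j K.* u)) (ℤₚ.+-assoc m (ℤ.- d) (ℤ.- i)) (above-* (lattice p j) (above-≡ (v-inverse au≈1 va))))

-- The valuation ring of L

module PowerBoundedElements {c ℓ c′ ℓ′} (𝕂 : LocalField c ℓ)
  (𝕃 : FiniteGaloisExtension (LocalField.baseField 𝕂) c′ ℓ′)
  {N : ℕ} (galCard : HasCardinality (Group.setoid (Gal (FiniteGaloisExtension.extension 𝕃))) N) where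

  open LocalField 𝕂 using (v; isDiscreteValuation; isComplete; residueFinite) renaming (baseField to K)
  open FiniteGaloisExtension 𝕃 using (isFinite; isGalois) renaming (extension to E)
  open FieldExtension E using (top; ι)
  open Field top using (1≉0; inverse)
  private
    module K = RingKit (Field.commutativeRing K)
    module ι = IsRingHomomorphism (FieldExtension.isRingHomomorphism E)
    module G = Group (Gal E)
  open RingKit (Field.commutativeRing top)
  open Valuation K v isDiscreteValuation
    using (Above; above-cong; above-mono; above-1; above-neg; above-*; above-≡; above-^; v-inverse;
           v≡0; v≡0⇒¬above-1; near-1⇒v≡0; powers-above)
    renaming (_≟_ to _≟ᴷ_)
  open IsDiscreteValuation isDiscreteValuation using (v-∞)
  open Filtration v isDiscreteValuation isComplete (proj₂ residueFinite) E (proj₁ (proj₂ isFinite)) (proj₂ (proj₂ isFinite)) public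
  open GaloisNorm E isGalois galCard
  open FieldHomomorphism K _≟ᴷ_ (Field.commutativeRing top) 1≉0 ι (FieldExtension.isRingHomomorphism E)
    renaming (j-injective to ι-injective) public
  open Automorphism using (⟦_⟧)
  open Inverse galCard using (to; from)
  open SetoidReasoning setoid

  noZeroDivisors : NoZeroDivisors (Field.commutativeRing top)
  noZeroDivisors = field-noZeroDivisors top ≈0?

  Norm-cong : ∀ {x y} → x ≈ y → Norm x K.≈ Norm y
  Norm-cong {x} {y} e = ι-injective (trans (ι-Norm x) (trans (∏-cong (λ i → Automorphism.⟦⟧-cong (from i) e)) (sym (ι-Norm y))))

  Norm-* : ∀ x y → Norm (x * y) K.≈ Norm x K.* Norm y
  Norm-* x y = ι-injective (begin
    ι (Norm (x * y))                          ≈⟨ ι-Norm (x * y) ⟩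
    ∏ (λ i → σ i (x * y))                     ≈⟨ ∏-cong (λ i → Automorphism.*-homo (from i) x y) ⟩
    ∏ (λ i → σ i x * σ i y)                   ≈⟨ ∏-distrib-* (λ i → σ i x) (λ i → σ i y) ⟩
    ∏ (λ i → σ i x) * ∏ (λ i → σ i y)         ≈⟨ sym (*-cong (ι-Norm x) (ι-Norm y)) ⟩
    ι (Norm x) * ι (Norm y)                   ≈⟨ sym (ι.*-homo _ _) ⟩
    ι (Norm x K.* Norm y)                     ∎)

  Norm-1 : Norm 1# K.≈ K.1#
  Norm-1 = ι-injective (trans (ι-Norm 1#) (trans (∏-ones _ (λ i → Automorphism.1#-homo (from i))) (sym ι.1#-homo)))

  Norm-^ : ∀ x m → Norm (x ^ m) K.≈ Norm x K.^ m
  Norm-^ x zero    = Norm-1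
  Norm-^ x (suc m) = K.trans (Norm-* x (x ^ m)) (K.*-congˡ (Norm-^ x m))

  -- A topological form of integrality over 𝒪. It presupposes no valuation on L, and enlarging the
  -- bound is harmless, so estimates may be wasteful.
  PowerBounded : Carrier → Set
  PowerBounded x = ∃ λ C → ∀ m → Λ C (x ^ m)

  pb-cong : ∀ {x y} → x ≈ y → PowerBounded x → PowerBounded y
  pb-cong e (C , p) = C , λ m → Λ-cong (^-congˡ m e) (p m)

  pb-* : ∀ {x y} → PowerBounded x → PowerBounded y → PowerBounded (x * y)
  pb-* {x} {y} (C , p) (D , q) = C ℤ.+ D , λ m → Λ-cong (sym (^-distrib-* x y m)) (Λ-* (p m) (q m))

  ι-^ : ∀ k m → ι (k K.^ m) ≈ ι k ^ m
  ι-^ = RingHomomorphismKit.^-homo (Field.commutativeRing K) (Field.commutativeRing top) ι (FieldExtension.isRingHomomorphism E)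

  pb-ι : ∀ {k} → Above 0ℤ k → PowerBounded (ι k)
  pb-ι {k} p with C , q ← Λ-exhaust 1# = 0ℤ ℤ.+ C , λ m →
    Λ-cong (trans (*-identityʳ _) (ι-^ k m)) (Λ-scale (above-^ p m) q)

  pb-1 : PowerBounded 1#
  pb-1 = pb-cong ι.1#-homo (pb-ι above-1)

  -- Expanding one factor x + y at a time raises the exponent of either x or y. Carrying x^i y^j
  -- along gives one bound for all terms without binomial coefficients.
  pb-+ : ∀ {x y} → PowerBounded x → PowerBounded y → PowerBounded (x + y)
  pb-+ {x} {y} (C , p) (D , q) = C ℤ.+ D , λ m →
    Λ-cong (trans (*-congʳ (*-identityˡ 1#)) (*-identityˡ _)) (bound m 0 0)
    where
    bound : ∀ m i j → Λ (C ℤ.+ D) ((x ^ i * y ^ j) * (x + y) ^ m)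
    bound zero    i j = Λ-cong (sym (*-identityʳ _)) (Λ-* (p i) (q j))
    bound (suc m) i j = Λ-cong
      (solve 5 (λ x y X Y Z → (x :* X :* Y) :* Z :+ (X :* (y :* Y)) :* Z := (X :* Y) :* ((x :+ y) :* Z)) refl x y (x ^ i) (y ^ j) ((x + y) ^ m))
      (Λ-+ (bound m (suc i) j) (bound m i (suc j)))

  pb-neg : ∀ {x} → PowerBounded x → PowerBounded (- x)
  pb-neg {x} p = pb-cong (trans (*-congʳ (trans (ι.-‿homo _) (-‿cong ι.1#-homo))) (-1*x≈-x x)) (pb-* (pb-ι (above-neg above-1)) p)

  pb-minus : ∀ {x y} → PowerBounded x → PowerBounded y → PowerBounded (x - y)
  pb-minus p q = pb-+ p (pb-neg q)

  pb-^ : ∀ {x} → PowerBounded x → ∀ m → PowerBounded (x ^ m)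
  pb-^ p zero    = pb-1
  pb-^ p (suc m) = pb-* p (pb-^ p m)

  pb-∏ : ∀ {n} (t : Fin n → Carrier) → (∀ i → PowerBounded (t i)) → PowerBounded (∏ t)
  pb-∏ {zero}  t p = pb-1
  pb-∏ {suc n} t p = pb-* (p zero) (pb-∏ (t ∘ suc) (p ∘ suc))

  pb-automorphism : ∀ τ {x} → PowerBounded x → PowerBounded (⟦ τ ⟧ x)
  pb-automorphism τ {x} (C , p) with t , bound ← Λ-automorphism τ = C ℤ.+ t , λ m →
    Λ-cong (AutKit.^-homo τ x m) (bound C (x ^ m) (p m))

  ∏-bounded : ∀ {n} (t : ℕ → Fin n → Carrier) → (∀ i → ∃ λ C → ∀ m → Λ C (t m i)) → ∃ λ C → ∀ m → Λ C (∏ (t m))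
  ∏-bounded {zero}  t b = let C , q = Λ-exhaust 1# in C , λ _ → q
  ∏-bounded {suc n} t b = let C , q = b zero; D , r = ∏-bounded (λ m i → t m (suc i)) (b ∘ suc) in
    C ℤ.+ D , λ m → Λ-* (q m) (r m)

  -- The norms of the powers of x are products of conjugates from fixed lattices, so the powers of
  -- `Norm x` are bounded below, which in K forces valuation at least 0.
  pb⇒above : ∀ {x} → PowerBounded x → Above 0ℤ (Norm x)
  pb⇒above {x} (C , p) = powers-above (D ℤ.+ t) λ m →
    above-cong (Norm-^ x m) (proj₂ ι-Λ D _ (Λ-cong (sym (ι-Norm (x ^ m))) (proj₂ bounded m)))
    where
    bounded : ∃ λ D → ∀ m → Λ D (∏ (λ i → σ i (x ^ m)))
    bounded = ∏-bounded (λ m i → σ i (x ^ m)) λ i →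
      let t , bound = Λ-automorphism (from i) in C ℤ.+ t , λ m → bound C (x ^ m) (p m)
    D = proj₁ bounded
    t = proj₁ ι-Λ

  ∏-others : ∀ {n} (t : Fin n → Carrier) i → (∀ j → PowerBounded (t j)) → ∃ λ r → PowerBounded r × ∏ t ≈ t i * r
  ∏-others {suc n} t i p = ∏ (removeAt t i) , pb-∏ (removeAt t i) (λ j → p _) , ∏-remove {i = i} t

  -- The inverse is the product of the other conjugates divided by the norm.
  pb-inverse : ∀ {x} → PowerBounded x → v (Norm x) ≡ [ 0ℤ ] → ∃ λ y → x * y ≈ 1# × PowerBounded y
  pb-inverse {x} p vN = r * ι u , (begin
    x * (r * ι u)             ≈⟨ sym (*-assoc _ _ _) ⟩
    x * r * ι u               ≈⟨ *-congʳ (*-congʳ (sym (index-correct G.ε x))) ⟩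
    σ (to G.ε) x * r * ι u    ≈⟨ *-congʳ (sym (proj₂ (proj₂ rest))) ⟩
    ∏ (λ i → σ i x) * ι u     ≈⟨ *-congʳ (sym (ι-Norm x)) ⟩
    ι (Norm x) * ι u          ≈⟨ sym (ι.*-homo _ _) ⟩
    ι (Norm x K.* u)          ≈⟨ ι.⟦⟧-cong (proj₂ norm-inverse) ⟩
    ι K.1#                    ≈⟨ ι.1#-homo ⟩
    1#                        ∎) , pb-* (proj₁ (proj₂ rest)) (pb-ι (above-≡ (v-inverse (proj₂ norm-inverse) vN)))
    where
    norm-inverse = Field.inverse K (Norm x) (λ N≈0 → [i]≢⊤⁺ (≡.trans (≡.sym vN) (Equivalence.from (v-∞ _) N≈0)))
    u = proj₁ norm-inverse
    rest = ∏-others (λ i → σ i x) (to G.ε) (λ i → pb-automorphism (from i) p)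
    r = proj₁ rest

  unit-factor : ∀ {x y} → PowerBounded x → PowerBounded y → v (Norm (x * y)) ≡ [ 0ℤ ] → v (Norm x) ≡ [ 0ℤ ]
  unit-factor {x} {y} p q e = v≡0 (pb⇒above p) λ a →
    v≡0⇒¬above-1 e (above-cong (K.sym (Norm-* x y)) (above-* {1ℤ} {0ℤ} a (pb⇒above q)))

  ∏-near-1 : ∀ {D} → 0ℤ ℤ.≤ D → ∀ {n} (t : Fin n → Carrier) → (∀ i → Λ D (t i)) → Λ D (1# - ∏ (λ i → 1# - t i))
  ∏-near-1 0≤D {zero}  t h = Λ-cong (sym (-‿inverseʳ 1#)) Λ-0
  ∏-near-1 {D} 0≤D {suc n} t h = Λ-cong
    (solve 2 (λ a p → ((:1 :- p) :+ a) :- a :* (:1 :- p) := :1 :- (:1 :- a) :* p) refl (t zero) (∏ (λ i → 1# - t (suc i))))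
    (Λ-minus (Λ-+ ih (h zero)) (Λ-mono (ℤₚ.≤-trans (ℤₚ.≤-reflexive (≡.sym (ℤₚ.+-identityˡ D))) (ℤₚ.+-monoˡ-≤ D 0≤D)) (Λ-* (h zero) ih)))
    where
    ih = ∏-near-1 0≤D (t ∘ suc) (h ∘ suc)

  Norm-near-1 : ∃ λ R → ∀ u → Λ R u → v (Norm (1# - u)) ≡ [ 0ℤ ]
  Norm-near-1 = R , λ u p → near-1⇒v≡0 _
    (above-mono 1≤D+e (above D _ (Λ-cong (sym (close u))
      (∏-near-1 (ℤₚ.i≤i⊔j 0ℤ (1ℤ ℤ.- e)) (λ i → σ i u) λ i → ≡.subst (λ z → Λ z (σ i u)) R+t (bound i R u p)))))
    where
    uniform : ∃ λ t → ∀ i m x → Λ m x → Λ (m ℤ.+ t) (σ i x)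
    uniform = common-lower-bound (λ i t → ∀ m x → Λ m x → Λ (m ℤ.+ t) (σ i x))
      (λ i a≤b h m x p → Λ-mono (ℤₚ.+-monoʳ-≤ m a≤b) (h m x p)) (λ i → Λ-automorphism (from i))
    t = proj₁ uniform
    bound = proj₂ uniform
    e = proj₁ ι-Λ
    above = proj₂ ι-Λ
    -- `D` ≥ 0 keeps products of the factors 1 - σu within `Λ D` of 1; `D` ≥ 1 - e makes the
    -- resulting element of K have valuation at least 1 after the loss e of `ι-Λ`. `R` compensates
    -- the loss t of the automorphisms.
    D R : ℤ
    D = 0ℤ ℤ.⊔ (1ℤ ℤ.- e)
    R = D ℤ.- t
    R+t : R ℤ.+ t ≡ D
    R+t = +-*-Solver.solve 2 (λ d t → (d :-ℤ t) :+ℤ t :=ℤ d) ≡.refl D t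
    1≤D+e : 1ℤ ℤ.≤ D ℤ.+ e
    1≤D+e = ≡.subst (ℤ._≤ D ℤ.+ e) (+-*-Solver.solve 1 (λ e → (+-*-Solver.con 1ℤ :-ℤ e) :+ℤ e :=ℤ +-*-Solver.con 1ℤ) ≡.refl e)
      (ℤₚ.+-monoˡ-≤ e (ℤₚ.i≤j⊔i 0ℤ (1ℤ ℤ.- e)))
    close : ∀ u → ι (K.1# K.- Norm (1# - u)) ≈ 1# - ∏ (λ i → 1# - σ i u)
    close u = begin
      ι (K.1# K.- Norm (1# - u))          ≈⟨ trans (ι.+-homo _ _) (+-cong ι.1#-homo (ι.-‿homo _)) ⟩
      1# - ι (Norm (1# - u))              ≈⟨ +-congˡ (-‿cong (ι-Norm _)) ⟩
      1# - ∏ (λ i → σ i (1# - u))         ≈⟨ +-congˡ (-‿cong (∏-cong λ i → trans (AutKit.minus-homo (from i) 1# u) (+-congʳ (Automorphism.1#-homo (from i))))) ⟩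
      1# - ∏ (λ i → 1# - σ i u)           ∎

  -- By the pigeonhole principle the powers of w are eventually periodic
  -- modulo Λ R, so that some of them are idempotent modulo Λ R.
  approximately-idempotent : ∀ {w} C → (∀ m → Λ C (w ^ m)) → ∀ R → ∃ λ a → Λ R (w ^ suc a * w ^ suc a - w ^ suc a)
  approximately-idempotent {w} C p R = ℕ.pred a ,
    ≡.subst (λ a → Λ R (w ^ a * w ^ a - w ^ a)) (≡.sym (ℕₚ.suc-pred a {{ℕ.>-nonZero 0<a}}))
      (Λ-cong (trans (solve 2 (λ x y → :- (x :- y) := y :- x) refl _ _) (+-congʳ (^-homo-* w a a))) (Λ-neg (periodic a (suc i) i≤a)))
    where
    -- The precision R - C is chosen since the collision is later multiplied by a power of w, which
    -- lies in `Λ C`.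
    coding : ∃ λ m → Σ[ code ∈ (∀ x → Λ C x → Fin m) ]
             (∀ x y p p′ → code x p ≡ code y p′ → Λ (R ℤ.- C) (x - y))
    coding = Λ-code C (R ℤ.- C)
    collision : ∃ λ i → ∃ λ j → i ℕ.< j × Λ (R ℤ.- C) (w ^ i - w ^ j)
    collision = let i , j , i<j , e = Finₚ.pigeonhole (ℕₚ.n<1+n (proj₁ coding)) (λ k → proj₁ (proj₂ coding) (w ^ toℕ k) (p (toℕ k)))
      in toℕ i , toℕ j , i<j , proj₂ (proj₂ coding) _ _ _ _ e
    i = proj₁ collision
    j = proj₁ (proj₂ collision)
    i<j : i ℕ.< j
    i<j = proj₁ (proj₂ (proj₂ collision))
    T = j ℕ.∸ i
    -- A positive multiple of the period T lying beyond the preperiod i; adding a once more gives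
    -- 2a, so w^a and its square agree modulo `Λ R`.
    a = suc i ℕ.* T
    0<T : 0 ℕ.< T
    0<T = ℕₚ.m<n⇒0<n∸m i<j
    i≤a : i ℕ.≤ a
    i≤a = ℕₚ.≤-trans (ℕₚ.n≤1+n i) (ℕₚ.m≤m*n (suc i) T {{ℕ.>-nonZero 0<T}})
    0<a : 0 ℕ.< a
    0<a = ℕₚ.≤-trans 0<T (ℕₚ.m≤m+n T _)
    step : ∀ s → i ℕ.≤ s → Λ R (w ^ s - w ^ (s ℕ.+ T))
    step s i≤s = Λ-cong (begin
      (w ^ i - w ^ j) * w ^ (s ℕ.∸ i)                       ≈⟨ solve 3 (λ x y z → (x :- y) :* z := x :* z :- y :* z) refl _ _ _ ⟩
      w ^ i * w ^ (s ℕ.∸ i) - w ^ j * w ^ (s ℕ.∸ i)         ≈⟨ sym (+-cong (^-homo-* w i _) (-‿cong (^-homo-* w j _))) ⟩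
      w ^ (i ℕ.+ (s ℕ.∸ i)) - w ^ (j ℕ.+ (s ℕ.∸ i))         ≡⟨ ≡.cong₂ (λ a b → w ^ a - w ^ b) (ℕₚ.m+[n∸m]≡n i≤s) j+s-i ⟩
      w ^ s - w ^ (s ℕ.+ T)                                 ∎)
      (≡.subst (λ z → Λ z ((w ^ i - w ^ j) * w ^ (s ℕ.∸ i))) (+-*-Solver.solve 2 (λ R C → (R :-ℤ C) :+ℤ C :=ℤ R) ≡.refl R C)
        (Λ-* (proj₂ (proj₂ (proj₂ collision))) (p (s ℕ.∸ i))))
      where
      j+s-i : j ℕ.+ (s ℕ.∸ i) ≡ s ℕ.+ T
      j+s-i = ≡.trans (≡.cong (ℕ._+ (s ℕ.∸ i)) (≡.sym (ℕₚ.m+[n∸m]≡n (ℕₚ.<⇒≤ i<j))))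
        (≡.trans (≡.cong (ℕ._+ (s ℕ.∸ i)) (ℕₚ.+-comm i T)) (≡.trans (ℕₚ.+-assoc T i _)
        (≡.trans (≡.cong (T ℕ.+_) (ℕₚ.m+[n∸m]≡n i≤s)) (ℕₚ.+-comm T s))))
    periodic : ∀ s t → i ℕ.≤ s → Λ R (w ^ s - w ^ (s ℕ.+ t ℕ.* T))
    periodic s zero i≤s = Λ-cong (sym (x≈y⇒x-y≈0 (^-congʳ w (≡.sym (ℕₚ.+-identityʳ s))))) Λ-0
    periodic s (suc t) i≤s = Λ-cong
      (trans (solve 3 (λ x y z → (x :- y) :+ (y :- z) := x :- z) refl _ _ _)
        (+-congˡ (-‿cong (^-congʳ w (ℕₚ.+-assoc s T (t ℕ.* T))))))
      (Λ-+ (step s i≤s) (periodic (s ℕ.+ T) t (ℕₚ.≤-trans i≤s (ℕₚ.m≤m+n s T))))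

  -- This is ℤ[w]. All its elements lie in the one lattice `Λ C` that contains the powers of w,
  -- whereas general products would lower the bound each time. This keeps Newton's iteration under
  -- control.
  data Generated (w : Carrier) : Carrier → Set (c′ Level.⊔ ℓ′) where
    power : ∀ m → Generated w (w ^ m)
    plus  : ∀ {x y} → Generated w x → Generated w y → Generated w (x + y)
    minus : ∀ {x y} → Generated w x → Generated w y → Generated w (x - y)
    resp  : ∀ {x y} → x ≈ y → Generated w x → Generated w y

  generated-bounded : ∀ {w C} → (∀ m → Λ C (w ^ m)) → ∀ {x} → Generated w x → Λ C x
  generated-bounded p (power m)   = p m
  generated-bounded p (plus s t)  = Λ-+ (generated-bounded p s) (generated-bounded p t)
  generated-bounded p (minus s t) = Λ-minus (generated-bounded p s) (generated-bounded p t)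
  generated-bounded p (resp e s)  = Λ-cong e (generated-bounded p s)

  generated-* : ∀ {w x y} → Generated w x → Generated w y → Generated w (x * y)
  generated-* (plus s t) u = resp (sym (distribʳ _ _ _)) (plus (generated-* s u) (generated-* t u))
  generated-* (minus s t) u = resp (solve 3 (λ x y z → x :* z :- y :* z := (x :- y) :* z) refl _ _ _) (minus (generated-* s u) (generated-* t u))
  generated-* (resp e s) u = resp (*-congʳ e) (generated-* s u)
  generated-* s@(power m) (power k) = resp (^-homo-* _ m k) (power (m ℕ.+ k))
  generated-* s@(power m) (plus t u) = resp (sym (distribˡ _ _ _)) (plus (generated-* s t) (generated-* s u))
  generated-* s@(power m) (minus t u) = resp (solve 3 (λ x y z → z :* x :- z :* y := z :* (x :- y)) refl _ _ _) (minus (generated-* s t) (generated-* s u))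
  generated-* s@(power m) (resp e t) = resp (*-congˡ e) (generated-* s t)

module MinimalCoefficient {c ℓ} (K : Field c ℓ) (v : Field.Carrier K → ℤ ⁺) (isDV : IsDiscreteValuation K v) where
  open RingKit (Field.commutativeRing K)
  open Valuation K v isDV

  above-or-below : ∀ i x → Above i x ⊎ ∃ λ j → v x ≡ [ j ] × j ℤ.≤ i
  above-or-below i x with v x in e
  ... | ⊤⁺    = inj₁ (_ ≤⊤⁺)
  ... | [ j ] with ℤₚ.≤-total i j
  ...   | inj₁ i≤j = inj₁ [ i≤j ]
  ...   | inj₂ j≤i = inj₂ (j , ≡.refl , j≤i)

  -- Dividing by a coefficient of least valuation turns an equation into a primitive one: all
  -- coefficients integral and one of them equal to 1.
  minimal : ∀ cs → All (_≈ 0#) cs ⊎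
            ∃ λ pre → ∃ λ x → ∃ λ suf → ∃ λ i → cs ≡ pre ++ x ∷ suf × v x ≡ [ i ] × All (Above i) cs
  minimal [] = inj₁ []
  minimal (x ∷ xs) with minimal xs | ≈0? x
  ... | inj₁ xs≈0 | yes x≈0 = inj₁ (x≈0 ∷ xs≈0)
  ... | inj₁ xs≈0 | no x≉0 with i , vx ← finite-valuation x x≉0 =
    inj₂ ([] , x , xs , i , ≡.refl , vx , above-≡ vx ∷ All.map (λ y≈0 → above-cong (sym y≈0) above-0) xs≈0)
  ... | inj₂ (pre , y , suf , i , e , vy , above) | _ with above-or-below i x
  ...   | inj₁ p = inj₂ (x ∷ pre , y , suf , i , ≡.cong (x ∷_) e , vy , p ∷ above)
  ...   | inj₂ (j , vx , j≤i) = inj₂ ([] , x , xs , j , ≡.refl , vx , above-≡ vx ∷ All.map (above-mono j≤i) above)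

module ValuationRing {c ℓ c′ ℓ′} (𝕂 : LocalField c ℓ)
  (𝕃 : FiniteGaloisExtension (LocalField.baseField 𝕂) c′ ℓ′)
  {N : ℕ} (galCard : HasCardinality (Group.setoid (Gal (FiniteGaloisExtension.extension 𝕃))) N) where

  open LocalField 𝕂 using (v; isDiscreteValuation) renaming (baseField to K)
  open FiniteGaloisExtension 𝕃 using (isGalois) renaming (extension to E)
  open FieldExtension E using (top; ι)
  private
    module K = RingKit (Field.commutativeRing K)
    module ι = IsRingHomomorphism (FieldExtension.isRingHomomorphism E)
    module G = Group (Gal E)
  open RingKit (Field.commutativeRing top)
  open Polynomials (Field.commutativeRing top)
  open Valuation K v isDiscreteValuation
    using (Above; above-cong; above-0; above-1; ¬above-1-1; above-neg; above-*; above-≡; v-inverse; v≡0)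
  open MinimalCoefficient K v isDiscreteValuation
  open IsDiscreteValuation isDiscreteValuation using (v-cong)
  open GaloisNorm E isGalois galCard
  open PowerBoundedElements 𝕂 𝕃 galCard
  open Inverse galCard using (to)
  open SetoidReasoning setoid

  -- Newton's iteration e ↦ e + (1 - 2e)(e² - e) for the equation e² = e.
  module Newton {w} (C R : ℤ) (p : ∀ m → Λ C (w ^ m)) (C≤0 : C ℤ.≤ 0ℤ) (1≤C+R : 1ℤ ℤ.≤ C ℤ.+ R)
                (e₀ : Carrier) (generated₀ : Generated w e₀) (close₀ : Λ R (e₀ * e₀ - e₀)) where
    defect next : Carrier → Carrier
    defect e = e * e - e
    next e = e + (1# - (e + e)) * defect e

    e : ℕ → Carrier
    e zero    = e₀
    e (suc k) = next (e k)

    generated-defect : ∀ {e} → Generated w e → Generated w (defect e)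
    generated-defect g = minus (generated-* g g) g

    generated : ∀ k → Generated w (e k)
    generated zero    = generated₀
    generated (suc k) = plus (generated k) (generated-* (minus (power 0) (plus (generated k) (generated k))) (generated-defect (generated k)))

    -- With d = e² - e one has (1 - 2e)² = 1 + 4d, whence the new defect is d²(4d - 3). The second
    -- factor stays in ℤ[w], so convergence is quadratic up to the constant C.
    defect-next : ∀ e → defect (next e) ≈ (defect e * defect e) * (((defect e + defect e) + (defect e + defect e)) - (1# + 1# + 1#))
    defect-next = solve 1 (λ e → let d = e :* e :- e; e′ = e :+ (:1 :- (e :+ e)) :* d in
      e′ :* e′ :- e′ := (d :* d) :* (((d :+ d) :+ (d :+ d)) :- (:1 :+ :1 :+ :1))) refl

    1≤C+R+k : ∀ k → 1ℤ ℤ.≤ (C ℤ.+ R) ℤ.+ ℤ.+ k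
    1≤C+R+k k = ℤₚ.≤-trans 1≤C+R (ℤₚ.i≤i+j (C ℤ.+ R) (ℤ.+ k))

    close : ∀ k → Λ (R ℤ.+ ℤ.+ k) (defect (e k))
    close zero    = ≡.subst (λ z → Λ z (defect e₀)) (≡.sym (ℤₚ.+-identityʳ R)) close₀
    close (suc k) = Λ-cong (sym (defect-next (e k))) (Λ-mono bound (Λ-* (Λ-* (close k) (close k))
      (generated-bounded p (minus (plus (plus g g) (plus g g)) (plus (plus (power 0) (power 0)) (power 0))))))
      where
      g = generated-defect (generated k)
      -- The squared defect reaches 2(R + k) + C, and C + R ≥ 1 leaves a gain of at least one per
      -- step; this linear rate suffices.
      bound : R ℤ.+ ℤ.+ suc k ℤ.≤ ((R ℤ.+ ℤ.+ k) ℤ.+ (R ℤ.+ ℤ.+ k)) ℤ.+ C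
      bound = ≡.subst₂ ℤ._≤_
        (+-*-Solver.solve 2 (λ R k → (R :+ℤ k) :+ℤ +-*-Solver.con 1ℤ :=ℤ R :+ℤ (+-*-Solver.con 1ℤ :+ℤ k)) ≡.refl R (ℤ.+ k))
        (+-*-Solver.solve 3 (λ C R k → (R :+ℤ k) :+ℤ ((C :+ℤ R) :+ℤ k) :=ℤ ((R :+ℤ k) :+ℤ (R :+ℤ k)) :+ℤ C) ≡.refl C R (ℤ.+ k))
        (ℤₚ.+-monoʳ-≤ (R ℤ.+ ℤ.+ k) (1≤C+R+k k))

    increment : ∀ k → Λ ((C ℤ.+ R) ℤ.+ ℤ.+ k) (e (suc k) - e k)
    increment k = Λ-cong (solve 2 (λ e d → d := (e :+ d) :- e) refl (e k) _)
      (≡.subst (λ z → Λ z ((1# - (e k + e k)) * defect (e k))) (≡.sym (ℤₚ.+-assoc C R (ℤ.+ k)))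
        (Λ-* (generated-bounded p (minus (power 0) (plus (generated k) (generated k)))) (close k)))

    limit : ∃ λ x → ∀ k → Λ ((C ℤ.+ R) ℤ.+ ℤ.+ k) (x - e k)
    limit = Λ-limit e (C ℤ.+ R) increment

    x = proj₁ limit

    x-idempotent : x * x ≈ x
    x-idempotent = x-y≈0⇒x≈y (Λ-separated _ λ m → let k = ℤ.∣ m ℤ.- C ∣ in
      Λ-mono (bound m) (Λ-cong (sym (split (e k))) (Λ-+ (Λ-+
        (Λ-mono (n≤n+n k) (Λ-* (proj₂ limit k) (proj₂ limit k)))
        (Λ-* (generated-bounded p (minus (plus (generated k) (generated k)) (power 0))) (proj₂ limit k)))
        (Λ-mono (R+k k) (close k)))))
      where
      split : ∀ e → x * x - x ≈ ((x - e) * (x - e) + ((e + e) - 1#) * (x - e)) + defect e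
      split = solve 2 (λ x e → x :* x :- x := ((x :- e) :* (x :- e) :+ ((e :+ e) :- :1) :* (x :- e)) :+ (e :* e :- e)) refl x
      n : ℕ → ℤ
      n k = (C ℤ.+ R) ℤ.+ ℤ.+ k
      C+i≤i : ∀ i → C ℤ.+ i ℤ.≤ i
      C+i≤i i = ≡.subst (C ℤ.+ i ℤ.≤_) (ℤₚ.+-identityˡ i) (ℤₚ.+-monoˡ-≤ i C≤0)
      n≤n+n : ∀ k → C ℤ.+ n k ℤ.≤ n k ℤ.+ n k
      n≤n+n k = ℤₚ.+-monoˡ-≤ (n k) (ℤₚ.≤-trans C≤0 (ℤₚ.≤-trans (ℤ.+≤+ ℕ.z≤n) (1≤C+R+k k)))
      R+k : ∀ k → C ℤ.+ n k ℤ.≤ R ℤ.+ ℤ.+ k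
      R+k k = ℤₚ.≤-trans (C+i≤i (n k)) (≡.subst (ℤ._≤ R ℤ.+ ℤ.+ k) (≡.sym (ℤₚ.+-assoc C R (ℤ.+ k))) (C+i≤i (R ℤ.+ ℤ.+ k)))
      bound : ∀ m → m ℤ.≤ C ℤ.+ n ℤ.∣ m ℤ.- C ∣
      bound m = ≡.subst (ℤ._≤ C ℤ.+ n ℤ.∣ m ℤ.- C ∣) (+-*-Solver.solve 2 (λ m C → C :+ℤ (m :-ℤ C) :=ℤ m) ≡.refl m C)
        (ℤₚ.+-monoʳ-≤ C (ℤₚ.≤-trans (i≤∣i∣ (m ℤ.- C))
          (≡.subst (ℤ._≤ n ℤ.∣ m ℤ.- C ∣) (ℤₚ.+-identityˡ _) (ℤₚ.+-monoˡ-≤ (ℤ.+ ℤ.∣ m ℤ.- C ∣) (ℤₚ.≤-trans (ℤ.+≤+ ℕ.z≤n) 1≤C+R)))))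

  geometric : ∀ {w} → PowerBounded w → ∀ n → ∃ λ g → PowerBounded g × (1# - w) * g ≈ 1# - w ^ n
  geometric {w} p zero = 0# , pb-cong ι.0#-homo (pb-ι above-0) , trans (zeroʳ _) (sym (-‿inverseʳ 1#))
  geometric {w} p (suc n) = let g , q , e = geometric p n in
    1# + w * g , pb-+ pb-1 (pb-* p q) , (begin
      (1# - w) * (1# + w * g)        ≈⟨ solve 2 (λ w g → (:1 :- w) :* (:1 :+ w :* g) := (:1 :- w) :+ w :* ((:1 :- w) :* g)) refl w g ⟩
      (1# - w) + w * ((1# - w) * g)  ≈⟨ +-congˡ (*-congˡ e) ⟩
      (1# - w) + w * (1# - w ^ n)    ≈⟨ solve 2 (λ w P → (:1 :- w) :+ w :* (:1 :- P) := :1 :- w :* P) refl w (w ^ n) ⟩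
      1# - w ^ suc n                 ∎)

  idempotent-in-field : ∀ {x} → x * x ≈ x → x ≈ 0# ⊎ x ≈ 1#
  idempotent-in-field {x} e with noZeroDivisors x (x - 1#)
    (trans (solve 1 (λ x → x :* (x :- :1) := x :* x :- x) refl x) (x≈y⇒x-y≈0 e))
  ... | inj₁ x≈0 = inj₁ x≈0
  ... | inj₂ p   = inj₂ (x-y≈0⇒x≈y p)

  -- The power bounded elements form a local ring: an approximately
  -- idempotent power of w converges to an idempotent of the field L.
  local : ∀ {w} → PowerBounded w → v (Norm w) ≡ [ 0ℤ ] ⊎ v (Norm (1# - w)) ≡ [ 0ℤ ]
  local {w} pw = [ zero-case , one-case ]′ (idempotent-in-field x-idempotent)
    where
    -- `C` is lowered to at most 0 as Newton's estimates require. `R` makes C + R the larger of R₀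
    -- and 1: at least 1 for convergence, at least R₀ so that the limit is near enough to the power
    -- of w for `Norm-near-1`.
    R₀ C R : ℤ
    R₀ = proj₁ Norm-near-1
    C = proj₁ pw ℤ.⊓ 0ℤ
    R = (R₀ ℤ.⊔ 1ℤ) ℤ.- C
    p : ∀ m → Λ C (w ^ m)
    p m = Λ-mono (ℤₚ.i⊓j≤i (proj₁ pw) 0ℤ) (proj₂ pw m)
    C+R : C ℤ.+ R ≡ R₀ ℤ.⊔ 1ℤ
    C+R = +-*-Solver.solve 2 (λ C M → C :+ℤ (M :-ℤ C) :=ℤ M) ≡.refl C (R₀ ℤ.⊔ 1ℤ)
    approximation : ∃ λ a → Λ R (w ^ suc a * w ^ suc a - w ^ suc a)
    approximation = approximately-idempotent C p R
    a = proj₁ approximation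
    open Newton C R p (ℤₚ.i⊓j≤j (proj₁ pw) 0ℤ) (≡.subst (1ℤ ℤ.≤_) (≡.sym C+R) (ℤₚ.i≤j⊔i R₀ 1ℤ))
      (w ^ suc a) (power (suc a)) (proj₂ approximation) using (x; x-idempotent; limit)
    x-close : Λ R₀ (x - w ^ suc a)
    x-close = Λ-mono (≡.subst (R₀ ℤ.≤_) (≡.sym (≡.trans (ℤₚ.+-identityʳ (C ℤ.+ R)) C+R)) (ℤₚ.i≤i⊔j R₀ 1ℤ)) (proj₂ limit 0)
    -- If the limit is 0, a power of w is close to 0, so 1 minus it has unit norm, and 1 - w divides
    -- it. If the limit is 1, the power of w itself has unit norm, and w divides it.
    zero-case : x ≈ 0# → v (Norm w) ≡ [ 0ℤ ] ⊎ v (Norm (1# - w)) ≡ [ 0ℤ ]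
    zero-case x≈0 = let g , pg , e = geometric pw (suc a) in
      inj₂ (unit-factor (pb-minus pb-1 pw) pg (≡.trans (v-cong (Norm-cong e))
        (proj₂ Norm-near-1 (w ^ suc a) (Λ-cong (solve 1 (λ y → :- (:- y) := y) refl _)
          (Λ-neg (Λ-cong (trans (+-congʳ x≈0) (+-identityˡ _)) x-close))))))
    one-case : x ≈ 1# → v (Norm w) ≡ [ 0ℤ ] ⊎ v (Norm (1# - w)) ≡ [ 0ℤ ]
    one-case x≈1 = inj₁ (unit-factor pw (pb-^ pw a) (≡.trans (v-cong (Norm-cong (solve 1 (λ y → y := :1 :- (:1 :- y)) refl _)))
      (proj₂ Norm-near-1 (1# - w ^ suc a) (Λ-cong (+-congʳ x≈1) x-close))))

  data Span (z : Carrier) (n : ℕ) : Carrier → Set (c Level.⊔ c′ Level.⊔ ℓ′) where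
    monomial : ∀ {i} → i ℕ.≤ n → Span z n (z ^ i)
    zero     : Span z n 0#
    plus     : ∀ {x y} → Span z n x → Span z n y → Span z n (x + y)
    scaled   : ∀ {k x} → Above 0ℤ k → Span z n x → Span z n (ι k * x)
    resp     : ∀ {x y} → x ≈ y → Span z n x → Span z n y

  span-bounded : ∀ z n → ∃ λ C → ∀ {x} → Span z n x → Λ C x
  span-bounded z n = C , bounded
    where
    monomials : ∃ λ C → ∀ (i : Fin (suc n)) → Λ C (z ^ toℕ i)
    monomials = common-lower-bound (λ i C → Λ C (z ^ toℕ i)) (λ i → Λ-mono) (λ i → Λ-exhaust (z ^ toℕ i))
    C = proj₁ monomials
    bounded : ∀ {x} → Span z n x → Λ C x
    bounded (monomial {i} i≤n) = ≡.subst (λ i → Λ C (z ^ i)) (Finₚ.toℕ-fromℕ< (ℕ.s≤s i≤n)) (proj₂ monomials (fromℕ< (ℕ.s≤s i≤n)))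
    bounded zero         = Λ-0
    bounded (plus s t)   = Λ-+ (bounded s) (bounded t)
    bounded (scaled {k} {x} a s) = ≡.subst (λ m → Λ m (ι k * x)) (ℤₚ.+-identityˡ C) (Λ-scale a (bounded s))
    bounded (resp e s)   = Λ-cong e (bounded s)

  span-stable : ∀ {z n} t → (∀ i → i ℕ.≤ n → Span z n (t * z ^ i)) → ∀ {x} → Span z n x → Span z n (t * x)
  span-stable t h (monomial i≤n) = h _ i≤n
  span-stable t h zero           = resp (sym (zeroʳ t)) zero
  span-stable t h (plus s u)     = resp (sym (distribˡ _ _ _)) (plus (span-stable t h s) (span-stable t h u))
  span-stable t h (scaled a s)   = resp (solve 3 (λ t k x → k :* (t :* x) := t :* (k :* x)) refl _ _ _) (scaled a (span-stable t h s))
  span-stable t h (resp e s)     = resp (*-congˡ e) (span-stable t h s)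

  -- The span contains 1, hence every power of t, and a finitely generated 𝒪-module lies in one
  -- lattice. This replaces the determinant trick for integrality.
  stable⇒pb : ∀ {z n} t → (∀ i → i ℕ.≤ n → Span z n (t * z ^ i)) → PowerBounded t
  stable⇒pb {z} {n} t h = proj₁ (span-bounded z n) , λ m → proj₂ (span-bounded z n) (powers m)
    where
    powers : ∀ m → Span z n (t ^ m)
    powers zero    = monomial ℕ.z≤n
    powers (suc m) = span-stable t h (powers m)

  span-ev : ∀ {z n} cs → All (Above 0ℤ) cs → ∀ j → j ℕ.+ length cs ℕ.≤ suc n → Span z n (ev 0# (map ι cs) z * z ^ j)
  span-ev [] [] j b = resp (sym (zeroˡ _)) zero
  span-ev {z} {n} (k ∷ cs) (a ∷ as) j b = resp
    (solve 4 (λ k z E P → k :* P :+ E :* (z :* P) := (k :+ z :* E) :* P) refl (ι k) z _ (z ^ j))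
    (plus (scaled a (monomial (ℕₚ.≤-trans (ℕₚ.m≤m+n j (length cs)) (ℕₚ.≤-pred b′))))
          (span-ev cs as (suc j) b′))
    where
    b′ : suc j ℕ.+ length cs ℕ.≤ suc n
    b′ = ≡.subst (ℕ._≤ suc n) (ℕₚ.+-suc j (length cs)) b

  -- If pre ++ suf is an integral equation of z, then multiplication by the
  -- polynomial suf in z maps the span of 1, z, …, zⁿ to itself: multiples of
  -- zʲ are evaluated directly for j ≤ length pre, and through pre otherwise.
  module Relation {z} {n} (pre suf : List K.Carrier) (integral : All (Above 0ℤ) (pre ++ suf))
    (relation : ev 0# (map ι (pre ++ suf)) z ≈ 0#) (len : length pre ℕ.+ length suf ℕ.≤ suc n) where
    T : Carrier
    T = ev 0# (map ι suf) z

    relation′ : ev 0# (map ι pre) z + z ^ length pre * T ≈ 0#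
    relation′ = trans (sym (trans (reflexive (≡.cong (λ l → ev 0# l z) (Listₚ.map-++ ι pre suf)))
      (trans (ev-++ (map ι pre) (map ι suf) z) (+-congˡ (*-congʳ (^-congʳ z (Listₚ.length-map ι pre))))))) relation

    -- The range reaches n + 1 because `zT-pb` multiplies T by z^(i + 1) with i ≤ n.
    shifted : ∀ j → j ℕ.≤ suc n → Span z n (T * z ^ j)
    shifted j j≤ = [ low , high ]′ (ℕₚ.≤-total j (length pre))
      where
      low : j ℕ.≤ length pre → Span z n (T * z ^ j)
      low b = span-ev suf (Allₚ.++⁻ʳ pre integral) j (ℕₚ.≤-trans (ℕₚ.+-monoˡ-≤ (length suf) b) len)
      high : length pre ℕ.≤ j → Span z n (T * z ^ j)
      high b = resp (begin
        ι (K.- K.1#) * (ev 0# (map ι pre) z * z ^ i)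
          ≈⟨ ι-neg1 _ ⟩
        - (ev 0# (map ι pre) z * z ^ i)
          ≈⟨ solve 4 (λ A P T Z → :- (A :* Z) := (T :* (P :* Z)) :- (A :+ P :* T) :* Z) refl _ (z ^ length pre) T (z ^ i) ⟩
        T * (z ^ length pre * z ^ i) - (ev 0# (map ι pre) z + z ^ length pre * T) * z ^ i
          ≈⟨ +-cong (*-congˡ (sym (^-homo-* z (length pre) i))) (-‿cong (trans (*-congʳ relation′) (zeroˡ _))) ⟩
        T * z ^ (length pre ℕ.+ i) - 0#
          ≈⟨ solve 1 (λ x → x :- con (ℤ.+ 0) := x) refl _ ⟩
        T * z ^ (length pre ℕ.+ i)
          ≡⟨ ≡.cong (λ i → T * z ^ i) (ℕₚ.m+[n∸m]≡n b) ⟩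
        T * z ^ j ∎)
        (scaled (above-neg above-1) (span-ev pre (Allₚ.++⁻ˡ pre integral) i
          (≡.subst (ℕ._≤ suc n) (≡.sym (ℕₚ.m∸n+n≡m b)) j≤)))
        where
        i = j ℕ.∸ length pre

    T-pb : PowerBounded T
    T-pb = stable⇒pb T λ i i≤n → shifted i (ℕₚ.m≤n⇒m≤1+n i≤n)

    zT-pb : PowerBounded (z * T)
    zT-pb = stable⇒pb (z * T) λ i i≤n → resp
      (solve 3 (λ z T P → T :* (z :* P) := z :* T :* P) refl z T (z ^ i)) (shifted (suc i) (ℕ.s≤s i≤n))

  charPoly-root : ∀ z → ev 0# (map ι (charPoly z ++ K.1# ∷ [])) z ≈ 0#
  charPoly-root z = begin
    ev 0# (map ι (charPoly z ++ K.1# ∷ [])) z    ≡⟨ ≡.cong (λ l → ev 0# l z) (Listₚ.map-++ ι (charPoly z) (K.1# ∷ [])) ⟩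
    ev 0# (map ι (charPoly z) ++ ι K.1# ∷ []) z  ≈⟨ ev-lead (ι K.1#) (map ι (charPoly z)) z ⟩
    ev (ι K.1#) (map ι (charPoly z)) z           ≈⟨ ev-congˡ (map ι (charPoly z)) z ι.1#-homo ⟩
    ev 1# (map ι (charPoly z)) z                 ≈⟨ ev-charPoly z z ⟩
    ∏ (λ i → z - σ i z)                          ≈⟨ ∏-zero (λ i → z - σ i z) (to G.ε) (x≈y⇒x-y≈0 (sym (index-correct G.ε z))) ⟩
    0#                                           ∎

  ev-map-* : ∀ u cs z → ev 0# (map ι (map (u K.*_) cs)) z ≈ ι u * ev 0# (map ι cs) z
  ev-map-* u [] z = sym (zeroʳ _)
  ev-map-* u (k ∷ cs) z = trans (+-cong (ι.*-homo u k) (*-congˡ (ev-map-* u cs z)))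
    (solve 4 (λ u k z E → u :* k :+ z :* (u :* E) := u :* (k :+ z :* E)) refl (ι u) (ι k) z _)

  -- In a primitive equation of z, let T₁ be the part from the coefficient 1 onwards and T₂ the part
  -- after it, so T₁ = 1 + zT₂. Both T₁ and T₂, as well as zT₁, are power bounded. By locality T₁ or
  -- 1 - T₁ = -zT₂ is a unit: in the one case z = zT₁ / T₁, in the other z⁻¹ = -T₂ / (1 - T₁).
  pb-or-inverse-pb : ∀ z → PowerBounded z ⊎ ∃ λ y → z * y ≈ 1# × PowerBounded y
  pb-or-inverse-pb z = [ (λ h → contradiction (ones-vanish h) (Field.1≉0 K)) , normalised ]′ (minimal equation)
    where
    equation = charPoly z ++ K.1# ∷ []
    ones-vanish : All (K._≈ K.0#) equation → K.1# K.≈ K.0#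
    ones-vanish h = All.head (Allₚ.++⁻ʳ (charPoly z) h)
    normalised : (∃ λ pre → ∃ λ x → ∃ λ suf → ∃ λ i → equation ≡ pre ++ x ∷ suf × v x ≡ [ i ] × All (Above i) equation) →
                 PowerBounded z ⊎ ∃ λ y → z * y ≈ 1# × PowerBounded y
    normalised (pre , x , suf , i , e , vx , above) = [ unit-T , unit-1-T ]′ (local R₁.T-pb)
      where
      x-inverse = Field.inverse K x (λ x≈0 → [i]≢⊤⁺ (≡.trans (≡.sym vx) (Equivalence.from (IsDiscreteValuation.v-∞ isDiscreteValuation x) x≈0)))
      u = proj₁ x-inverse
      pre′ = map (u K.*_) pre
      suf′ = map (u K.*_) suf
      split : map (u K.*_) equation ≡ pre′ ++ u K.* x ∷ suf′
      split = ≡.trans (≡.cong (map (u K.*_)) e) (Listₚ.map-++ (u K.*_) pre (x ∷ suf))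
      integral : All (Above 0ℤ) (pre′ ++ u K.* x ∷ suf′)
      integral = ≡.subst (All (Above 0ℤ)) split (Allₚ.map⁺ (All.map (λ {y} a → ≡.subst (λ m → Above m (u K.* y)) (ℤₚ.+-inverseˡ i)
        (above-* (above-≡ (v-inverse (proj₂ x-inverse) vx)) a)) above))
      relation : ev 0# (map ι (pre′ ++ u K.* x ∷ suf′)) z ≈ 0#
      relation = trans (reflexive (≡.cong (λ l → ev 0# (map ι l) z) (≡.sym split)))
        (trans (ev-map-* u equation z) (trans (*-congˡ (charPoly-root z)) (zeroʳ _)))
      step : (pre′ ++ u K.* x ∷ []) ++ suf′ ≡ pre′ ++ u K.* x ∷ suf′
      step = Listₚ.++-assoc pre′ (u K.* x ∷ []) suf′
      n = length pre′ ℕ.+ length (u K.* x ∷ suf′)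
      -- The same relation is cut once just before and once just after its coefficient 1.
      module R₁ = Relation {z} {n} pre′ (u K.* x ∷ suf′) integral relation (ℕₚ.n≤1+n _)
      module R₂ = Relation {z} {n} (pre′ ++ u K.* x ∷ []) suf′
        (≡.subst (All (Above 0ℤ)) (≡.sym step) integral)
        (trans (reflexive (≡.cong (λ l → ev 0# (map ι l) z) step)) relation)
        (ℕₚ.≤-trans (ℕₚ.≤-reflexive (≡.trans (≡.sym (Listₚ.length-++ (pre′ ++ u K.* x ∷ [])))
          (≡.trans (≡.cong length step) (Listₚ.length-++ pre′)))) (ℕₚ.n≤1+n _))
      T₁≈1+zT₂ : R₁.T ≈ 1# + z * R₂.T
      T₁≈1+zT₂ = +-congʳ (trans (ι.⟦⟧-cong (K.trans (K.*-comm u x) (proj₂ x-inverse))) ι.1#-homo)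
      unit-T : v (Norm R₁.T) ≡ [ 0ℤ ] → PowerBounded z ⊎ ∃ λ y → z * y ≈ 1# × PowerBounded y
      unit-T vN = let y , Ty≈1 , py = pb-inverse R₁.T-pb vN in
        inj₁ (pb-cong (trans (*-assoc z R₁.T y) (trans (*-congˡ Ty≈1) (*-identityʳ z))) (pb-* R₁.zT-pb py))
      unit-1-T : v (Norm (1# - R₁.T)) ≡ [ 0ℤ ] → PowerBounded z ⊎ ∃ λ y → z * y ≈ 1# × PowerBounded y
      unit-1-T vN = let y , e′ , py = pb-inverse (pb-minus pb-1 R₁.T-pb) vN in
        inj₂ (- R₂.T * y , (begin
          z * (- R₂.T * y)                  ≈⟨ solve 3 (λ z T y → z :* (:- T :* y) := (:1 :- (:1 :+ z :* T)) :* y) refl z R₂.T y ⟩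
          (1# - (1# + z * R₂.T)) * y        ≈⟨ *-congʳ (+-congˡ (-‿cong (sym T₁≈1+zT₂))) ⟩
          (1# - R₁.T) * y                   ≈⟨ e′ ⟩
          1#                                ∎) , pb-* (pb-neg R₂.T-pb) py)

  -- If instead y = z⁻¹ is power bounded, then the norms of z and y both have valuation at least 0
  -- and product 1. So y is a unit among the power bounded elements, and its inverse is z.
  above⇒pb : ∀ {z} → Above 0ℤ (Norm z) → PowerBounded z
  above⇒pb {z} a = [ id , (λ (y , zy≈1 , py) → via y zy≈1 py) ]′ (pb-or-inverse-pb z)
    where
    via : ∀ y → z * y ≈ 1# → PowerBounded y → PowerBounded z
    via y zy≈1 py = let x , yx≈1 , px = pb-inverse py vNy in pb-cong (begin
      x              ≈⟨ sym (*-identityˡ x) ⟩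
      1# * x         ≈⟨ *-congʳ (sym zy≈1) ⟩
      z * y * x      ≈⟨ *-assoc z y x ⟩
      z * (y * x)    ≈⟨ *-congˡ yx≈1 ⟩
      z * 1#         ≈⟨ *-identityʳ z ⟩
      z              ∎) px
      where
      vNy : v (Norm y) ≡ [ 0ℤ ]
      vNy = v≡0 (pb⇒above py) λ b → ¬above-1-1
        (above-cong (K.trans (K.sym (Norm-* z y)) (K.trans (Norm-cong zy≈1) Norm-1)) (above-* {0ℤ} {1ℤ} a b))

-- Action of the Galois group on the residue field of L

iter : ∀ {a} {A : Set a} → (A → A) → ℕ → A → A
iter f zero    x = x
iter f (suc n) x = f (iter f n x)

iter-+ : ∀ {a} {A : Set a} (f : A → A) m n x → iter f (m ℕ.+ n) x ≡ iter f m (iter f n x)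
iter-+ f zero    n x = ≡.refl
iter-+ f (suc m) n x = ≡.cong f (iter-+ f m n x)

module Iteration {a ℓ} (S : Setoid a ℓ) (f : Setoid.Carrier S → Setoid.Carrier S)
  (f-cong : ∀ {x y} → Setoid._≈_ S x y → Setoid._≈_ S (f x) (f y)) where
  open Setoid S

  iter-cong : ∀ n {x y} → x ≈ y → iter f n x ≈ iter f n y
  iter-cong zero    e = e
  iter-cong (suc n) e = f-cong (iter-cong n e)

  iter-multiple : ∀ k {i x} → iter f i x ≈ x → iter f (k ℕ.* i) x ≈ x
  iter-multiple zero    e = refl
  iter-multiple (suc k) {i} {x} e = trans (reflexive (iter-+ f i (k ℕ.* i) x)) (trans (iter-cong i (iter-multiple k e)) e)

  -- Bézout for i and l yields multiples of them differing by 1. Since f is not assumed invertible,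
  -- the two signs of the identity are treated separately.
  iter-prime : ∀ {l} → Prime l → ∀ {i x} → 0 ℕ.< i → i ℕ.< l → iter f i x ≈ x → iter f l x ≈ x → f x ≈ x
  iter-prime {l} l-prime {i} {x} 0<i i<l ei el
    with coprime-Bézout (prime⇒coprime l-prime {{ℕ.>-nonZero 0<i}} i<l)
  ... | Bézout.+- s t e = trans (sym (f-cong (iter-multiple t ei))) (trans (reflexive (≡.cong (λ n → iter f n x) e)) (iter-multiple s el))
  ... | Bézout.-+ s t e = trans (sym (f-cong (iter-multiple s el))) (trans (reflexive (≡.cong (λ n → iter f n x) e)) (iter-multiple t ei))

module SumLemmas {c ℓ} (R : CommutativeRing c ℓ) where
  open RingKit R
  open SetoidReasoning setoid

  sum-++ : ∀ {a} {A : Set a} (g : A → Carrier) {m n} (s : Fin m → A) (t : Fin n → A) →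
           sum (λ i → g ((s Vector.++ t) i)) ≈ sum (λ i → g (s i)) + sum (λ i → g (t i))
  sum-++ g {zero}  s t = sym (+-identityˡ _)
  sum-++ g {suc m} {n} s t = trans (+-congˡ (trans (sum-cong-≋ (λ i → reflexive (≡.cong g (tail-++ i)))) (sum-++ g (s ∘ suc) t)))
    (sym (+-assoc _ _ _))
    where
    tail-++ : ∀ i → (s Vector.++ t) (suc i) ≡ ((s ∘ suc) Vector.++ t) i
    tail-++ i with splitAt m i
    ... | inj₁ _ = ≡.refl
    ... | inj₂ _ = ≡.refl

  sum-shift : ∀ n (g : ℕ → Carrier) →
              sum {n} (λ i → g (suc (toℕ i))) + g 0 ≈ sum {n} (λ i → g (toℕ i)) + g n
  sum-shift zero    g = refl
  sum-shift (suc n) g = begin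
    (g 1 + sum {n} (λ i → g (suc (suc (toℕ i))))) + g 0   ≈⟨ solve 3 (λ a s b → (a :+ s) :+ b := b :+ (s :+ a)) refl _ _ _ ⟩
    g 0 + (sum {n} (λ i → g (suc (suc (toℕ i)))) + g 1)   ≈⟨ +-congˡ (sum-shift n (g ∘ suc)) ⟩
    g 0 + (sum {n} (λ i → g (suc (toℕ i))) + g (suc n))   ≈⟨ sym (+-assoc _ _ _) ⟩
    (g 0 + sum {n} (λ i → g (suc (toℕ i)))) + g (suc n)   ∎

  sum-minus : ∀ {n} (f g : Fin n → Carrier) → sum (λ i → f i - g i) ≈ sum f - sum g
  sum-minus {zero}  f g = sym (-‿inverseʳ 0#)
  sum-minus {suc n} f g = trans (+-congˡ (sum-minus (f ∘ suc) (g ∘ suc)))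
    (solve 4 (λ a b s t → (a :- b) :+ (s :- t) := (a :+ s) :- (b :+ t)) refl _ _ _ _)

++-case : ∀ {a p} {A : Set a} {m n} (s : Fin m → A) (t : Fin n → A) (P : A → Set p) i →
          P ((s Vector.++ t) i) → (∃ λ j → P (s j)) ⊎ (∃ λ k → P (t k))
++-case {m = m} s t P i p with splitAt m i
... | inj₁ j = inj₁ (j , p)
... | inj₂ k = inj₂ (k , p)

module ResidueAction {c ℓ c′ ℓ′ g} (F : Field c ℓ) {q : ℕ} (card : HasCardinality (Field.setoid F) q)
  (R : CommutativeRing c′ ℓ′) (nzd : NoZeroDivisors R)
  (1≉0 : ¬ CommutativeRing._≈_ R (CommutativeRing.1# R) (CommutativeRing.0# R))
  (j : Field.Carrier F → CommutativeRing.Carrier R)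
  (j-hom : IsRingHomomorphism (Field.rawRing F) (CommutativeRing.rawRing R) j)
  (G : Set g) (act : G → CommutativeRing.Carrier R → CommutativeRing.Carrier R)
  (act-hom : ∀ σ → IsRingHomomorphism (CommutativeRing.rawRing R) (CommutativeRing.rawRing R) (act σ))
  (act-fixes : ∀ σ x → CommutativeRing._≈_ R (act σ (j x)) (j x))
  (l : ℕ) (l-prime : Prime l)
  (act-period : ∀ σ x → CommutativeRing._≈_ R (iter (act σ) l x) x)
  (frobenius-locally : ∀ x → ∃ λ σ → CommutativeRing._≈_ R (act σ x) (RingKit._^_ R x q))
  where

  open RingKit R
  open Polynomials R
  open SumLemmas R
  open FrobeniusOver F card R nzd 1≉0 j j-hom using (φ; φ-cong; φ-hom; fixed⇒∈F)
  open SetoidReasoning setoid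
  private
    module act σ = IsRingHomomorphism (act-hom σ)
    module actKit σ = RingHomomorphismKit R R (act σ) (act-hom σ)

  open Iteration setoid φ φ-cong

  iter-hom : ∀ {f} → IsRingHomomorphism rawRing rawRing f → ∀ n → IsRingHomomorphism rawRing rawRing (iter f n)
  iter-hom {f} h zero = Identity.isRingHomomorphism rawRing refl
  iter-hom {f} h (suc n) = Composition.isRingHomomorphism trans (iter-hom h n) h

  private
    module φ n = IsRingHomomorphism (iter-hom φ-hom n)
    module φKit n = RingHomomorphismKit R R (iter φ n) (iter-hom φ-hom n)

  act-φ : ∀ σ n x → act σ (iter φ n x) ≈ iter φ n (act σ x)
  act-φ σ zero    x = refl
  act-φ σ (suc n) x = trans (actKit.^-homo σ _ q) (φ-cong (act-φ σ n x))

  frobenius-iterates : ∀ σ {x} → act σ x ≈ φ x → ∀ n → iter (act σ) n x ≈ iter φ n x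
  frobenius-iterates σ e zero = refl
  frobenius-iterates σ {x} e (suc n) = begin
    act σ (iter (act σ) n x)  ≈⟨ act.⟦⟧-cong σ (frobenius-iterates σ e n) ⟩
    act σ (iter φ n x)        ≈⟨ act-φ σ n x ⟩
    iter φ n (act σ x)        ≈⟨ iter-cong n e ⟩
    iter φ n (φ x)            ≡⟨ ≡.sym (iter-+ φ n 1 x) ⟩
    iter φ (n ℕ.+ 1) x        ≡⟨ ≡.cong (λ k → iter φ k x) (ℕₚ.+-comm n 1) ⟩
    iter φ (suc n) x          ∎

  -- On each x the Frobenius φ agrees with some σ, and σ commutes with φ.
  φ-period : ∀ x → iter φ l x ≈ x
  φ-period x = let σ , e = frobenius-locally x in trans (sym (frobenius-iterates σ e l)) (act-period σ x)

  φ-fixed⇒act-fixed : ∀ {x} → φ x ≈ x → ∀ σ → act σ x ≈ x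
  φ-fixed⇒act-fixed {x} e σ = let y , x≈jy = fixed⇒∈F x e in
    trans (act.⟦⟧-cong σ x≈jy) (trans (act-fixes σ y) (sym x≈jy))

  private
    instance
      l-nonZero : ℕ.NonZero l
      l-nonZero = prime⇒nonZero l-prime

  -- Applying φ^(l - i) to both sides gives a return time k - i strictly between 0 and l; together
  -- with the return time l, which is prime, this fixes x.
  collision⇒φ-fixed : ∀ {x i k} → i ℕ.< k → k ℕ.< l → iter φ i x ≈ iter φ k x → φ x ≈ x
  collision⇒φ-fixed {x} {i} {k} i<k k<l e =
    iter-prime l-prime (ℕₚ.m<n⇒0<n∸m i<k) (ℕₚ.≤-<-trans (ℕₚ.m∸n≤m k i) k<l) (begin
      iter φ (k ℕ.∸ i) x                     ≈⟨ sym (iter-cong (k ℕ.∸ i) (φ-period x)) ⟩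
      iter φ (k ℕ.∸ i) (iter φ l x)          ≡⟨ ≡.sym (iter-+ φ (k ℕ.∸ i) l x) ⟩
      iter φ (k ℕ.∸ i ℕ.+ l) x               ≡⟨ ≡.cong (λ n → iter φ n x) index ⟩
      iter φ (l ℕ.∸ i ℕ.+ k) x               ≡⟨ iter-+ φ (l ℕ.∸ i) k x ⟩
      iter φ (l ℕ.∸ i) (iter φ k x)          ≈⟨ iter-cong (l ℕ.∸ i) (sym e) ⟩
      iter φ (l ℕ.∸ i) (iter φ i x)          ≡⟨ ≡.sym (iter-+ φ (l ℕ.∸ i) i x) ⟩
      iter φ (l ℕ.∸ i ℕ.+ i) x               ≡⟨ ≡.cong (λ n → iter φ n x) (ℕₚ.m∸n+n≡m i≤l) ⟩
      iter φ l x                             ≈⟨ φ-period x ⟩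
      x                                      ∎) (φ-period x)
    where
    i≤l : i ℕ.≤ l
    i≤l = ℕₚ.<⇒≤ (ℕₚ.<-trans i<k k<l)
    index : k ℕ.∸ i ℕ.+ l ≡ l ℕ.∸ i ℕ.+ k
    index = ≡.trans (≡.sym (ℕₚ.+-∸-comm l (ℕₚ.<⇒≤ i<k))) (≡.trans (≡.cong (ℕ._∸ i) (ℕₚ.+-comm k l)) (ℕₚ.+-∸-comm k i≤l))

  -- The exponents 1, q, q², …, q^(l-1) modulo l and 0 cannot all differ.
  root-of-unity-fixed : ∀ {ζ} → ζ ^ l ≈ 1# → φ ζ ≈ ζ
  root-of-unity-fixed {ζ} ζ^l≈1 = conclude (Finₚ.pigeonhole (ℕₚ.n<1+n l) exponent)
    where
    exponentℕ : Fin (suc l) → ℕ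
    exponentℕ zero    = 0
    exponentℕ (suc i) = q ℕ.^ toℕ i
    exponent : Fin (suc l) → Fin l
    exponent i = fromℕ< (m%n<n (exponentℕ i) l)
    ζ^-% : ∀ n → ζ ^ n ≈ ζ ^ (n % l)
    ζ^-% n = begin
      ζ ^ n                                   ≡⟨ ≡.cong (ζ ^_) (m≡m%n+[m/n]*n n l) ⟩
      ζ ^ (n % l ℕ.+ n / l ℕ.* l)             ≈⟨ ^-homo-* ζ (n % l) _ ⟩
      ζ ^ (n % l) * ζ ^ (n / l ℕ.* l)         ≡⟨ ≡.cong (λ k → ζ ^ (n % l) * ζ ^ k) (ℕₚ.*-comm (n / l) l) ⟩
      ζ ^ (n % l) * ζ ^ (l ℕ.* (n / l))       ≈⟨ *-congˡ (trans (sym (^-assocʳ ζ l (n / l))) (trans (^-congˡ (n / l) ζ^l≈1) (1^ (n / l)))) ⟩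
      ζ ^ (n % l) * 1#                        ≈⟨ *-identityʳ _ ⟩
      ζ ^ (n % l)                             ∎
    iter-φ : ∀ n → ζ ^ (q ℕ.^ n) ≈ iter φ n ζ
    iter-φ zero    = *-identityʳ ζ
    iter-φ (suc n) = trans (^-congʳ ζ (ℕₚ.*-comm q (q ℕ.^ n))) (trans (sym (^-assocʳ ζ (q ℕ.^ n) q)) (φ-cong (iter-φ n)))
    same : ∀ a b → exponent a ≡ exponent b → ζ ^ exponentℕ a ≈ ζ ^ exponentℕ b
    same a b e = trans (ζ^-% _) (trans (^-congʳ ζ (Finₚ.fromℕ<-injective _ _ _ _ e)) (sym (ζ^-% _)))
    conclude : (∃ λ a → ∃ λ b → toℕ a ℕ.< toℕ b × exponent a ≡ exponent b) → φ ζ ≈ ζ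
    -- A collision with the exponent 0 means φ^k ζ = 1; completing it to φ^l gives ζ = 1.
    conclude (zero , suc k , _ , e) = trans (φ-cong ζ≈1) (trans (1^ q) (sym ζ≈1))
      where
      ζ≈1 : ζ ≈ 1#
      ζ≈1 = begin
        ζ                                            ≈⟨ sym (φ-period ζ) ⟩
        iter φ l ζ                                   ≡⟨ ≡.cong (λ n → iter φ n ζ) (≡.sym (ℕₚ.m∸n+n≡m (ℕₚ.<⇒≤ (Finₚ.toℕ<n k)))) ⟩
        iter φ (l ℕ.∸ toℕ k ℕ.+ toℕ k) ζ             ≡⟨ iter-+ φ (l ℕ.∸ toℕ k) (toℕ k) ζ ⟩
        iter φ (l ℕ.∸ toℕ k) (iter φ (toℕ k) ζ)      ≈⟨ iter-cong (l ℕ.∸ toℕ k) (trans (sym (iter-φ (toℕ k))) (sym (same zero (suc k) e))) ⟩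
        iter φ (l ℕ.∸ toℕ k) 1#                      ≈⟨ φ.1#-homo (l ℕ.∸ toℕ k) ⟩
        1#                                           ∎
    conclude (suc i , suc k , ℕ.s≤s i<k , e) = collision⇒φ-fixed i<k (Finₚ.toℕ<n k)
      (trans (sym (iter-φ (toℕ i))) (trans (same (suc i) (suc k) e) (iter-φ (toℕ k))))

  trace : Carrier → Carrier
  trace x = sum {l} (λ i → iter φ (toℕ i) x)

  φ-trace : ∀ x → φ (trace x) ≈ trace x
  φ-trace x = begin
    φ (trace x)                                      ≈⟨ φKit.sum-homo 1 {l} (λ i → iter φ (toℕ i) x) ⟩
    sum {l} (λ i → iter φ (suc (toℕ i)) x)           ≈⟨ solve 2 (λ a b → a := (a :+ b) :- b) refl _ x ⟩
    (sum {l} (λ i → iter φ (suc (toℕ i)) x) + x) - x ≈⟨ +-congʳ (sum-shift l (λ n → iter φ n x)) ⟩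
    (trace x + iter φ l x) - x                       ≈⟨ +-congʳ (+-congˡ (φ-period x)) ⟩
    (trace x + x) - x                                ≈⟨ solve 2 (λ a b → (a :+ b) :- b := a) refl _ x ⟩
    trace x                                          ∎

  -- The trace is fixed by φ, hence comes from F and is fixed by σ; and σ commutes with φ, which is
  -- a power map.
  trace-act : ∀ σ x → trace x ≈ trace (act σ x)
  trace-act σ x = begin
    trace x                                  ≈⟨ sym (φ-fixed⇒act-fixed (φ-trace x) σ) ⟩
    act σ (trace x)                          ≈⟨ actKit.sum-homo σ {l} (λ i → iter φ (toℕ i) x) ⟩
    sum {l} (λ i → act σ (iter φ (toℕ i) x)) ≈⟨ sum-cong-≋ {l} (λ i → act-φ σ (toℕ i) x) ⟩
    trace (act σ x)                          ∎

  module _ {y} (φy≉y : ¬ φ y ≈ y) where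

    -- Compare the traces of yᵐ w and of its image, for all m.
    stabiliser-trivial : ∀ σ → act σ y ≈ y → ∀ w → act σ w ≈ w
    stabiliser-trivial σ σy≈y w = go l ≡.refl
      where
      go : ∀ n → n ≡ l → act σ w ≈ w
      go zero    e = contradiction (≡.sym e) (ℕ.≢-nonZero⁻¹ l)
      -- The traces say that the weights `d i` at the nodes `φⁱ y` have vanishing moments. The node
      -- y is split off as the distinguished one, so the product compares it with the other l - 1
      -- iterates.
      go (suc n) e = finish (nzd _ _ (vandermonde (λ (i : Fin n) → iter φ (suc (toℕ i)) y) (λ i → d (suc (toℕ i))) y (d 0) (moments n e)))
        where
        d : ℕ → Carrier
        d i = iter φ i w - iter φ i (act σ w)
        moments : ∀ n → suc n ≡ l → ∀ m → y ^ m * d 0 + sum {n} (λ i → iter φ (suc (toℕ i)) y ^ m * d (suc (toℕ i))) ≈ 0#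
        moments n ≡.refl m = begin
          sum {l} (λ i → iter φ (toℕ i) y ^ m * d (toℕ i))
            ≈⟨ sum-cong-≋ {l} (λ i → trans (solve 3 (λ Y a b → Y :* (a :- b) := Y :* a :- Y :* b) refl (iter φ (toℕ i) y ^ m) _ _)
                 (+-cong (term (toℕ i) y w) (-‿cong (trans (*-congʳ (^-congˡ m (iter-cong (toℕ i) (sym σy≈y))))
                   (trans (term (toℕ i) (act σ y) (act σ w)) (iter-cong (toℕ i) image)))))) ⟩
          sum {l} (λ i → iter φ (toℕ i) (y ^ m * w) - iter φ (toℕ i) (act σ (y ^ m * w)))
            ≈⟨ sum-minus {l} (λ i → iter φ (toℕ i) (y ^ m * w)) (λ i → iter φ (toℕ i) (act σ (y ^ m * w))) ⟩
          trace (y ^ m * w) - trace (act σ (y ^ m * w))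
            ≈⟨ x≈y⇒x-y≈0 (trace-act σ (y ^ m * w)) ⟩
          0# ∎
          where
          term : ∀ i y w → iter φ i y ^ m * iter φ i w ≈ iter φ i (y ^ m * w)
          term i y w = sym (trans (φ.*-homo i _ _) (*-congʳ (φKit.^-homo i y m)))
          image : act σ y ^ m * act σ w ≈ act σ (y ^ m * w)
          image = sym (trans (act.*-homo σ _ _) (*-congʳ (actKit.^-homo σ y m)))
        finish : d 0 ≈ 0# ⊎ ∏ (λ i → y - iter φ (suc (toℕ {n} i)) y) ≈ 0# → act σ w ≈ w
        finish (inj₁ e) = sym (x-y≈0⇒x≈y e)
        finish (inj₂ p) = let i , y≈ = ∏≈0⇒∃ nzd 1≉0 _ p in
          contradiction (collision⇒φ-fixed {i = 0} (ℕ.s≤s ℕ.z≤n) (≡.subst (suc (toℕ i) ℕ.<_) e (ℕ.s≤s (Finₚ.toℕ<n i))) (x-y≈0⇒x≈y y≈)) φy≉y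

    -- Otherwise σy and the φⁱy would be distinct, although y and σy have the
    -- same traces of powers.
    orbit : ∀ σ → ∃ λ i → i ℕ.< l × act σ y ≈ iter φ i y
    orbit σ = go l ≡.refl
      where
      go : ∀ n → n ≡ l → ∃ λ i → i ℕ.< l × act σ y ≈ iter φ i y
      go zero    e = contradiction (≡.sym e) (ℕ.≢-nonZero⁻¹ l)
      go (suc n) e = let k , z = ∏≈0⇒∃ nzd 1≉0 _ product≈0 in
        [ (λ (i , p) → toℕ i , Finₚ.toℕ<n i , p) , (λ (i , p) → contradiction (impossible i p) φy≉y) ]′
          (++-case plus minus (λ (e , _) → act σ y ≈ e) k (x-y≈0⇒x≈y z))
        where
        -- Equality of traces of powers is a relation among the nodes `φⁱ y` with weight 1 and
        -- `φⁱ(σy)` with weight -1. The node σy is the distinguished one, so `minus` starts at i =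
        -- 1.
        plus : Fin l → Carrier × Carrier
        plus i = iter φ (toℕ i) y , 1#
        minus : Fin n → Carrier × Carrier
        minus i = iter φ (suc (toℕ i)) (act σ y) , - 1#
        node : Fin (l ℕ.+ n) → Carrier × Carrier
        node = plus Vector.++ minus
        moments : ∀ n → suc n ≡ l → ∀ m → act σ y ^ m * - 1# +
          (sum {l} (λ i → iter φ (toℕ i) y ^ m * 1#) + sum {n} (λ i → iter φ (suc (toℕ i)) (act σ y) ^ m * - 1#)) ≈ 0#
        moments n ≡.refl m = begin
          act σ y ^ m * - 1# + (sum {l} (λ i → iter φ (toℕ i) y ^ m * 1#) + sum {n} (λ i → iter φ (suc (toℕ i)) (act σ y) ^ m * - 1#))
            ≈⟨ solve 3 (λ a b c → a :+ (b :+ c) := b :+ (a :+ c)) refl _ _ _ ⟩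
          sum {l} (λ i → iter φ (toℕ i) y ^ m * 1#) + sum {l} (λ i → iter φ (toℕ i) (act σ y) ^ m * - 1#)
            ≈⟨ +-cong (sum-cong-≋ {l} (λ i → trans (*-identityʳ _) (sym (φKit.^-homo (toℕ i) y m))))
                      (sym (*-distribʳ-sum {l} (- 1#) (λ i → iter φ (toℕ i) (act σ y) ^ m))) ⟩
          trace (y ^ m) + sum {l} (λ i → iter φ (toℕ i) (act σ y) ^ m) * - 1#
            ≈⟨ +-congˡ (*-congʳ (sum-cong-≋ {l} (λ i → sym (trans (iter-cong (toℕ i) (actKit.^-homo σ y m)) (φKit.^-homo (toℕ i) (act σ y) m))))) ⟩
          trace (y ^ m) + trace (act σ (y ^ m)) * - 1#
            ≈⟨ +-congʳ (trace-act σ (y ^ m)) ⟩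
          trace (act σ (y ^ m)) + trace (act σ (y ^ m)) * - 1#
            ≈⟨ solve 1 (λ t → t :+ t :* (:- :1) := con (ℤ.+ 0)) refl _ ⟩
          0# ∎
        product≈0 : ∏ (λ k → act σ y - proj₁ (node k)) ≈ 0#
        product≈0 = begin
          ∏ (λ k → act σ y - proj₁ (node k))                        ≈⟨ solve 1 (λ p → p := :- (:- :1 :* p)) refl _ ⟩
          - (- 1# * ∏ (λ k → act σ y - proj₁ (node k)))             ≈⟨ -‿cong (vandermonde (proj₁ ∘ node) (proj₂ ∘ node) (act σ y) (- 1#) λ m →
              trans (+-congˡ (sum-++ (λ (e , d) → e ^ m * d) plus minus)) (moments n e m)) ⟩
          - 0#                                                      ≈⟨ -0#≈0# ⟩
          0#                                                        ∎
        -- Such a collision puts σy into F, so σ fixes σy and σ^l y = σy. But σ^l y = y, hence y =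
        -- σy would be fixed by φ.
        impossible : ∀ (i : Fin n) → act σ y ≈ iter φ (suc (toℕ i)) (act σ y) → φ y ≈ y
        impossible i p = trans (φ-cong (sym σy≈y)) (trans φσy≈σy σy≈y)
          where
          φσy≈σy : φ (act σ y) ≈ act σ y
          φσy≈σy = collision⇒φ-fixed {i = 0} (ℕ.s≤s ℕ.z≤n) (≡.subst (suc (toℕ i) ℕ.<_) e (ℕ.s≤s (Finₚ.toℕ<n i))) p
          iterates : ∀ n → iter (act σ) (suc n) y ≈ act σ y
          iterates zero    = refl
          iterates (suc n) = trans (act.⟦⟧-cong σ (iterates n)) (φ-fixed⇒act-fixed φσy≈σy σ)
          σy≈y : act σ y ≈ y
          σy≈y = trans (sym (iterates n)) (trans (reflexive (≡.cong (λ k → iter (act σ) k y) e)) (act-period σ y))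

-- Quotient rings and the residue ring of L

module _ {c ℓ b} (R : CommutativeRing c ℓ) (B : CommutativeRing.Carrier R → Set b) where
  open CommutativeRing R

  record IsSubring : Set (c Level.⊔ b) where
    field
      B-0   : B 0#
      B-1   : B 1#
      B-+   : ∀ {x y} → B x → B y → B (x + y)
      B-neg : ∀ {x} → B x → B (- x)
      B-*   : ∀ {x y} → B x → B y → B (x * y)

  record IsIdealOf {m} (M : Carrier → Set m) : Set (c Level.⊔ ℓ Level.⊔ b Level.⊔ m) where
    field
      M-cong : ∀ {x y} → x ≈ y → M x → M y
      M-0    : M 0#
      M-+    : ∀ {x y} → M x → M y → M (x + y)
      M-neg  : ∀ {x} → M x → M (- x)
      M-*    : ∀ {x y} → M x → B y → M (x * y)

module QuotientRing {c ℓ b m} (R : CommutativeRing c ℓ)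
  (B : CommutativeRing.Carrier R → Set b) (M : CommutativeRing.Carrier R → Set m)
  (isSubring : IsSubring R B) (isIdeal : IsIdealOf R B M) where
  open RingKit R
  open IsSubring isSubring
  open IsIdealOf isIdeal

  infix 4 _∼_
  _∼_ : Σ Carrier B → Σ Carrier B → Set m
  (x , _) ∼ (y , _) = M (x - y)

  ≈⇒∼ : ∀ {x y} → x ≈ y → M (x - y)
  ≈⇒∼ e = M-cong (sym (x≈y⇒x-y≈0 e)) M-0

  quotient : CommutativeRing (c Level.⊔ b) m
  quotient = record
    { Carrier = Σ Carrier B
    ; _≈_     = _∼_
    ; _+_     = λ (x , p) (y , q) → x + y , B-+ p q
    ; _*_     = λ (x , p) (y , q) → x * y , B-* p q
    ; -_      = λ (x , p) → - x , B-neg p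
    ; 0#      = 0# , B-0
    ; 1#      = 1# , B-1
    ; isCommutativeRing = record
      { isRing = record
        { +-isAbelianGroup = record
          { isGroup = record
            { isMonoid = record
              { isSemigroup = record
                { isMagma = record
                  { isEquivalence = record
                    { refl  = ≈⇒∼ refl
                    ; sym   = λ p → M-cong (solve 2 (λ x y → :- (x :- y) := y :- x) refl _ _) (M-neg p)
                    ; trans = λ p q → M-cong (solve 3 (λ x y z → (x :- y) :+ (y :- z) := x :- z) refl _ _ _) (M-+ p q)
                    }
                  ; ∙-cong = λ p q → M-cong (solve 4 (λ x y u w → (x :- y) :+ (u :- w) := (x :+ u) :- (y :+ w)) refl _ _ _ _) (M-+ p q)
                  }
                ; assoc = λ _ _ _ → ≈⇒∼ (+-assoc _ _ _)
                }
              ; identity = (λ _ → ≈⇒∼ (+-identityˡ _)) , (λ _ → ≈⇒∼ (+-identityʳ _))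
              }
            ; inverse = (λ _ → ≈⇒∼ (-‿inverseˡ _)) , (λ _ → ≈⇒∼ (-‿inverseʳ _))
            ; ⁻¹-cong = λ p → M-cong (solve 2 (λ x y → :- (x :- y) := :- x :- :- y) refl _ _) (M-neg p)
            }
          ; comm = λ _ _ → ≈⇒∼ (+-comm _ _)
          }
        ; *-cong = λ {_} {y} {u} p q → M-cong
            (solve 4 (λ x y u w → (x :- y) :* u :+ (u :- w) :* y := x :* u :- y :* w) refl _ _ _ _)
            (M-+ (M-* p (proj₂ u)) (M-* q (proj₂ y)))
        ; *-assoc = λ _ _ _ → ≈⇒∼ (*-assoc _ _ _)
        ; *-identity = (λ _ → ≈⇒∼ (*-identityˡ _)) , (λ _ → ≈⇒∼ (*-identityʳ _))
        ; distrib = (λ _ _ _ → ≈⇒∼ (distribˡ _ _ _)) , (λ _ _ _ → ≈⇒∼ (distribʳ _ _ _))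
        }
      ; *-comm = λ _ _ → ≈⇒∼ (*-comm _ _)
      }
    }

module ResidueRing {c ℓ c′ ℓ′} (𝕂 : LocalField c ℓ)
  (𝕃 : FiniteGaloisExtension (LocalField.baseField 𝕂) c′ ℓ′)
  {N : ℕ} (galCard : HasCardinality (Group.setoid (Gal (FiniteGaloisExtension.extension 𝕃))) N) where

  open LocalField 𝕂 using (v; isDiscreteValuation) renaming (baseField to K)
  open FiniteGaloisExtension 𝕃 using (isGalois) renaming (extension to E)
  open FieldExtension E using (top; ι)
  open Field top using (inverse)
  private
    module K = RingKit (Field.commutativeRing K)
    module ι = IsRingHomomorphism (FieldExtension.isRingHomomorphism E)
    module G = Group (Gal E)
  open RingKit (Field.commutativeRing top)
  open Polynomials (Field.commutativeRing top)
  open RootPolynomial (Field.commutativeRing top)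
  open Valuation K v isDiscreteValuation
    using (Above; above?; above-cong; above-mono; above-0; ¬above-1-1; above-*; above-^;
           v≡0; v≡0⇒¬above-1; powers-above)
  open IsDiscreteValuation isDiscreteValuation using (v-cong)
  open GaloisNorm E isGalois galCard
  open PowerBoundedElements 𝕂 𝕃 galCard
  open ValuationRing 𝕂 𝕃 galCard
  open Inverse galCard using (to; from)
  open Automorphism using (⟦_⟧)
  open SetoidReasoning setoid

  record Integral (x : Carrier) : Set where
    constructor mkIntegral
    field
      norm-above-0 : Above 0ℤ (Norm x)

  record Small (x : Carrier) : Set where
    constructor mkSmall
    field
      norm-above-1 : Above 1ℤ (Norm x)

  open Integral public
  open Small public

  small? : ∀ x → Dec (Small x)
  small? x = Dec.map′ mkSmall norm-above-1 (above? 1ℤ (Norm x))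

  integral-pb : ∀ {x} → Integral x → PowerBounded x
  integral-pb p = above⇒pb (norm-above-0 p)

  pb-integral : ∀ {x} → PowerBounded x → Integral x
  pb-integral p = mkIntegral (pb⇒above p)

  integral-cong : ∀ {x y} → x ≈ y → Integral x → Integral y
  integral-cong e p = mkIntegral (above-cong (Norm-cong e) (norm-above-0 p))

  small-cong : ∀ {x y} → x ≈ y → Small x → Small y
  small-cong e p = mkSmall (above-cong (Norm-cong e) (norm-above-1 p))

  integral-+ : ∀ {x y} → Integral x → Integral y → Integral (x + y)
  integral-+ p q = pb-integral (pb-+ (integral-pb p) (integral-pb q))

  integral-* : ∀ {x y} → Integral x → Integral y → Integral (x * y)
  integral-* {x} {y} p q = mkIntegral (above-cong (K.sym (Norm-* x y)) (above-* {0ℤ} {0ℤ} (norm-above-0 p) (norm-above-0 q)))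

  integral-neg : ∀ {x} → Integral x → Integral (- x)
  integral-neg p = pb-integral (pb-neg (integral-pb p))

  integral-1 : Integral 1#
  integral-1 = pb-integral pb-1

  integral-ι : ∀ {k} → Above 0ℤ k → Integral (ι k)
  integral-ι a = pb-integral (pb-ι a)

  integral-0 : Integral 0#
  integral-0 = integral-cong ι.0#-homo (integral-ι above-0)

  integral-automorphism : ∀ τ {x} → Integral x → Integral (⟦ τ ⟧ x)
  integral-automorphism τ p = pb-integral (pb-automorphism τ (integral-pb p))

  small-* : ∀ {x y} → Small x → Integral y → Small (x * y)
  small-* {x} {y} p q = mkSmall (above-cong (K.sym (Norm-* x y)) (above-* {1ℤ} {0ℤ} (norm-above-1 p) (norm-above-0 q)))

  small-*ʳ : ∀ {x y} → Integral x → Small y → Small (x * y)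
  small-*ʳ p q = small-cong (*-comm _ _) (small-* q p)

  small-neg : ∀ {x} → Small x → Small (- x)
  small-neg {x} p = small-cong (trans (*-comm _ _) (-1*x≈-x x)) (small-* p (integral-neg integral-1))

  -- The norm says nothing about sums directly. As x/y or y/x is power bounded, x + y is an integral
  -- multiple of y or of x.
  small-+ : ∀ {x y} → Small x → Small y → Small (x + y)
  small-+ {x} {y} p q = cases (≈0? y)
    where
    cases : Dec (y ≈ 0#) → Small (x + y)
    cases (yes y≈0) = small-cong (sym (trans (+-congˡ y≈0) (+-identityʳ x))) p
    cases (no y≉0)  = [ by-y , by-x ]′ (pb-or-inverse-pb (x * y⁻¹))
      where
      y⁻¹ = proj₁ (inverse y y≉0)
      yy⁻¹≈1 = proj₂ (inverse y y≉0)
      by-y : PowerBounded (x * y⁻¹) → Small (x + y)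
      by-y b = small-cong (begin
        (x * y⁻¹ + 1#) * y      ≈⟨ solve 3 (λ x y z → (x :* z :+ :1) :* y := x :* (y :* z) :+ y) refl x y y⁻¹ ⟩
        x * (y * y⁻¹) + y       ≈⟨ +-congʳ (trans (*-congˡ yy⁻¹≈1) (*-identityʳ x)) ⟩
        x + y                   ∎) (small-*ʳ (integral-+ (pb-integral b) integral-1) q)
      by-x : (∃ λ u → x * y⁻¹ * u ≈ 1# × PowerBounded u) → Small (x + y)
      by-x (u , e , b) = small-cong (begin
        (1# + u) * x                  ≈⟨ solve 2 (λ x u → (:1 :+ u) :* x := x :+ :1 :* (x :* u)) refl x u ⟩
        x + 1# * (x * u)              ≈⟨ +-congˡ (*-congʳ (sym yy⁻¹≈1)) ⟩
        x + y * y⁻¹ * (x * u)         ≈⟨ +-congˡ (solve 4 (λ x y z u → y :* z :* (x :* u) := y :* (x :* z :* u)) refl x y y⁻¹ u) ⟩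
        x + y * (x * y⁻¹ * u)         ≈⟨ +-congˡ (trans (*-congˡ e) (*-identityʳ y)) ⟩
        x + y                         ∎) (small-*ʳ (integral-+ integral-1 (pb-integral b)) p)

  Norm-automorphism : ∀ τ x → Norm (⟦ τ ⟧ x) K.≈ Norm x
  Norm-automorphism τ x = ι-injective (trans (ι-Norm (⟦ τ ⟧ x)) (trans (∏σ-automorphism τ x) (sym (ι-Norm x))))

  small-automorphism : ∀ τ {x} → Small x → Small (⟦ τ ⟧ x)
  small-automorphism τ {x} p = mkSmall (above-cong (K.sym (Norm-automorphism τ x)) (norm-above-1 p))

  integral-ratio : ∀ τ {x x⁻¹} → x * x⁻¹ ≈ 1# → Integral (⟦ τ ⟧ x * x⁻¹)
  integral-ratio τ {x} {x⁻¹} e = mkIntegral (above-cong (K.sym ratio-norm) (norm-above-0 integral-1))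
    where
    ratio-norm : Norm (⟦ τ ⟧ x * x⁻¹) K.≈ Norm 1#
    ratio-norm = K.trans (Norm-* _ _) (K.trans (K.*-congʳ (Norm-automorphism τ x)) (K.trans (K.sym (Norm-* x x⁻¹)) (Norm-cong e)))

  ¬small-1 : ¬ Small 1#
  ¬small-1 p = ¬above-1-1 (above-cong Norm-1 (norm-above-1 p))

  small-prime : ∀ {x y} → Integral x → Integral y → Small (x * y) → Small x ⊎ Small y
  small-prime {x} {y} p q s = cases (small? x) (small? y)
    where
    cases : Dec (Small x) → Dec (Small y) → Small x ⊎ Small y
    cases (yes a) _       = inj₁ a
    cases (no _)  (yes b) = inj₂ b
    cases (no a)  (no b)  = contradiction (norm-above-1 s) (v≡0⇒¬above-1 (≡.trans (v-cong (Norm-* x y))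
      (≡.trans (IsDiscreteValuation.v-* isDiscreteValuation _ _)
        (≡.cong₂ _+⁺_ (v≡0 (norm-above-0 p) (a ∘ mkSmall)) (v≡0 (norm-above-0 q) (b ∘ mkSmall))))))

  Norm-ι : ∀ k → Norm (ι k) K.≈ k K.^ N
  Norm-ι k = ι-injective (begin
    ι (Norm (ι k))          ≈⟨ ι-Norm (ι k) ⟩
    ∏ (λ i → σ i (ι k))     ≈⟨ ∏-cong (λ i → Automorphism.fixes (from i) k) ⟩
    ∏ {N} (λ _ → ι k)       ≈⟨ ∏-replicate N ⟩
    ι k ^ N                 ≈⟨ sym (ι-^ k N) ⟩
    ι (k K.^ N)             ∎)

  small-ι : ∀ {k} → Above 1ℤ k → Small (ι k)
  small-ι {k} a = mkSmall (above-cong (K.sym (Norm-ι k)) (positive-power N (to G.ε)))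
    where
    -- The index of the identity of G is passed in to exclude the exponent 0.
    positive-power : ∀ n → Fin n → Above 1ℤ (k K.^ n)
    positive-power (suc n) _ = above-* {1ℤ} {0ℤ} a (above-^ (above-mono (ℤ.+≤+ ℕ.z≤n) a) n)

  integral-ι⁻¹ : ∀ {k} → Integral (ι k) → Above 0ℤ k
  integral-ι⁻¹ {k} p = let C , b = integral-pb p; t , above = ι-Λ in
    powers-above (C ℤ.+ t) λ m → above C _ (Λ-cong (sym (ι-^ k m)) (b m))

  isSubring : IsSubring (Field.commutativeRing top) Integral
  isSubring = record
    { B-0   = integral-0
    ; B-1   = integral-1
    ; B-+   = integral-+
    ; B-neg = integral-neg
    ; B-*   = integral-*
    }

  isIdeal : IsIdealOf (Field.commutativeRing top) Integral Small
  isIdeal = record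
    { M-cong = small-cong
    ; M-0    = small-cong ι.0#-homo (small-ι above-0)
    ; M-+    = small-+
    ; M-neg  = small-neg
    ; M-*    = small-*
    }

  open QuotientRing (Field.commutativeRing top) Integral Small isSubring isIdeal public

-- Inertia is central

module TameGalois {c ℓ c′ ℓ′} (𝕂 : LocalField c ℓ)
  (𝕃 : FiniteGaloisExtension (LocalField.baseField 𝕂) c′ ℓ′)
  {N : ℕ} (galCard : HasCardinality (Group.setoid (Gal (FiniteGaloisExtension.extension 𝕃))) N)
  (l : ℕ) (l-prime : Prime l)
  (l≉0 : ¬ Field._≈_ (LocalField.residueField 𝕂) (RawMonoidOps._×_ (Field.+-rawMonoid (LocalField.residueField 𝕂)) l
         (Field.1# (LocalField.residueField 𝕂))) (Field.0# (LocalField.residueField 𝕂)))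
  (period : KilledBy (Gal (FiniteGaloisExtension.extension 𝕃)) l)
  where

  open LocalField 𝕂 using (v; isDiscreteValuation; residueFinite; residueField) renaming (baseField to K)
  open FiniteGaloisExtension 𝕃 using (isGalois) renaming (extension to E)
  open FieldExtension E using (top; ι)
  open Field top using (inverse)
  private
    module K = RingKit (Field.commutativeRing K)
    module ι = IsRingHomomorphism (FieldExtension.isRingHomomorphism E)
    module G = Group (Gal E)
    module k = Field residueField
  open RingKit (Field.commutativeRing top)
  open Polynomials (Field.commutativeRing top)
  open RootPolynomial (Field.commutativeRing top)
  open Valuation K v isDiscreteValuation using (Above; above-cong; above-mono; above-0; above-≡; v-inverse; v≡0)
  open GaloisNorm E isGalois galCard
  open PowerBoundedElements 𝕂 𝕃 galCard
  open ResidueRing 𝕂 𝕃 galCard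
  open Residue isDiscreteValuation using (𝒪)
  open Inverse galCard using (to; from)
  open Automorphism using (⟦_⟧)
  open SetoidReasoning setoid

  private
    module R = RingKit quotient
    module PR = Polynomials quotient

  small-zero : ∀ {x} → Small (x - 0#) → Small x
  small-zero = small-cong (trans (+-congˡ -0#≈0#) (+-identityʳ _))

  zero-small : ∀ {x} → Small x → Small (x - 0#)
  zero-small = small-cong (sym (trans (+-congˡ -0#≈0#) (+-identityʳ _)))

  quotient-noZeroDivisors : NoZeroDivisors quotient
  quotient-noZeroDivisors (x , p) (y , q) s = [ inj₁ ∘ zero-small , inj₂ ∘ zero-small ]′ (small-prime p q (small-zero s))

  quotient-1≉0 : ¬ R.1# R.≈ R.0#
  quotient-1≉0 s = ¬small-1 (small-zero s)

  reduction : k.Carrier → R.Carrier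
  reduction (x , p) = ι x , integral-ι p

  ι-minus : ∀ x y → ι (x K.- y) ≈ ι x - ι y
  ι-minus x y = trans (ι.+-homo _ _) (+-congˡ (ι.-‿homo _))

  reduction-hom : IsRingHomomorphism (Field.rawRing residueField) R.rawRing reduction
  reduction-hom = record
    { isSemiringHomomorphism = record
      { isNearSemiringHomomorphism = record
        { +-isMonoidHomomorphism = record
          { isMagmaHomomorphism = record
            { isRelHomomorphism = record { cong = λ a → small-cong (ι-minus _ _) (small-ι a) }
            ; homo = λ _ _ → ≈⇒∼ (ι.+-homo _ _)
            }
          ; ε-homo = ≈⇒∼ ι.0#-homo
          }
        ; *-homo = λ _ _ → ≈⇒∼ (ι.*-homo _ _)
        }
      ; 1#-homo = ≈⇒∼ ι.1#-homo
      }
    ; -‿homo = λ _ → ≈⇒∼ (ι.-‿homo _)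
    }

  act : Automorphism E → R.Carrier → R.Carrier
  act τ (x , p) = ⟦ τ ⟧ x , integral-automorphism τ p

  act-hom : ∀ τ → IsRingHomomorphism R.rawRing R.rawRing (act τ)
  act-hom τ = record
    { isSemiringHomomorphism = record
      { isNearSemiringHomomorphism = record
        { +-isMonoidHomomorphism = record
          { isMagmaHomomorphism = record
            { isRelHomomorphism = record { cong = λ s → small-cong (AutKit.minus-homo τ _ _) (small-automorphism τ s) }
            ; homo = λ _ _ → ≈⇒∼ (τ.+-homo _ _)
            }
          ; ε-homo = ≈⇒∼ τ.0#-homo
          }
        ; *-homo = λ _ _ → ≈⇒∼ (τ.*-homo _ _)
        }
      ; 1#-homo = ≈⇒∼ τ.1#-homo
      }
    ; -‿homo = λ _ → ≈⇒∼ (τ.-‿homo _)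
    }
    where module τ = Automorphism τ

  power-of : Automorphism E → ℕ → Automorphism E
  power-of τ n = RawMonoidOps._×_ G.rawMonoid n τ

  proj₁-iter-act : ∀ τ n x → proj₁ (iter (act τ) n x) ≡ ⟦ power-of τ n ⟧ (proj₁ x)
  proj₁-iter-act τ zero    x = ≡.refl
  proj₁-iter-act τ (suc n) x = ≡.cong ⟦ τ ⟧ (proj₁-iter-act τ n x)

  act-period : ∀ τ x → iter (act τ) l x R.≈ x
  act-period τ x = ≈⇒∼ (trans (reflexive (proj₁-iter-act τ l x)) (period τ (proj₁ x)))

  open FrobeniusOver residueField (proj₂ residueFinite) quotient quotient-noZeroDivisors quotient-1≉0 reduction reduction-hom
    using (φ; φ-root)

  pb-mulRoot : ∀ {r p cs} → PowerBounded r → PowerBounded p → All PowerBounded cs → All PowerBounded (mulRoot r p cs)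
  pb-mulRoot r p []       = pb-minus p r ∷ []
  pb-mulRoot r p (c ∷ cs) = pb-minus p (pb-* r c) ∷ pb-mulRoot r c cs

  pb-rootsPoly : ∀ {rs} → All PowerBounded rs → All PowerBounded (rootsPoly rs)
  pb-rootsPoly []       = []
  pb-rootsPoly (r ∷ rs) = pb-mulRoot r (integral-pb integral-0) (pb-rootsPoly rs)

  integral-coefficients : ∀ {ks cs} → map ι ks ≋ cs → All PowerBounded cs → ∃ λ (os : List k.Carrier) → map proj₁ os ≡ ks
  integral-coefficients {[]}     []       []       = [] , ≡.refl
  integral-coefficients {k ∷ ks} (e ∷ es) (p ∷ ps) = let os , eq = integral-coefficients es ps in
    (k , integral-ι⁻¹ (pb-integral (pb-cong (sym e) p))) ∷ os , ≡.cong (k ∷_) eq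

  proj₁-ev : ∀ os X → proj₁ (PR.ev R.1# (map reduction os) X) ≡ ev 1# (map ι (map proj₁ os)) (proj₁ X)
  proj₁-ev []       X = ≡.refl
  proj₁-ev (o ∷ os) X = ≡.cong (λ E → ι (proj₁ o) + proj₁ X * E) (proj₁-ev os X)

  proj₁-∏ : ∀ {n} (t : Fin n → R.Carrier) → proj₁ (R.∏ t) ≡ ∏ (proj₁ ∘ t)
  proj₁-∏ {zero}  t = ≡.refl
  proj₁-∏ {suc n} t = ≡.cong (proj₁ (t zero) *_) (proj₁-∏ (t ∘ suc))

  -- The reduction of the characteristic polynomial of x has coefficients in the
  -- residue field of K, which φ fixes; so its roots include φ x.
  frobenius-locally : ∀ x → ∃ λ τ → act τ x R.≈ φ x
  frobenius-locally x = from (proj₁ image) , R.sym {φ x} {act (from (proj₁ image)) x} (proj₂ image)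
    where
    z = proj₁ x
    conjugates-pb : All PowerBounded (conjugates z)
    conjugates-pb = Allₚ.tabulate⁺ (λ i → pb-automorphism (from i) (integral-pb (proj₂ x)))
    coefficients : ∃ λ (os : List k.Carrier) → map proj₁ os ≡ charPoly z
    coefficients = integral-coefficients (ι-charPoly z) (pb-rootsPoly conjugates-pb)
    os = proj₁ coefficients
    t : Fin N → R.Carrier
    t i = act (from i) x
    factorisation : ∀ X → PR.ev R.1# (map reduction os) X R.≈ R.∏ (λ i → X R.- t i)
    factorisation X = ≈⇒∼ (trans (reflexive (≡.trans (proj₁-ev os X) (≡.cong (λ ks → ev 1# (map ι ks) (proj₁ X)) (proj₂ coefficients))))
      (trans (ev-charPoly z (proj₁ X)) (reflexive (≡.sym (proj₁-∏ (λ i → X R.- t i))))))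
    image : ∃ λ k → φ x R.≈ t k
    image = φ-root os t factorisation {x} (to G.ε) (≈⇒∼ (sym (index-correct G.ε z)))

  open ResidueAction residueField (proj₂ residueFinite) quotient quotient-noZeroDivisors quotient-1≉0 reduction reduction-hom
    (Automorphism E) act act-hom (λ τ o → ≈⇒∼ (Automorphism.fixes τ (proj₁ o))) l l-prime act-period frobenius-locally

  small-0 : Small 0#
  small-0 = IsIdealOf.M-0 isIdeal

  small-sum : ∀ {n} (t : Fin n → Carrier) → (∀ i → Small (t i)) → Small (sum t)
  small-sum {zero}  t h = small-0
  small-sum {suc n} t h = small-+ (h zero) (small-sum (t ∘ suc) (h ∘ suc))

  near-1-integral : ∀ {x} → Small (x - 1#) → Integral x
  near-1-integral s = integral-cong (solve 1 (λ x → (x :- :1) :+ :1 := x) refl _)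
    (integral-+ (mkIntegral (above-mono (ℤ.+≤+ ℕ.z≤n) (norm-above-1 s))) integral-1)

  -- As l is nonzero in the residue field, it has valuation 0 in K, so its inverse is integral. A
  -- small l would make 1 small.
  l-not-small : ¬ Small (sum {l} (λ _ → 1#))
  l-not-small s = ¬small-1 (small-cong (begin
    sum {l} (λ _ → 1#) * ι (proj₁ u)    ≈⟨ *-congʳ (sym (ι-multiple l)) ⟩
    ι lᴷ * ι (proj₁ u)                  ≈⟨ sym (ι.*-homo _ _) ⟩
    ι (lᴷ K.* proj₁ u)                  ≈⟨ ι.⟦⟧-cong (proj₂ u) ⟩
    ι K.1#                              ≈⟨ ι.1#-homo ⟩
    1#                                  ∎) (small-* s (integral-ι (above-≡ (v-inverse (proj₂ u) vl)))))
    where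
    multiple : ℕ → 𝒪
    multiple n = RawMonoidOps._×_ k.+-rawMonoid n k.1#
    ι-multiple : ∀ n → ι (proj₁ (multiple n)) ≈ sum {n} (λ _ → 1#)
    ι-multiple zero    = ι.0#-homo
    ι-multiple (suc n) = trans (ι.+-homo _ _) (+-cong ι.1#-homo (ι-multiple n))
    lᴷ : K.Carrier
    lᴷ = proj₁ (multiple l)
    ¬above : ¬ Above 1ℤ lᴷ
    ¬above a = l≉0 (above-cong (K.sym (K.trans (K.+-congˡ K.-0#≈0#) (K.+-identityʳ lᴷ))) a)
    vl : v lᴷ ≡ [ 0ℤ ]
    vl = v≡0 (proj₂ (multiple l)) ¬above
    u : ∃ λ u → lᴷ K.* u K.≈ K.1#
    u = Field.inverse K lᴷ (λ e → ¬above (above-cong (K.sym e) above-0))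

  automorphism-inverse : ∀ (τ : Automorphism E) {x y} → x * y ≈ 1# → ⟦ τ ⟧ x * ⟦ τ ⟧ y ≈ 1#
  automorphism-inverse τ e = trans (sym (Automorphism.*-homo τ _ _)) (trans (Automorphism.⟦⟧-cong τ e) (Automorphism.1#-homo τ))

  -- With y = βx - x ≉ 0, the l terms of Σ βʲy / y are close to 1, but the
  -- sum vanishes because it telescopes to βˡx - x.
  wild⇒trivial : ∀ (β : Automorphism E) → (∀ x x⁻¹ → x * x⁻¹ ≈ 1# → Small ((⟦ β ⟧ x - x) * x⁻¹)) → ∀ x → ⟦ β ⟧ x ≈ x
  wild⇒trivial β wild x = cases (≈0? (⟦ β ⟧ x - x))
    where
    open SumLemmas (Field.commutativeRing top)
    y = ⟦ β ⟧ x - x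
    h : ℕ → Carrier
    h n = ⟦ power-of β n ⟧ x
    β-shift : ∀ n x → ⟦ power-of β n ⟧ (⟦ β ⟧ x) ≡ ⟦ power-of β (suc n) ⟧ x
    β-shift zero    x = ≡.refl
    β-shift (suc n) x = ≡.cong ⟦ β ⟧ (β-shift n x)
    telescope : sum {l} (λ i → ⟦ power-of β (toℕ i) ⟧ y) ≈ 0#
    telescope = begin
      sum {l} (λ i → ⟦ power-of β (toℕ i) ⟧ y)
        ≈⟨ sum-cong-≋ {l} (λ i → trans (AutKit.minus-homo (power-of β (toℕ i)) (⟦ β ⟧ x) x) (+-congʳ (reflexive (β-shift (toℕ i) x)))) ⟩
      sum {l} (λ i → h (suc (toℕ i)) - h (toℕ i))
        ≈⟨ sum-minus {l} (λ i → h (suc (toℕ i))) (λ i → h (toℕ i)) ⟩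
      sum {l} (λ i → h (suc (toℕ i))) - sum {l} (λ i → h (toℕ i))
        ≈⟨ solve 3 (λ a b c → a :- b := (a :+ c) :- (b :+ c)) refl _ _ x ⟩
      (sum {l} (λ i → h (suc (toℕ i))) + h 0) - (sum {l} (λ i → h (toℕ i)) + x)
        ≈⟨ +-cong (sum-shift l h) (-‿cong (+-congˡ (sym (period β x)))) ⟩
      (sum {l} (λ i → h (toℕ i)) + h l) - (sum {l} (λ i → h (toℕ i)) + h l)
        ≈⟨ -‿inverseʳ _ ⟩
      0# ∎
    cases : Dec (y ≈ 0#) → ⟦ β ⟧ x ≈ x
    cases (yes y≈0) = x-y≈0⇒x≈y y≈0
    cases (no y≉0)  = contradiction (small-cong total (small-neg (small-sum {l} _ (λ i → close (toℕ i))))) l-not-small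
      where
      y⁻¹ = proj₁ (inverse y y≉0)
      yy⁻¹≈1 = proj₂ (inverse y y≉0)
      -- With z = βⁿy, the quotient βⁿ⁺¹y / y is (βz / z)(z / y), and wildness puts the first factor
      -- close to 1.
      close : ∀ n → Small (⟦ power-of β n ⟧ y * y⁻¹ - 1#)
      close zero    = small-cong (sym (x≈y⇒x-y≈0 yy⁻¹≈1)) small-0
      close (suc n) = small-cong (begin
        (⟦ β ⟧ z - z) * z⁻¹ * (z * y⁻¹) + (z * y⁻¹ - 1#)
          ≈⟨ solve 4 (λ w z z′ y′ → (w :- z) :* z′ :* (z :* y′) :+ (z :* y′ :- :1) := ((w :- z) :* (z :* z′) :+ z) :* y′ :- :1) refl (⟦ β ⟧ z) z z⁻¹ y⁻¹ ⟩
        ((⟦ β ⟧ z - z) * (z * z⁻¹) + z) * y⁻¹ - 1#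
          ≈⟨ +-congʳ (*-congʳ (+-congʳ (trans (*-congˡ zz⁻¹≈1) (*-identityʳ _)))) ⟩
        (⟦ β ⟧ z - z + z) * y⁻¹ - 1#
          ≈⟨ solve 3 (λ w z y′ → (w :- z :+ z) :* y′ :- :1 := w :* y′ :- :1) refl (⟦ β ⟧ z) z y⁻¹ ⟩
        ⟦ β ⟧ z * y⁻¹ - 1# ∎)
        (small-+ (small-* (wild z z⁻¹ zz⁻¹≈1) (near-1-integral (close n))) (close n))
        where
        z = ⟦ power-of β n ⟧ y
        z⁻¹ = ⟦ power-of β n ⟧ y⁻¹
        zz⁻¹≈1 = automorphism-inverse (power-of β n) yy⁻¹≈1
      total : - sum {l} (λ i → ⟦ power-of β (toℕ i) ⟧ y * y⁻¹ - 1#) ≈ sum {l} (λ _ → 1#)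
      total = begin
        - sum {l} (λ i → ⟦ power-of β (toℕ i) ⟧ y * y⁻¹ - 1#)
          ≈⟨ -‿cong (sum-minus {l} (λ i → ⟦ power-of β (toℕ i) ⟧ y * y⁻¹) (λ _ → 1#)) ⟩
        - (sum {l} (λ i → ⟦ power-of β (toℕ i) ⟧ y * y⁻¹) - sum {l} (λ _ → 1#))
          ≈⟨ -‿cong (+-congʳ (trans (sym (*-distribʳ-sum {l} y⁻¹ (λ i → ⟦ power-of β (toℕ i) ⟧ y))) (trans (*-congʳ telescope) (zeroˡ _)))) ⟩
        - (0# - sum {l} (λ _ → 1#))
          ≈⟨ solve 1 (λ s → :- (con (ℤ.+ 0) :- s) := s) refl _ ⟩
        sum {l} (λ _ → 1#) ∎

  Inertial : Automorphism E → Set c′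
  Inertial α = ∀ x → Integral x → Small (⟦ α ⟧ x - x)

  proj₁-^ : ∀ x n → proj₁ (x R.^ n) ≡ proj₁ x ^ n
  proj₁-^ x zero    = ≡.refl
  proj₁-^ x (suc n) = ≡.cong (proj₁ x *_) (proj₁-^ x n)

  -- For x ≉ 0 the residue ζ of αx / x satisfies ζˡ = 1, so it is fixed by
  -- every σ; hence σαx and ασx agree to first order, and the commutator of
  -- σ and α is wild.
  module _ {α} (inertial : Inertial α) (σ : Automorphism E) where
    module _ {x x⁻¹} (xx⁻¹≈1 : x * x⁻¹ ≈ 1#) where
      private
        ζ u : Carrier
        ζ = ⟦ α ⟧ x * x⁻¹
        u = ⟦ σ ⟧ x * x⁻¹

        ζ-integral : Integral ζ
        ζ-integral = integral-ratio α xx⁻¹≈1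

        u-integral : Integral u
        u-integral = integral-ratio σ xx⁻¹≈1

        -- The quotient αⁿx / x is integral, so the inertial α fixes its residue; hence αⁿ⁺¹x / x =
        -- α(αⁿx / x) · ζ is congruent to (αⁿx / x) · ζ.
        power-close : ∀ n → Small (⟦ power-of α n ⟧ x * x⁻¹ - ζ ^ n)
        power-close zero    = small-cong (sym (x≈y⇒x-y≈0 xx⁻¹≈1)) small-0
        power-close (suc n) = small-cong (begin
          (⟦ α ⟧ (z * x⁻¹) - z * x⁻¹) * ζ + (z * x⁻¹ - ζ ^ n) * ζ
            ≈⟨ solve 4 (λ a b ζ Z → (a :- b) :* ζ :+ (b :- Z) :* ζ := a :* ζ :- ζ :* Z) refl _ (z * x⁻¹) ζ (ζ ^ n) ⟩
          ⟦ α ⟧ (z * x⁻¹) * ζ - ζ * ζ ^ n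
            ≈⟨ +-congʳ (*-congʳ (Automorphism.*-homo α z x⁻¹)) ⟩
          ⟦ α ⟧ z * ⟦ α ⟧ x⁻¹ * (⟦ α ⟧ x * x⁻¹) - ζ * ζ ^ n
            ≈⟨ +-congʳ (solve 4 (λ a b c d → a :* b :* (c :* d) := a :* (c :* b) :* d) refl _ (⟦ α ⟧ x⁻¹) (⟦ α ⟧ x) x⁻¹) ⟩
          ⟦ α ⟧ z * (⟦ α ⟧ x * ⟦ α ⟧ x⁻¹) * x⁻¹ - ζ * ζ ^ n
            ≈⟨ +-congʳ (*-congʳ (trans (*-congˡ (automorphism-inverse α xx⁻¹≈1)) (*-identityʳ _))) ⟩
          ⟦ α ⟧ z * x⁻¹ - ζ * ζ ^ n ∎)
          (small-+ (small-* (inertial (z * x⁻¹) (integral-ratio (power-of α n) xx⁻¹≈1)) ζ-integral) (small-* (power-close n) ζ-integral))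
          where
          z = ⟦ power-of α n ⟧ x

        ζ^l∼1 : (ζ , ζ-integral) R.^ l R.≈ R.1#
        ζ^l∼1 = small-cong (begin
          - (⟦ power-of α l ⟧ x * x⁻¹ - ζ ^ l)  ≈⟨ solve 2 (λ a b → :- (a :- b) := b :- a) refl _ _ ⟩
          ζ ^ l - ⟦ power-of α l ⟧ x * x⁻¹      ≈⟨ +-cong (reflexive (≡.sym (proj₁-^ (ζ , ζ-integral) l)))
                                                    (-‿cong (trans (*-congʳ (period α x)) xx⁻¹≈1)) ⟩
          proj₁ ((ζ , ζ-integral) R.^ l) - 1#   ∎) (small-neg (power-close l))

        ζ-fixed : Small (⟦ σ ⟧ ζ - ζ)
        ζ-fixed = φ-fixed⇒act-fixed {ζ , ζ-integral} (root-of-unity-fixed {ζ , ζ-integral} ζ^l∼1) σ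

        ratio : ∀ z → z ≈ z * x⁻¹ * x
        ratio z = sym (trans (*-assoc _ _ _) (trans (*-congˡ (trans (*-comm _ _) xx⁻¹≈1)) (*-identityʳ z)))

      -- With u = σx / x one has σαx = σζ · σx and ασx = αu · αx. Both are congruent to ζux relative
      -- to x: σ fixes the residue of ζ, and α that of u.
      first-order : Small ((⟦ σ ⟧ (⟦ α ⟧ x) - ⟦ α ⟧ (⟦ σ ⟧ x)) * x⁻¹)
      first-order = small-cong (begin
        (⟦ σ ⟧ ζ - ζ) * u - (⟦ α ⟧ u - u) * ζ
          ≈⟨ solve 4 (λ s ζ a u → (s :- ζ) :* u :- (a :- u) :* ζ := s :* u :- a :* ζ) refl (⟦ σ ⟧ ζ) ζ (⟦ α ⟧ u) u ⟩
        ⟦ σ ⟧ ζ * (⟦ σ ⟧ x * x⁻¹) - ⟦ α ⟧ u * (⟦ α ⟧ x * x⁻¹)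
          ≈⟨ solve 5 (λ a b c d e → a :* (b :* e) :- c :* (d :* e) := (a :* b :- c :* d) :* e) refl _ _ _ _ x⁻¹ ⟩
        (⟦ σ ⟧ ζ * ⟦ σ ⟧ x - ⟦ α ⟧ u * ⟦ α ⟧ x) * x⁻¹
          ≈⟨ *-congʳ (+-cong (image σ (⟦ α ⟧ x)) (-‿cong (image α (⟦ σ ⟧ x)))) ⟩
        (⟦ σ ⟧ (⟦ α ⟧ x) - ⟦ α ⟧ (⟦ σ ⟧ x)) * x⁻¹ ∎)
        (small-+ (small-* ζ-fixed u-integral) (small-neg (small-* (inertial u u-integral) ζ-integral)))
        where
        image : ∀ (τ : Automorphism E) z → ⟦ τ ⟧ (z * x⁻¹) * ⟦ τ ⟧ x ≈ ⟦ τ ⟧ z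
        image τ z = trans (sym (Automorphism.*-homo τ _ _)) (Automorphism.⟦⟧-cong τ (sym (ratio z)))

    inertial-central : σ G.∙ α G.≈ α G.∙ σ
    inertial-central x = begin
      ⟦ σ G.∙ α ⟧ x                        ≈⟨ sym (G.inverseʳ (α G.∙ σ) (⟦ σ G.∙ α ⟧ x)) ⟩
      ⟦ α G.∙ σ ⟧ (⟦ ρ ⟧ (⟦ σ G.∙ α ⟧ x))  ≈⟨ Automorphism.⟦⟧-cong (α G.∙ σ) (wild⇒trivial (ρ G.∙ (σ G.∙ α)) commutator-wild x) ⟩
      ⟦ α G.∙ σ ⟧ x                        ∎
      where
      ρ = (α G.∙ σ) G.⁻¹
      -- ρ carries the estimate for D relative to x to one relative to ρx; the integral factor ρx /
      -- x makes it relative to x again.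
      commutator-wild : ∀ x x⁻¹ → x * x⁻¹ ≈ 1# → Small ((⟦ ρ ⟧ (⟦ σ ⟧ (⟦ α ⟧ x)) - x) * x⁻¹)
      commutator-wild x x⁻¹ e = small-cong (begin
        ⟦ ρ ⟧ (D * x⁻¹) * (⟦ ρ ⟧ x * x⁻¹)              ≈⟨ *-congʳ (Automorphism.*-homo ρ D x⁻¹) ⟩
        ⟦ ρ ⟧ D * ⟦ ρ ⟧ x⁻¹ * (⟦ ρ ⟧ x * x⁻¹)          ≈⟨ solve 4 (λ a b c d → a :* b :* (c :* d) := a :* (c :* b) :* d) refl _ _ _ _ ⟩
        ⟦ ρ ⟧ D * (⟦ ρ ⟧ x * ⟦ ρ ⟧ x⁻¹) * x⁻¹          ≈⟨ *-congʳ (trans (*-congˡ (automorphism-inverse ρ e)) (*-identityʳ _)) ⟩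
        ⟦ ρ ⟧ D * x⁻¹                                  ≈⟨ *-congʳ (AutKit.minus-homo ρ _ _) ⟩
        (⟦ ρ ⟧ (⟦ σ ⟧ (⟦ α ⟧ x)) - ⟦ ρ ⟧ (⟦ α ⟧ (⟦ σ ⟧ x))) * x⁻¹ ≈⟨ *-congʳ (+-congˡ (-‿cong (G.inverseˡ (α G.∙ σ) x))) ⟩
        (⟦ ρ ⟧ (⟦ σ ⟧ (⟦ α ⟧ x)) - x) * x⁻¹            ∎)
        (small-* (small-automorphism ρ (first-order e)) (integral-ratio ρ e))
        where
        D = ⟦ σ ⟧ (⟦ α ⟧ x) - ⟦ α ⟧ (⟦ σ ⟧ x)

  Commute : Automorphism E → Automorphism E → Set _
  Commute α β = α G.∙ β G.≈ β G.∙ α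

  commute-∙ : ∀ {α β γ} → Commute α β → Commute α γ → Commute α (β G.∙ γ)
  commute-∙ {β = β} {γ} e f x = trans (e (⟦ γ ⟧ x)) (Automorphism.⟦⟧-cong β (f x))

  commute-resp : ∀ {α β γ} → β G.≈ γ → Commute α γ → Commute α β
  commute-resp {α} e f x = trans (Automorphism.⟦⟧-cong α (e x)) (trans (f x) (sym (e (⟦ α ⟧ x))))

  commute-power : ∀ {α β} → Commute α β → ∀ n → Commute α (power-of β n)
  commute-power e zero    x = refl
  commute-power {α} {β} e (suc n) = commute-∙ {α} {β} {power-of β n} e (commute-power {α} {β} e n)

  module _ {y} (φy≉y : ¬ φ y R.≈ y) where
    private
      σ₀ : Automorphism E
      σ₀ = proj₁ (frobenius-locally y)

      -- `orbit` gives i with ρy = φⁱy = σ₀ⁱy in the residue ring. So σ₀⁻ⁱρ fixes the residue of y,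
      -- and an element stabilising it acts trivially on the whole residue ring.
      decompose : ∀ ρ → ∃ λ i → ∃ λ α → Inertial α × ρ G.≈ power-of σ₀ i G.∙ α
      decompose ρ = i , κ G.∙ ρ ,
        (λ x p → stabiliser-trivial φy≉y (κ G.∙ ρ) fixes-y (x , p)) ,
        (λ x → sym (G.inverseʳ (power-of σ₀ i) (⟦ ρ ⟧ x)))
        where
        i = proj₁ (orbit φy≉y ρ)
        κ = power-of σ₀ i G.⁻¹
        ρy∼σ₀ⁱy : Small (⟦ ρ ⟧ (proj₁ y) - ⟦ power-of σ₀ i ⟧ (proj₁ y))
        ρy∼σ₀ⁱy = small-cong (+-congˡ (-‿cong (reflexive (proj₁-iter-act σ₀ i y))))
          (R.trans {act ρ y} {iter φ i y} {iter (act σ₀) i y} (proj₂ (proj₂ (orbit φy≉y ρ)))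
            (R.sym {iter (act σ₀) i y} {iter φ i y} (frobenius-iterates σ₀ {y} (proj₂ (frobenius-locally y)) i)))
        fixes-y : act (κ G.∙ ρ) y R.≈ y
        fixes-y = small-cong (trans (AutKit.minus-homo κ _ _) (+-congˡ (-‿cong (G.inverseˡ (power-of σ₀ i) (proj₁ y)))))
          (small-automorphism κ ρy∼σ₀ⁱy)

      commute-decomposed : ∀ α → Commute α σ₀ → ∀ ρ → Commute α ρ
      commute-decomposed α e ρ = let i , β , inertial , eq = decompose ρ in
        commute-resp {α} {ρ} {power-of σ₀ i G.∙ β} eq
          (commute-∙ {α} {power-of σ₀ i} {β} (commute-power {α} {σ₀} e i) (inertial-central {β} inertial α))

    -- The decomposition is used twice: σ₀ commutes with itself, hence with σ; therefore σ commutes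
    -- with σ₀, hence with τ.
    frobenius-nontrivial⇒commute : ∀ σ τ → Commute σ τ
    frobenius-nontrivial⇒commute σ τ = commute-decomposed σ (λ x → sym (commute-decomposed σ₀ (λ _ → refl) σ x)) τ

  -- If στ and τσ differed at x, no y could satisfy φy ≉ y, so φ would be trivial on the residue
  -- ring. Then every residue lies in F and is fixed by G, so τ is inertial and hence central after
  -- all.
  commutative : Commutative G._≈_ G._∙_
  commutative σ τ x = Dec.decidable-stable (⟦ σ ⟧ (⟦ τ ⟧ x) ≟ ⟦ τ ⟧ (⟦ σ ⟧ x)) λ ¬commute →
    let φ-trivial : ∀ y → φ y R.≈ y
        φ-trivial y = Dec.decidable-stable (small? (proj₁ (φ y) - proj₁ y)) λ φy≉y →
          ¬commute (frobenius-nontrivial⇒commute {y} φy≉y σ τ x)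
    in ¬commute (inertial-central {τ} (λ z p → φ-fixed⇒act-fixed {z , p} (φ-trivial (z , p)) τ) σ x)

-- The residue characteristic and transport along isomorphisms

characteristic-nonzero : ∀ {c ℓ} (F : Field c ℓ) {p l} → HasCharacteristic F p → Prime l → p ≢ l →
  ¬ Field._≈_ F (RawMonoidOps._×_ (Field.+-rawMonoid F) l (Field.1# F)) (Field.0# F)
characteristic-nonzero F {p} {l} char l-prime p≢l e = [ p≡1⇒⊥ , p≢l ]′ (prime⇒irreducible l-prime (Equivalence.to (char l) e))
  where
  open Field F
  p≡1⇒⊥ : ¬ p ≡ 1
  p≡1⇒⊥ ≡.refl = 1≉0 (trans (sym (+-identityʳ 1#)) (Equivalence.from (char 1) (1∣ 1)))

module GroupIsomorphism {a b c ℓ} (G : Group a b) (H : Group c ℓ) (f : Group.Carrier G → Group.Carrier H)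
  (iso : IsGroupIsomorphism (Group.rawGroup G) (Group.rawGroup H) f) where
  private
    module G = Group G
    module H = Group H
  open IsGroupIsomorphism iso

  preimage : H.Carrier → G.Carrier
  preimage y = proj₁ (surjective y)

  f-preimage : ∀ y → f (preimage y) H.≈ y
  f-preimage y = proj₂ (surjective y) G.refl

  cardinality : ∀ {n} → HasCardinality H.setoid n → HasCardinality G.setoid n
  cardinality card = record
    { to        = to ∘ f
    ; from      = preimage ∘ from
    ; to-cong   = to-cong ∘ ⟦⟧-cong
    ; from-cong = λ { ≡.refl → G.refl }
    ; inverse   = (λ {i} x≈ → ≡.trans (to-cong (H.trans (⟦⟧-cong x≈) (f-preimage (from i)))) (inverseˡ H.refl))
                , (λ {x} e → injective (H.trans (f-preimage _) (inverseʳ e)))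
    }
    where open Inverse card

  commutative : Commutative G._≈_ G._∙_ → Commutative H._≈_ H._∙_
  commutative comm x y = begin
    x H.∙ y                               ≈⟨ H.sym (H.∙-cong (f-preimage x) (f-preimage y)) ⟩
    f (preimage x) H.∙ f (preimage y)     ≈⟨ H.sym (∙-homo _ _) ⟩
    f (preimage x G.∙ preimage y)         ≈⟨ ⟦⟧-cong (comm _ _) ⟩
    f (preimage y G.∙ preimage x)         ≈⟨ ∙-homo _ _ ⟩
    f (preimage y) H.∙ f (preimage x)     ≈⟨ H.∙-cong (f-preimage y) (f-preimage x) ⟩
    y H.∙ x                               ∎
    where open SetoidReasoning H.setoid

  killed : ∀ {n} → KilledBy H n → KilledBy G n
  killed {n} k x = injective (H.trans (power-homo n) (H.trans (k (f x)) (H.sym ε-homo)))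
    where
    power-homo : ∀ n → f (RawMonoidOps._×_ G.rawMonoid n x) H.≈ RawMonoidOps._×_ H.rawMonoid n (f x)
    power-homo zero    = ε-homo
    power-homo (suc n) = H.trans (∙-homo _ _) (H.∙-congˡ (power-homo n))

corollary8p8 : ∀ {a b c ℓ c′ ℓ′} (l : ℕ) → Prime l → l ≢ 2 →
    (ℌ : Group a b) → IsHeisenberg ℌ l →
    (K : LocalField c ℓ) (p : ℕ) →
    HasCharacteristic (LocalField.residueField K) p → p ≢ l →
    ¬ (Σ[ L ∈ FiniteGaloisExtension (LocalField.baseField K) c′ ℓ′ ]
    Gal (FiniteGaloisExtension.extension L) ≅ ℌ)
corollary8p8 l l-prime _ ℌ isHeisenberg K p char p≢l (L , f , iso) =
  nonCommutative (I.commutative (TameGalois.commutative K L (I.cardinality order) l l-prime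
    (characteristic-nonzero (LocalField.residueField K) char l-prime p≢l)
    (I.killed {l} (HasExponent.kills exponent))))
  where
  open IsHeisenberg isHeisenberg
  module I = GroupIsomorphism (Gal (FiniteGaloisExtension.extension L)) ℌ f iso
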